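{- For every integer $r\geq 3$ and every real number $\xi$ with $0<\xi \leq \frac{3}{13+8\log_2 r}$, there exists $n_0\in\mathbb{N}$ such that for all integers $n\geq n_0$ the following holds: if $A\subseteq [n]$ and $|A|\geq (1-\xi)n$, then $$g_r(A)\le\binom{r}{2} 2^{|A|}+2^{ -\frac{n}{36\log_2n}}2^n.$$
   Context: $[n]=\{1,2,\ldots,n\}$. A 3-term arithmetic progression (3-AP) of $A\subseteq[n]$ is a sequence $a, a+d, a+2d$ of elements of $A$ with $d\in[n]$ (so $d\ge 1$). An $r$-coloring of $A$ is any map $c\colon A\to[r]$ (not necessarily surjective). A 3-AP of $A$ is rainbow under $c$ if its three terms have pairwise distinct colors; $c$ is rainbow 3-AP-free if no 3-AP of $A$ is rainbow. $g_r(A)$ denotes the number of rainbow 3-AP-free $r$-colorings of $A$. -}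

module Defs where

open import Algebra.Bundles using (CommutativeRing)
import Algebra.Properties.CommutativeSemiring.Exp as Exp
open import Data.Empty using (⊥-elim)
open import Data.Fin using (Fin; toℕ)
open import Data.Fin.Properties as Fin using (all?; any?)
open import Data.Fin.Subset using (Subset; inside; outside; _∈_; ∣_∣)
open import Data.Fin.Subset.Properties using (_∈?_)
open import Data.Integer as ℤ using (ℤ; +_; -[1+_])
import Data.Integer.Properties as ℤ
open import Data.List using (List; []; _∷_; allFin; cartesianProductWith; filter; length; map)
open import Data.List.Membership.Propositional using () renaming (_∈_ to _∈ˡ_)
open import Data.List.Membership.Propositional.Properties
  using (∈-allFin; ∈-cartesianProductWith⁺; ∈-map⁺)
open import Data.List.Relation.Unary.All using ([])
open import Data.List.Relation.Unary.AllPairs using ([]; _∷_)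
import Data.List.Relation.Unary.Any as Any
open import Data.List.Relation.Unary.Unique.Propositional using (Unique)
open import Data.List.Relation.Unary.Unique.Propositional.Properties
  using (allFin⁺; cartesianProductWith⁺; map⁺)
open import Data.Nat as ℕ using (ℕ; zero; suc; NonZero; NonTrivial)
import Data.Nat.Properties as ℕ
open import Data.Product using (∃; _×_; _,_)
open import Data.Rational hiding (NonZero; Positive; positive)
open import Data.Rational as ℚ using ()
open import Data.Rational.Properties
open import Data.Rational.Solver using (module +-*-Solver)
import Data.Rational.Unnormalised as ℚᵘ
import Data.Rational.Unnormalised.Properties as ℚᵘ
open import Data.Sum as Sum using (_⊎_; inj₁; inj₂)
open import Data.Vec using ([]; _∷_; here; there)
open import Data.Vec.Properties.WithK using ([]=-irrelevant)
open import Relation.Binary using (tri<; tri≈; tri>)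
open import Relation.Binary.PropositionalEquality
open import Relation.Nullary using (¬_; Dec; yes; no; ¬?; _×-dec_; _→-dec_)
import Relation.Nullary.Decidable as Dec
open +-*-Solver using (solve; _:+_; _:*_; _:-_; :-_; _:=_)

open Exp (CommutativeRing.commutativeSemiring +-*-commutativeRing)
  using (_^_; ^-homo-*; ^-assocʳ)

ι : ℕ → ℚ
ι n = + n / 1

2ℚ : ℚ
2ℚ = ι 2

0<1 : 0ℚ < 1ℚ
0<1 = positive⁻¹ 1ℚ

p<q⇒0<q-p : ∀ {p q} → p < q → 0ℚ < q - p
p<q⇒0<q-p {p} {q} p<q = subst (_< q - p) (+-inverseʳ p) (+-monoˡ-< (- p) p<q)

p<p+q : ∀ p {q} → 0ℚ < q → p < p + q
p<p+q p {q} h = subst (_< p + q) (+-identityʳ p) (+-monoʳ-< p h)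

p-q<p : ∀ p {q} → 0ℚ < q → p - q < p
p-q<p p {q} h = subst (p - q <_) (+-identityʳ p) (+-monoʳ-< p (neg-antimono-< h))

*-monoˡ : ∀ {r p q} → 0ℚ ≤ r → p ≤ q → r * p ≤ r * q
*-monoˡ {r} 0≤r = *-monoˡ-≤-nonNeg r {{nonNegative 0≤r}}

*-monoʳ : ∀ {r p q} → 0ℚ ≤ r → p ≤ q → p * r ≤ q * r
*-monoʳ {r} 0≤r = *-monoʳ-≤-nonNeg r {{nonNegative 0≤r}}

*-mono-≤ : ∀ {a b c d} → 0ℚ ≤ b → 0ℚ ≤ c → a ≤ b → c ≤ d → a * c ≤ b * d
*-mono-≤ 0≤b 0≤c a≤b c≤d = ≤-trans (*-monoʳ 0≤c a≤b) (*-monoˡ 0≤b c≤d)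

*-monoˡ-< : ∀ {r p q} → 0ℚ < r → p < q → r * p < r * q
*-monoˡ-< {r} 0<r = *-monoʳ-<-pos r {{ℚ.positive 0<r}}

*-monoʳ-< : ∀ {r p q} → 0ℚ < r → p < q → p * r < q * r
*-monoʳ-< {r} 0<r = *-monoˡ-<-pos r {{ℚ.positive 0<r}}

0≤* : ∀ {p q} → 0ℚ ≤ p → 0ℚ ≤ q → 0ℚ ≤ p * q
0≤* {p} {q} 0≤p 0≤q = subst (_≤ p * q) (*-zeroʳ p) (*-monoˡ 0≤p 0≤q)

0<* : ∀ {p q} → 0ℚ < p → 0ℚ < q → 0ℚ < p * q
0<* {p} {q} 0<p 0<q = subst (_< p * q) (*-zeroʳ p) (*-monoˡ-< 0<p 0<q)

0≤+ : ∀ {p q} → 0ℚ ≤ p → 0ℚ ≤ q → 0ℚ ≤ p + q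
0≤+ = +-mono-≤

0<+ : ∀ {p q} → 0ℚ < p → 0ℚ ≤ q → 0ℚ < p + q
0<+ = +-mono-<-≤

0<⊓ : ∀ {p q} → 0ℚ < p → 0ℚ < q → 0ℚ < p ⊓ q
0<⊓ {p} {q} 0<p 0<q with ⊓-sel p q
... | inj₁ e = subst (0ℚ <_) (sym e) 0<p
... | inj₂ e = subst (0ℚ <_) (sym e) 0<q

inverse : ∀ {p} → 0ℚ < p → ∃ λ p⁻¹ → 0ℚ < p⁻¹ × p * p⁻¹ ≡ 1ℚ
inverse {p} 0<p =
  1/ p , positive⁻¹ (1/ p) {{1/pos⇒pos p}} , *-inverseʳ p
  where instance
    _ = ℚ.positive 0<p
    _ = pos⇒nonZero p

*-inverse-cancel : ∀ {e K K⁻¹} → K * K⁻¹ ≡ 1ℚ → e * K⁻¹ * K ≡ e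
*-inverse-cancel {e} {K} {K⁻¹} eq =
  trans (solve 3 (λ e k i → e :* i :* k := e :* (k :* i)) refl e K K⁻¹)
        (trans (cong (e *_) eq) (*-identityʳ e))

small : ∀ {m e K} → 0ℚ < m → 0ℚ < e → 0ℚ < K →
        ∃ λ δ → 0ℚ < δ × δ < m × δ * K < e
small {m} {e} {K} 0<m 0<e 0<K =
  let (K⁻¹ , 0<K⁻¹ , eq) = inverse 0<K
      b = e * K⁻¹
      (δ , 0<δ , δ<) = <-dense (0<⊓ 0<m (0<* 0<e 0<K⁻¹))
  in δ , 0<δ , <-≤-trans δ< (p⊓q≤p m b) ,
     subst (δ * K <_) (*-inverse-cancel eq) (*-monoʳ-< 0<K (<-≤-trans δ< (p⊓q≤q m b)))

toℚᵘ-/ : ∀ k m .{{_ : NonZero m}} → toℚᵘ (k / m) ℚᵘ.≃ (k ℚᵘ./ m)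
toℚᵘ-/ k (suc m) = toℚᵘ-fromℚᵘ (ℚᵘ.mkℚᵘ k m)

/-cross : ∀ k m .{{_ : NonZero m}} → ↥ (k / m) ℤ.* + m ≡ k ℤ.* ↧ (k / m)
/-cross k (suc m) with toℚᵘ-/ k (suc m)
... | e with k / suc m
...   | mkℚ _ _ _ with ℚᵘ.*≡* eq ← e = eq

</-cross : ∀ q k m .{{_ : NonZero m}} → ↥ q ℤ.* + m ℤ.< k ℤ.* ↧ q → q < k / m
</-cross q@record{} k (suc m) h =
  toℚᵘ-cancel-< (ℚᵘ.<-respʳ-≃ (ℚᵘ.≃-sym (toℚᵘ-/ k (suc m))) (ℚᵘ.*<* h))

/<-cross : ∀ q k m .{{_ : NonZero m}} → k ℤ.* ↧ q ℤ.< ↥ q ℤ.* + m → k / m < q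
/<-cross q@record{} k (suc m) h =
  toℚᵘ-cancel-< (ℚᵘ.<-respˡ-≃ (ℚᵘ.≃-sym (toℚᵘ-/ k (suc m))) (ℚᵘ.*<* h))

ι-suc : ∀ n → ι (suc n) ≡ 1ℚ + ι n
ι-suc n = toℚᵘ-injective (ℚᵘ.≃-trans (toℚᵘ-/ (+ suc n) 1)
  (ℚᵘ.≃-sym (ℚᵘ.≃-trans (toℚᵘ-homo-+ 1ℚ (ι n))
    (ℚᵘ.≃-trans (ℚᵘ.+-congʳ ℚᵘ.1ℚᵘ (toℚᵘ-/ (+ n) 1)) (ℚᵘ.*≡* eq)))))
  where
  eq : (+ 1 ℤ.+ + n ℤ.* + 1) ℤ.* + 1 ≡ + suc n ℤ.* + 1
  eq = cong (λ k → (+ 1 ℤ.+ k) ℤ.* + 1) (ℤ.*-identityʳ (+ n))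

0≤ι : ∀ n → 0ℚ ≤ ι n
0≤ι zero    = ≤-refl
0≤ι (suc n) = subst (0ℚ ≤_) (sym (ι-suc n)) (0≤+ (<⇒≤ 0<1) (0≤ι n))

0<ι-suc : ∀ n → 0ℚ < ι (suc n)
0<ι-suc n = subst (0ℚ <_) (sym (ι-suc n)) (0<+ 0<1 (0≤ι n))

archimedean : ∀ q → ∃ λ n → q < ι n
archimedean q@(mkℚ i d-1 _) = suc ℤ.∣ i ∣ , </-cross q (+ suc ℤ.∣ i ∣) 1 (begin-strict
  i ℤ.* + 1              ≡⟨ ℤ.*-identityʳ i ⟩
  i                      ≤⟨ i≤∣i∣ i ⟩
  + ℤ.∣ i ∣              <⟨ ℤ.+<+ (ℕ.n<1+n _) ⟩
  + suc ℤ.∣ i ∣          ≡⟨ ℤ.*-identityʳ _ ⟨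
  + suc ℤ.∣ i ∣ ℤ.* + 1  ≤⟨ ℤ.*-monoˡ-≤-nonNeg (+ suc ℤ.∣ i ∣) (ℤ.+≤+ (ℕ.s≤s ℕ.z≤n)) ⟩
  + suc ℤ.∣ i ∣ ℤ.* + suc d-1 ∎)
  where
  open ℤ.≤-Reasoning
  i≤∣i∣ : ∀ i → i ℤ.≤ + ℤ.∣ i ∣
  i≤∣i∣ (+ n)    = ℤ.≤-refl
  i≤∣i∣ -[1+ n ] = ℤ.-≤+

archimedean* : ∀ K {e} → 0ℚ < e → ∃ λ n → K < ι n * e
archimedean* K {e} 0<e with inverse 0<e
... | e⁻¹ , 0<e⁻¹ , eq with archimedean (K * e⁻¹)
...   | n , h = n , subst (_< ι n * e) (*-inverse-cancel eq)
  (*-monoʳ-< 0<e h)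

0≤^ : ∀ {x} n → 0ℚ ≤ x → 0ℚ ≤ x ^ n
0≤^ zero    0≤x = <⇒≤ 0<1
0≤^ (suc n) 0≤x = 0≤* 0≤x (0≤^ n 0≤x)

0<^ : ∀ {x} n → 0ℚ < x → 0ℚ < x ^ n
0<^ zero    0<x = 0<1
0<^ (suc n) 0<x = 0<* 0<x (0<^ n 0<x)

^-mono-≤ : ∀ {x y} n → 0ℚ ≤ x → x ≤ y → x ^ n ≤ y ^ n
^-mono-≤ zero    0≤x x≤y = ≤-refl
^-mono-≤ (suc n) 0≤x x≤y =
  *-mono-≤ (≤-trans 0≤x x≤y) (0≤^ n 0≤x) x≤y (^-mono-≤ n 0≤x x≤y)

^-mono-< : ∀ {x y} n .{{_ : NonZero n}} → 0ℚ ≤ x → x < y → x ^ n < y ^ n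
^-mono-< {x} {y} (suc n) 0≤x x<y =
  ≤-<-trans (*-monoˡ 0≤x (^-mono-≤ n 0≤x (<⇒≤ x<y)))
            (*-monoʳ-< (0<^ n (≤-<-trans 0≤x x<y)) x<y)

^-cancel-< : ∀ {x y} n → 0ℚ ≤ y → x ^ n < y ^ n → x < y
^-cancel-< {x} {y} n 0≤y h with <-cmp x y
... | tri< x<y _ _ = x<y
... | tri≈ _ refl _ = ⊥-elim (<-irrefl refl h)
... | tri> _ _ y<x = ⊥-elim (<-irrefl refl (<-≤-trans h (^-mono-≤ n 0≤y (<⇒≤ y<x))))

^-swap : ∀ x b d → (x ^ b) ^ d ≡ (x ^ d) ^ b
^-swap x b d = trans (^-assocʳ x b d)
  (trans (cong (x ^_) (ℕ.*-comm b d)) (sym (^-assocʳ x d b)))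

x≤x^ : ∀ {x} n .{{_ : NonZero n}} → 1ℚ ≤ x → x ≤ x ^ n
x≤x^ {x} (suc n) 1≤x = subst (_≤ x * x ^ n) (*-identityʳ x)
  (*-monoˡ (≤-trans (<⇒≤ 0<1) 1≤x)
    (subst (_≤ x ^ n) (1^ n) (^-mono-≤ n (<⇒≤ 0<1) 1≤x)))
  where
  1^ : ∀ n → 1ℚ ^ n ≡ 1ℚ
  1^ zero    = refl
  1^ (suc n) = trans (*-identityˡ (1ℚ ^ n)) (1^ n)

*-continuous↑ : ∀ {x y z} → 0ℚ ≤ x → 0ℚ ≤ z → x * z < y →
                ∃ λ δ → 0ℚ < δ × (x + δ) * (z + δ) < y
*-continuous↑ {x} {y} {z} 0≤x 0≤z h =
  let 0<K = subst (0ℚ <_) (+-comm 1ℚ (x + z)) (0<+ 0<1 (0≤+ 0≤x 0≤z))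
      (δ , 0<δ , δ<1 , δK) = small 0<1 (p<q⇒0<q-p h) 0<K
  in δ , 0<δ , bound 0<δ δ<1 δK
  where
  open ≤-Reasoning
  bound : ∀ {δ} → 0ℚ < δ → δ < 1ℚ → δ * (x + z + 1ℚ) < y - x * z →
          (x + δ) * (z + δ) < y
  bound {δ} 0<δ δ<1 δK = begin-strict
    (x + δ) * (z + δ)         ≡⟨ solve 3 (λ x z d → (x :+ d) :* (z :+ d) := x :* z :+ d :* (x :+ z :+ d)) refl x z δ ⟩
    x * z + δ * (x + z + δ)   <⟨ +-monoʳ-< (x * z) (*-monoˡ-< 0<δ (+-monoʳ-< (x + z) δ<1)) ⟩
    x * z + δ * (x + z + 1ℚ)  <⟨ +-monoʳ-< (x * z) δK ⟩
    x * z + (y - x * z)       ≡⟨ solve 2 (λ a y → a :+ (y :- a) := y) refl (x * z) y ⟩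
    y ∎

*-continuous↓ : ∀ {x y z} → 0ℚ < x → 0ℚ < z → y < x * z →
                ∃ λ δ → 0ℚ < δ × δ < x × δ < z × y < (x - δ) * (z - δ)
*-continuous↓ {x} {y} {z} 0<x 0<z h =
  let (δ , 0<δ , δ<m , δK) =
        small (0<⊓ 0<x 0<z) (p<q⇒0<q-p h) (0<+ 0<x (<⇒≤ 0<z))
  in δ , 0<δ , <-≤-trans δ<m (p⊓q≤p x z) , <-≤-trans δ<m (p⊓q≤q x z) , bound 0<δ δK
  where
  open ≤-Reasoning
  bound : ∀ {δ} → 0ℚ < δ → δ * (x + z) < x * z - y → y < (x - δ) * (z - δ)
  bound {δ} 0<δ δK = begin-strict
    y                              ≡⟨ solve 2 (λ a y → y := a :- (a :- y)) refl (x * z) y ⟩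
    x * z - (x * z - y)            <⟨ +-monoʳ-< (x * z) (neg-antimono-< δK) ⟩
    x * z - δ * (x + z)            <⟨ p<p+q (x * z - δ * (x + z)) (0<* 0<δ 0<δ) ⟩
    x * z - δ * (x + z) + δ * δ    ≡⟨ solve 3 (λ x z d → x :* z :- d :* (x :+ z) :+ d :* d := (x :- d) :* (z :- d)) refl x z δ ⟩
    (x - δ) * (z - δ) ∎

^-continuous↑ : ∀ {x y} n → 0ℚ ≤ x → x ^ n < y → ∃ λ x′ → x < x′ × x′ ^ n < y
^-continuous↑ {x} zero 0≤x h = x + 1ℚ , p<p+q x 0<1 , h
^-continuous↑ {x} {y} (suc n) 0≤x h =
  let (δ , 0<δ , bound) = *-continuous↑ 0≤x (0≤^ n 0≤x) h
      (x₂ , x<x₂ , x₂ⁿ) = ^-continuous↑ n 0≤x (p<p+q (x ^ n) 0<δ)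
  in pick (p<p+q x 0<δ) x<x₂ (<⇒≤ x₂ⁿ) bound (≤-total (x + δ) x₂)
  where
  pick : ∀ {x₁ x₂ z} → x < x₁ → x < x₂ → x₂ ^ n ≤ z → x₁ * z < y →
         x₁ ≤ x₂ ⊎ x₂ ≤ x₁ → ∃ λ x′ → x < x′ × x′ ^ suc n < y
  pick {x₁} x<x₁ x<x₂ x₂ⁿ bound (inj₁ le) = x₁ , x<x₁ ,
    ≤-<-trans (*-monoˡ 0≤x₁ (≤-trans (^-mono-≤ n 0≤x₁ le) x₂ⁿ)) bound
    where 0≤x₁ = ≤-trans 0≤x (<⇒≤ x<x₁)
  pick {x₁} {x₂} x<x₁ x<x₂ x₂ⁿ bound (inj₂ le) = x₂ , x<x₂ ,
    ≤-<-trans (*-mono-≤ (≤-trans 0≤x (<⇒≤ x<x₁)) (0≤^ n (≤-trans 0≤x (<⇒≤ x<x₂))) le x₂ⁿ) bound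

^-continuous↓ : ∀ {x y} n → 0ℚ < x → y < x ^ n →
                ∃ λ x′ → 0ℚ ≤ x′ × x′ < x × y < x′ ^ n
^-continuous↓ zero 0<x h = 0ℚ , ≤-refl , 0<x , h
^-continuous↓ {x} {y} (suc n) 0<x h =
  let (δ , 0<δ , δ<x , δ<z , bound) = *-continuous↓ 0<x (0<^ n 0<x) h
      (x₂ , 0≤x₂ , x₂<x , x₂ⁿ) = ^-continuous↓ n 0<x (p-q<p (x ^ n) 0<δ)
  in pick (<⇒≤ (p<q⇒0<q-p δ<x)) (<⇒≤ (p<q⇒0<q-p δ<z)) (p-q<p x 0<δ)
          0≤x₂ x₂<x (<⇒≤ x₂ⁿ) bound (≤-total (x - δ) x₂)
  where
  pick : ∀ {x₁ x₂ z} → 0ℚ ≤ x₁ → 0ℚ ≤ z → x₁ < x → 0ℚ ≤ x₂ → x₂ < x → z ≤ x₂ ^ n →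
         y < x₁ * z → x₁ ≤ x₂ ⊎ x₂ ≤ x₁ → ∃ λ x′ → 0ℚ ≤ x′ × x′ < x × y < x′ ^ suc n
  pick {x₂ = x₂} 0≤x₁ 0≤z x₁<x 0≤x₂ x₂<x x₂ⁿ bound (inj₁ le) = x₂ , 0≤x₂ , x₂<x ,
    <-≤-trans bound (*-mono-≤ 0≤x₂ 0≤z le x₂ⁿ)
  pick {x₁} 0≤x₁ 0≤z x₁<x 0≤x₂ x₂<x x₂ⁿ bound (inj₂ le) = x₁ , 0≤x₁ , x₁<x ,
    <-≤-trans bound (*-monoˡ 0≤x₁ (≤-trans x₂ⁿ (^-mono-≤ n 0≤x₂ le)))

bernoulli : ∀ {y ε} n → 0ℚ < y → 0ℚ < ε →
            y ^ n * (y + ι n * ε) ≤ (y + ε) ^ n * y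
bernoulli {y} {ε} zero 0<y 0<ε =
  ≤-reflexive (cong (1ℚ *_) (trans (cong (λ k → y + k) (*-zeroˡ ε)) (+-identityʳ y)))
bernoulli {y} {ε} (suc n) 0<y 0<ε = begin
  y * u * (y + ι (suc n) * ε)                ≡⟨ cong (λ k → y * u * (y + k * ε)) (ι-suc n) ⟩
  y * u * (y + (1ℚ + m) * ε)                 ≡⟨ cong (λ k → y * u * (y + k)) (trans (*-distribʳ-+ ε 1ℚ m) (cong (_+ m * ε) (*-identityˡ ε))) ⟩
  y * u * (y + (ε + m * ε))                  ≡⟨ +-identityʳ _ ⟨
  y * u * (y + (ε + m * ε)) + 0ℚ             ≤⟨ +-monoʳ-≤ (y * u * (y + (ε + m * ε))) (0≤* (0≤^ n (<⇒≤ 0<y)) (0≤* (0≤ι n) (0≤* (<⇒≤ 0<ε) (<⇒≤ 0<ε)))) ⟩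
  y * u * (y + (ε + m * ε)) + u * (m * (ε * ε))
    ≡⟨ solve 4 (λ y u e m → y :* u :* (y :+ (e :+ m :* e)) :+ u :* (m :* (e :* e))
         := (y :+ e) :* (u :* (y :+ m :* e))) refl y u ε m ⟩
  (y + ε) * (u * (y + m * ε))                ≤⟨ *-monoˡ (0≤+ (<⇒≤ 0<y) (<⇒≤ 0<ε)) (bernoulli n 0<y 0<ε) ⟩
  (y + ε) * ((y + ε) ^ n * y)                ≡⟨ *-assoc (y + ε) ((y + ε) ^ n) y ⟨
  (y + ε) * (y + ε) ^ n * y ∎
  where
  open ≤-Reasoning
  u = y ^ n
  m = ι n

ι<ι-suc : ∀ n → ι n < ι (suc n)
ι<ι-suc n = subst (ι n <_) (trans (+-comm (ι n) 1ℚ) (sym (ι-suc n))) (p<p+q (ι n) 0<1)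

^-archimedean : ∀ {y z} C → 0ℚ < y → y < z → ∃ λ n → C * y ^ suc n < z ^ suc n
^-archimedean {y} {z} C 0<y y<z =
  let (n , h) = archimedean* (C * y) 0<ε
  in n , bound (suc n) (<-trans h (*-monoʳ-< 0<ε (ι<ι-suc n)))
  where
  open ≤-Reasoning
  0<ε = p<q⇒0<q-p y<z
  bound : ∀ n → C * y < ι n * (z - y) → C * y ^ n < z ^ n
  bound n h = *-cancelʳ-<-nonNeg y {{nonNegative (<⇒≤ 0<y)}} (begin-strict
    C * y ^ n * y               ≡⟨ solve 3 (λ c u y → c :* u :* y := u :* (c :* y)) refl C (y ^ n) y ⟩
    y ^ n * (C * y)             <⟨ *-monoˡ-< (0<^ n 0<y) h ⟩
    y ^ n * (ι n * (z - y))     ≡⟨ cong (y ^ n *_) (+-identityˡ (ι n * (z - y))) ⟨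
    y ^ n * (0ℚ + ι n * (z - y)) <⟨ *-monoˡ-< (0<^ n 0<y) (+-monoˡ-< (ι n * (z - y)) 0<y) ⟩
    y ^ n * (y + ι n * (z - y)) ≤⟨ bernoulli n 0<y 0<ε ⟩
    (y + (z - y)) ^ n * y       ≡⟨ cong (λ k → k ^ n * y) (solve 2 (λ y z → y :+ (z :- y) := z) refl y z) ⟩
    z ^ n * y ∎)

2^ᶻ : ℤ → ℚ
2^ᶻ (+ n)    = 2ℚ ^ n
2^ᶻ -[1+ n ] = ½ ^ suc n

0<2ℚ : 0ℚ < 2ℚ
0<2ℚ = positive⁻¹ 2ℚ

0<½ : 0ℚ < ½
0<½ = positive⁻¹ ½

0<2^ᶻ : ∀ k → 0ℚ < 2^ᶻ k
0<2^ᶻ (+ n)    = 0<^ n 0<2ℚ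
0<2^ᶻ -[1+ n ] = 0<^ (suc n) 0<½

2^ᶻ-suc : ∀ k → 2^ᶻ (ℤ.suc k) ≡ 2ℚ * 2^ᶻ k
2^ᶻ-suc (+ n)          = refl
2^ᶻ-suc -[1+ zero ]    = refl
2^ᶻ-suc -[1+ suc n ]   =
  trans (sym (*-identityˡ (½ ^ suc n))) (*-assoc 2ℚ ½ (½ ^ suc n))

1≤2^ : ∀ n → 1ℚ ≤ 2ℚ ^ n
1≤2^ zero    = ≤-refl
1≤2^ (suc n) = *-mono-≤ {1ℚ} {2ℚ} {1ℚ} (<⇒≤ 0<2ℚ) (<⇒≤ 0<1) (Dec.toWitness {a? = 1ℚ ≤? 2ℚ} _) (1≤2^ n)

½<1 : ½ < 1ℚ
½<1 = Dec.toWitness {a? = ½ <? 1ℚ} _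

½^≤1 : ∀ n → ½ ^ n ≤ 1ℚ
½^≤1 zero    = ≤-refl
½^≤1 (suc n) = *-mono-≤ {½} {1ℚ} {½ ^ n} {1ℚ} (<⇒≤ 0<1) (0≤^ n (<⇒≤ 0<½)) (<⇒≤ ½<1) (½^≤1 n)

2^ᶻ-mono-≤ : ∀ {a b} → a ℤ.≤ b → 2^ᶻ a ≤ 2^ᶻ b
2^ᶻ-mono-≤ (ℤ.+≤+ {m} {n} m≤n) =
  subst₂ _≤_ (*-identityʳ (2ℚ ^ m))
    (trans (sym (^-homo-* 2ℚ m (n ℕ.∸ m))) (cong (2ℚ ^_) (ℕ.m+[n∸m]≡n m≤n)))
    (*-monoˡ (0≤^ m (<⇒≤ 0<2ℚ)) (1≤2^ (n ℕ.∸ m)))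
2^ᶻ-mono-≤ (ℤ.-≤+ {m} {n}) = ≤-trans (½^≤1 (suc m)) (1≤2^ n)
2^ᶻ-mono-≤ (ℤ.-≤- {m} {n} n≤m) =
  subst₂ _≤_
    (trans (sym (^-homo-* ½ (suc n) (m ℕ.∸ n))) (cong (λ k → ½ ^ suc k) (ℕ.m+[n∸m]≡n n≤m)))
    (*-identityʳ (½ ^ suc n))
    (*-monoˡ (0≤^ (suc n) (<⇒≤ 0<½)) (½^≤1 (m ℕ.∸ n)))

x<2x : ∀ {x} → 0ℚ < x → x < 2ℚ * x
x<2x {x} 0<x = subst (_< 2ℚ * x) (*-identityˡ x)
  (*-monoʳ-< 0<x (Dec.toWitness {a? = 1ℚ <? 2ℚ} _))

2^ᶻ-mono-< : ∀ {a b} → a ℤ.< b → 2^ᶻ a < 2^ᶻ b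
2^ᶻ-mono-< {a} {b} a<b = <-≤-trans (x<2x (0<2^ᶻ a))
  (subst (_≤ 2^ᶻ b) (2^ᶻ-suc a) (2^ᶻ-mono-≤ (ℤ.i<j⇒suc[i]≤j a<b)))

2^ᶻ-^ : ∀ a d → 2^ᶻ (a ℤ.* + d) ≡ 2^ᶻ a ^ d
2^ᶻ-^ (+ n)    d       = trans (cong 2^ᶻ (sym (ℤ.pos-* n d))) (sym (^-assocʳ 2ℚ n d))
2^ᶻ-^ -[1+ n ] zero    = cong 2^ᶻ (ℤ.*-zeroʳ -[1+ n ])
2^ᶻ-^ -[1+ n ] (suc d) = sym (^-assocʳ ½ (suc n) (suc d))

cross-<2^ : ∀ {x} a b c d .{{_ : NonZero b}} .{{_ : NonZero d}} → 0ℚ ≤ x →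
            a ℤ.* + d ℤ.≤ c ℤ.* + b → x ^ b < 2^ᶻ a → x ^ d < 2^ᶻ c
cross-<2^ {x} a b c d 0≤x le h = ^-cancel-< b (<⇒≤ (0<2^ᶻ c)) (begin-strict
  (x ^ d) ^ b        ≡⟨ ^-swap x d b ⟩
  (x ^ b) ^ d        <⟨ ^-mono-< d (0≤^ b 0≤x) h ⟩
  2^ᶻ a ^ d          ≡⟨ 2^ᶻ-^ a d ⟨
  2^ᶻ (a ℤ.* + d)    ≤⟨ 2^ᶻ-mono-≤ le ⟩
  2^ᶻ (c ℤ.* + b)    ≡⟨ 2^ᶻ-^ c b ⟩
  2^ᶻ c ^ b ∎)
  where open ≤-Reasoning

cross-≤2^ : ∀ {x} a b c d .{{_ : NonZero b}} .{{_ : NonZero d}} → 0ℚ ≤ x →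
            a ℤ.* + d ℤ.< c ℤ.* + b → x ^ b ≤ 2^ᶻ a → x ^ d < 2^ᶻ c
cross-≤2^ {x} a b c d 0≤x lt h = ^-cancel-< b (<⇒≤ (0<2^ᶻ c)) (begin-strict
  (x ^ d) ^ b        ≡⟨ ^-swap x d b ⟩
  (x ^ b) ^ d        ≤⟨ ^-mono-≤ d (0≤^ b 0≤x) h ⟩
  2^ᶻ a ^ d          ≡⟨ 2^ᶻ-^ a d ⟨
  2^ᶻ (a ℤ.* + d)    <⟨ 2^ᶻ-mono-< lt ⟩
  2^ᶻ (c ℤ.* + b)    ≡⟨ 2^ᶻ-^ c b ⟩
  2^ᶻ c ^ b ∎)
  where open ≤-Reasoning

cross->2^ : ∀ {x} a b c d .{{_ : NonZero b}} .{{_ : NonZero d}} → 0ℚ ≤ x →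
            c ℤ.* + b ℤ.≤ a ℤ.* + d → 2^ᶻ a < x ^ b → 2^ᶻ c < x ^ d
cross->2^ {x} a b c d 0≤x le h = ^-cancel-< b (0≤^ d 0≤x) (begin-strict
  2^ᶻ c ^ b          ≡⟨ 2^ᶻ-^ c b ⟨
  2^ᶻ (c ℤ.* + b)    ≤⟨ 2^ᶻ-mono-≤ le ⟩
  2^ᶻ (a ℤ.* + d)    ≡⟨ 2^ᶻ-^ a d ⟩
  2^ᶻ a ^ d          <⟨ ^-mono-< d (<⇒≤ (0<2^ᶻ a)) h ⟩
  (x ^ b) ^ d        ≡⟨ ^-swap x b d ⟩
  (x ^ d) ^ b ∎)
  where open ≤-Reasoning

-- q <2^ s and q >2^ s compare q with 2 ^ s for rational s = a / b, as
-- q ^ b against 2 ^ a; clamping q at 0 makes negative q smaller than 2 ^ s.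

infix 4 _<2^_ _>2^_

_<2^_ _>2^_ : ℚ → ℚ → Set
q <2^ s = (0ℚ ⊔ q) ^ ↧ₙ s < 2^ᶻ (↥ s)
q >2^ s = 2^ᶻ (↥ s) < (0ℚ ⊔ q) ^ ↧ₙ s

0≤0⊔ : ∀ q → 0ℚ ≤ 0ℚ ⊔ q
0≤0⊔ q = p≤p⊔q 0ℚ q

<2^-monoʳ : ∀ {q s t} → s ≤ t → q <2^ s → q <2^ t
<2^-monoʳ {q} {s@record{}} {t@record{}} s≤t =
  cross-<2^ (↥ s) (↧ₙ s) (↥ t) (↧ₙ t) (0≤0⊔ q) (drop-*≤* s≤t)

>2^-monoʳ : ∀ {q s t} → t ≤ s → q >2^ s → q >2^ t
>2^-monoʳ {q} {s@record{}} {t@record{}} t≤s =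
  cross->2^ (↥ s) (↧ₙ s) (↥ t) (↧ₙ t) (0≤0⊔ q) (drop-*≤* t≤s)

<2^-monoˡ : ∀ {p q} s → p ≤ q → q <2^ s → p <2^ s
<2^-monoˡ {p} s p≤q = ≤-<-trans (^-mono-≤ (↧ₙ s) (0≤0⊔ p) (⊔-monoʳ-≤ 0ℚ p≤q))

>2^-monoˡ : ∀ {p q} s → p ≤ q → p >2^ s → q >2^ s
>2^-monoˡ {p} s p≤q h = <-≤-trans h (^-mono-≤ (↧ₙ s) (0≤0⊔ p) (⊔-monoʳ-≤ 0ℚ p≤q))

<2^-/ : ∀ {q} k m .{{_ : NonZero m}} → (0ℚ ⊔ q) ^ m < 2^ᶻ k → q <2^ (k / m)
<2^-/ {q} k m = cross-<2^ k m (↥ (k / m)) (↧ₙ (k / m)) (0≤0⊔ q) (ℤ.≤-reflexive (sym (/-cross k m)))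

>2^-/ : ∀ {q} k m .{{_ : NonZero m}} → 2^ᶻ k < (0ℚ ⊔ q) ^ m → q >2^ (k / m)
>2^-/ {q} k m = cross->2^ k m (↥ (k / m)) (↧ₙ (k / m)) (0≤0⊔ q) (ℤ.≤-reflexive (/-cross k m))

0^ : ∀ n .{{_ : NonZero n}} → 0ℚ ^ n ≡ 0ℚ
0^ (suc n) = *-zeroˡ (0ℚ ^ n)

0<2^ : ∀ s → 0ℚ <2^ s
0<2^ s = subst (_< 2^ᶻ (↥ s)) (sym (0^ (↧ₙ s))) (0<2^ᶻ (↥ s))

>2^-positive : ∀ {q} s → q >2^ s → 0ℚ < q
>2^-positive {q} s h with q ≤? 0ℚ
... | yes q≤0 = ⊥-elim (<-asym h (<2^-monoˡ s q≤0 (0<2^ s)))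
... | no  q≰0 = ≰⇒> q≰0

n<2^n : ∀ n → ι n < 2ℚ ^ n
n<2^n zero    = 0<1
n<2^n (suc n) = begin-strict
  ι (suc n)          ≡⟨ ι-suc n ⟩
  1ℚ + ι n           <⟨ +-mono-≤-< (1≤2^ n) (n<2^n n) ⟩
  2ℚ ^ n + 2ℚ ^ n    ≡⟨ cong₂ _+_ (*-identityˡ (2ℚ ^ n)) (*-identityˡ (2ℚ ^ n)) ⟨
  1ℚ * 2ℚ ^ n + 1ℚ * 2ℚ ^ n ≡⟨ *-distribʳ-+ (2ℚ ^ n) 1ℚ 1ℚ ⟨
  2ℚ * 2ℚ ^ n ∎
  where open ≤-Reasoning

½^*2^ : ∀ n → ½ ^ n * 2ℚ ^ n ≡ 1ℚ
½^*2^ zero    = refl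
½^*2^ (suc n) = trans
  (solve 4 (λ h t u v → h :* u :* (t :* v) := (h :* t) :* (u :* v)) refl ½ 2ℚ (½ ^ n) (2ℚ ^ n))
  (trans (*-identityˡ _) (½^*2^ n))

⌊log₂_⌋ : ∀ {y} → 0ℚ < y → ∃ λ k → 2^ᶻ k ≤ y × y < 2^ᶻ (ℤ.suc k)
⌊log₂_⌋ {y} 0<y =
  let (u , y<u)  = archimedean y
      (v , 1<vy) = archimedean* 1ℚ 0<y
  in search (v ℕ.+ u) (ℤ.- (+ v)) (lo v 1<vy) (hi u v y<u)
  where
  search : ∀ N k → 2^ᶻ k ≤ y → y < 2^ᶻ (+ N ℤ.+ k) →
           ∃ λ k → 2^ᶻ k ≤ y × y < 2^ᶻ (ℤ.suc k)
  search zero k h h′ =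
    ⊥-elim (<-irrefl refl (≤-<-trans h (subst (λ j → y < 2^ᶻ j) (ℤ.+-identityˡ k) h′)))
  search (suc N) k h h′ with y <? 2^ᶻ (ℤ.suc k)
  ... | yes lt = k , h , lt
  ... | no ¬lt = search N (ℤ.suc k) (≮⇒≥ ¬lt)
    (subst (λ j → y < 2^ᶻ j)
      (trans (cong (λ j → j ℤ.+ k) (trans (cong +_ (ℕ.+-comm 1 N)) (ℤ.pos-+ N 1)))
             (ℤ.+-assoc (+ N) (+ 1) k)) h′)
  2^ᶻ-neg : ∀ v → 2^ᶻ (ℤ.- (+ v)) ≡ ½ ^ v
  2^ᶻ-neg zero    = refl
  2^ᶻ-neg (suc v) = refl
  lo : ∀ v → 1ℚ < ι v * y → 2^ᶻ (ℤ.- (+ v)) ≤ y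
  lo v 1<vy = subst (_≤ y) (sym (2^ᶻ-neg v)) (*-cancelʳ-≤-pos (2ℚ ^ v) {{ℚ.positive (0<^ v 0<2ℚ)}} (begin
    ½ ^ v * 2ℚ ^ v    ≡⟨ ½^*2^ v ⟩
    1ℚ                ≤⟨ <⇒≤ 1<vy ⟩
    ι v * y           ≡⟨ *-comm (ι v) y ⟩
    y * ι v           ≤⟨ *-monoˡ (<⇒≤ 0<y) (<⇒≤ (n<2^n v)) ⟩
    y * 2ℚ ^ v ∎))
    where open ≤-Reasoning
  hi : ∀ u v → y < ι u → y < 2^ᶻ (+ (v ℕ.+ u) ℤ.+ ℤ.- (+ v))
  hi u v y<u = subst (λ j → y < 2^ᶻ j)
    (sym (trans (cong (ℤ._+ ℤ.- (+ v)) (trans (cong +_ (ℕ.+-comm v u)) (ℤ.pos-+ u v)))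
      (trans (ℤ.+-assoc (+ u) (+ v) (ℤ.- (+ v)))
        (trans (cong (ℤ._+_ (+ u)) (ℤ.+-inverseʳ (+ v))) (ℤ.+-identityʳ (+ u))))))
    (<-trans y<u (n<2^n u))

separate : ∀ {p q} → 0ℚ < p → p < q →
           ∃ λ m → ∃ λ k → p ^ suc m < 2^ᶻ k × 2^ᶻ (ℤ.suc k) < q ^ suc m
separate {p} {q} 0<p p<q =
  let (m , h)        = ^-archimedean (2ℚ * 2ℚ) 0<p p<q
      (k , lo , hi)  = ⌊log₂ 0<^ (suc m) 0<p ⌋
  in m , ℤ.suc k , hi , ≤-<-trans (bound k lo) h
  where
  open ≤-Reasoning
  bound : ∀ k {y} → 2^ᶻ k ≤ y → 2^ᶻ (ℤ.suc (ℤ.suc k)) ≤ 2ℚ * 2ℚ * y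
  bound k {y} lo = begin
    2^ᶻ (ℤ.suc (ℤ.suc k))   ≡⟨ 2^ᶻ-suc (ℤ.suc k) ⟩
    2ℚ * 2^ᶻ (ℤ.suc k)      ≡⟨ cong (2ℚ *_) (2^ᶻ-suc k) ⟩
    2ℚ * (2ℚ * 2^ᶻ k)       ≡⟨ *-assoc 2ℚ 2ℚ (2^ᶻ k) ⟨
    2ℚ * 2ℚ * 2^ᶻ k         ≤⟨ *-monoˡ (<⇒≤ (0<* 0<2ℚ 0<2ℚ)) lo ⟩
    2ℚ * 2ℚ * y ∎

i<suc[i] : ∀ i → i ℤ.< ℤ.suc i
i<suc[i] i = ℤ.suc[i]≤j⇒i<j ℤ.≤-refl

pred[i]<i : ∀ i → ℤ.pred i ℤ.< i
pred[i]<i i = ℤ.suc[i]≤j⇒i<j {ℤ.pred i} (ℤ.≤-reflexive (ℤ.suc-pred i))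

/-suc : ∀ k m → k / suc m < ℤ.suc k / suc m
/-suc k m = </-cross (k / suc m) (ℤ.suc k) (suc m)
  (subst (ℤ._< ℤ.suc k ℤ.* ↧ (k / suc m)) (sym (/-cross k (suc m)))
    (ℤ.*-monoʳ-<-pos (↧ (k / suc m)) (i<suc[i] k)))

-- Two-sided located Dedekind cuts. With η, instance search for Positive would
-- compare reals field by field.

record ℝ : Set₁ where
  no-eta-equality
  field
    L U         : ℚ → Set
    L-inhabited : ∃ L
    U-inhabited : ∃ U
    L-closed    : ∀ {p q} → p < q → L q → L p
    U-closed    : ∀ {p q} → p < q → U p → U q
    L-rounded   : ∀ {q} → L q → ∃ λ r → q < r × L r
    U-rounded   : ∀ {q} → U q → ∃ λ r → r < q × U r
    disjoint    : ∀ {q} → L q → ¬ U q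
    located     : ∀ {p q} → p < q → L p ⊎ U q

open ℝ

infix 4 _<ᴿ_ _≤ᴿ_

_<ᴿ_ : ℝ → ℝ → Set
x <ᴿ y = ∃ λ q → U x q × L y q

_≤ᴿ_ : ℝ → ℝ → Set
x ≤ᴿ y = ∀ q → L x q → L y q

L<U : ∀ x {a b} → L x a → U x b → a < b
L<U x {a} {b} la ub with <-cmp a b
... | tri< lt _ _   = lt
... | tri≈ _ refl _ = ⊥-elim (disjoint x la ub)
... | tri> _ _ gt   = ⊥-elim (disjoint x (L-closed x gt la) ub)

approximate : ∀ x {ε} → 0ℚ < ε → ∃ λ a → L x a × U x (a + ε)
approximate x {ε} 0<ε =
  let (δ , 0<δ , _ , δ2<ε) = small {ε} {ε} {2ℚ} 0<ε 0<ε 0<2ℚ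
      (a , la)     = L-inhabited x
      (b , ub)     = U-inhabited x
      (N , h)      = archimedean* (b - a) 0<δ
      (c , lc , u) = search 0<δ N a la (U-closed x (gap a b N h) ub)
  in c , lc , U-closed x (+-monoʳ-< c (subst (_< ε) (trans (*-distribˡ-+ δ 1ℚ 1ℚ) (cong₂ _+_ (*-identityʳ δ) (*-identityʳ δ))) δ2<ε)) u
  where
  gap : ∀ a b N {δ} → b - a < ι N * δ → b < a + ι N * δ
  gap a b N {δ} h = subst (_< a + ι N * δ)
    (solve 2 (λ a b → a :+ (b :- a) := b) refl a b) (+-monoʳ-< a h)
  search : ∀ {δ} → 0ℚ < δ → ∀ N a → L x a → U x (a + ι N * δ) →
           ∃ λ c → L x c × U x (c + (δ + δ))
  search {δ} 0<δ zero a la u = ⊥-elim (disjoint x la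
    (subst (U x) (trans (cong (λ k → a + k) (*-zeroˡ δ)) (+-identityʳ a)) u))
  search {δ} 0<δ (suc N) a la u with located x (+-monoʳ-< a (p<p+q δ 0<δ))
  ... | inj₂ u′ = a , la , u′
  ... | inj₁ l′ = search 0<δ N (a + δ) l′ (subst (U x) eq u)
    where
    eq : a + ι (suc N) * δ ≡ a + δ + ι N * δ
    eq = trans (cong (λ k → a + k * δ) (ι-suc N))
      (trans (cong (λ k → a + k) (trans (*-distribʳ-+ δ 1ℚ (ι N)) (cong (_+ ι N * δ) (*-identityˡ δ))))
             (sym (+-assoc a δ (ι N * δ))))

fromℕ : ℕ → ℝ
fromℕ n .L           = _< ι n
fromℕ n .U           = ι n <_
fromℕ n .L-inhabited = ι n - 1ℚ , p-q<p (ι n) 0<1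
fromℕ n .U-inhabited = ι n + 1ℚ , p<p+q (ι n) 0<1
fromℕ n .L-closed    = <-trans
fromℕ n .U-closed    = λ p<q n<p → <-trans n<p p<q
fromℕ n .L-rounded   = <-dense
fromℕ n .U-rounded   = λ n<q → let (r , l , u) = <-dense n<q in r , u , l
fromℕ n .disjoint    = <-asym
fromℕ n .located     = loc
  where
  loc : ∀ {p q} → p < q → p < ι n ⊎ ι n < q
  loc {p} p<q with p <? ι n
  ... | yes p<n = inj₁ p<n
  ... | no  p≮n = inj₂ (≤-<-trans (≮⇒≥ p≮n) p<q)

infixl 6 _+ᴿ_ _-ᴿ_
infixr 7 _·_
infix  8 -ᴿ_ 2^ᴿ_
infix  9 _⁻¹

_+ᴿ_ : ℝ → ℝ → ℝ
(x +ᴿ y) .L           = λ q → ∃ λ a → ∃ λ b → L x a × L y b × q < a + b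
(x +ᴿ y) .U           = λ q → ∃ λ a → ∃ λ b → U x a × U y b × a + b < q
(x +ᴿ y) .L-inhabited =
  let (a , la) = L-inhabited x
      (b , lb) = L-inhabited y
  in a + b - 1ℚ , a , b , la , lb , p-q<p (a + b) 0<1
(x +ᴿ y) .U-inhabited =
  let (a , ua) = U-inhabited x
      (b , ub) = U-inhabited y
  in a + b + 1ℚ , a , b , ua , ub , p<p+q (a + b) 0<1
(x +ᴿ y) .L-closed    = λ p<q (a , b , la , lb , h) → a , b , la , lb , <-trans p<q h
(x +ᴿ y) .U-closed    = λ p<q (a , b , ua , ub , h) → a , b , ua , ub , <-trans h p<q
(x +ᴿ y) .L-rounded   = λ (a , b , la , lb , h) →
  let (r , l , u) = <-dense h in r , l , a , b , la , lb , u
(x +ᴿ y) .U-rounded   = λ (a , b , ua , ub , h) →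
  let (r , l , u) = <-dense h in r , u , a , b , ua , ub , l
(x +ᴿ y) .disjoint    = λ (a , b , la , lb , h) (a′ , b′ , ua , ub , h′) →
  <-asym (<-trans h (+-mono-< (L<U x la ua) (L<U y lb ub))) h′
(x +ᴿ y) .located     = loc
  where
  loc : ∀ {p q} → p < q →
        (∃ λ a → ∃ λ b → L x a × L y b × p < a + b) ⊎
        (∃ λ a → ∃ λ b → U x a × U y b × a + b < q)
  loc {p} {q} p<q =
    let 0<e = p<q⇒0<q-p p<q
        (ε , 0<ε , _ , ε2<) = small 0<e 0<e 0<2ℚ
        (a , la , ua) = approximate x 0<ε
        (b , lb , ub) = approximate y 0<ε
    in pick la ua lb ub (subst (_< q - p) (trans (*-distribˡ-+ ε 1ℚ 1ℚ) (cong₂ _+_ (*-identityʳ ε) (*-identityʳ ε))) ε2<)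
    where
    open ≤-Reasoning
    pick : ∀ {a b ε} → L x a → U x (a + ε) → L y b → U y (b + ε) → ε + ε < q - p →
           (∃ λ a → ∃ λ b → L x a × L y b × p < a + b) ⊎
           (∃ λ a → ∃ λ b → U x a × U y b × a + b < q)
    pick {a} {b} {ε} la ua lb ub h with p <? a + b
    ... | yes lt = inj₁ (a , b , la , lb , lt)
    ... | no ¬lt = inj₂ (a + ε , b + ε , ua , ub , (begin-strict
      a + ε + (b + ε)    ≡⟨ solve 3 (λ a b e → a :+ e :+ (b :+ e) := a :+ b :+ (e :+ e)) refl a b ε ⟩
      a + b + (ε + ε)    <⟨ +-mono-≤-< (≮⇒≥ ¬lt) h ⟩
      p + (q - p)        ≡⟨ solve 2 (λ p q → p :+ (q :- p) := q) refl p q ⟩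
      q ∎))

neg² : ∀ q → - (- q) ≡ q
neg² = solve 1 (λ q → :- (:- q) := q) refl

-ᴿ_ : ℝ → ℝ
(-ᴿ x) .L           = λ q → U x (- q)
(-ᴿ x) .U           = λ q → L x (- q)
(-ᴿ x) .L-inhabited = let (q , u) = U-inhabited x in - q , subst (U x) (sym (neg² q)) u
(-ᴿ x) .U-inhabited = let (q , l) = L-inhabited x in - q , subst (L x) (sym (neg² q)) l
(-ᴿ x) .L-closed    = λ p<q → U-closed x (neg-antimono-< p<q)
(-ᴿ x) .U-closed    = λ p<q → L-closed x (neg-antimono-< p<q)
(-ᴿ x) .L-rounded {q} = λ u → let (r , r<-q , ur) = U-rounded x u in
  - r , subst (_< - r) (neg² q) (neg-antimono-< r<-q) , subst (U x) (sym (neg² r)) ur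
(-ᴿ x) .U-rounded {q} = λ l → let (r , -q<r , lr) = L-rounded x l in
  - r , subst (- r <_) (neg² q) (neg-antimono-< -q<r) , subst (L x) (sym (neg² r)) lr
(-ᴿ x) .disjoint    = λ u l → disjoint x l u
(-ᴿ x) .located     = λ p<q → Sum.swap (located x (neg-antimono-< p<q))

_-ᴿ_ : ℝ → ℝ → ℝ
x -ᴿ y = x +ᴿ (-ᴿ y)

_·_ : ℕ → ℝ → ℝ
(n · x) .L           = λ q → ∃ λ a → L x a × q < ι n * a
(n · x) .U           = λ q → ∃ λ b → U x b × ι n * b < q
(n · x) .L-inhabited = let (a , la) = L-inhabited x in ι n * a - 1ℚ , a , la , p-q<p (ι n * a) 0<1
(n · x) .U-inhabited = let (b , ub) = U-inhabited x in ι n * b + 1ℚ , b , ub , p<p+q (ι n * b) 0<1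
(n · x) .L-closed    = λ p<q (a , la , h) → a , la , <-trans p<q h
(n · x) .U-closed    = λ p<q (b , ub , h) → b , ub , <-trans h p<q
(n · x) .L-rounded   = λ (a , la , h) → let (r , l , u) = <-dense h in r , l , a , la , u
(n · x) .U-rounded   = λ (b , ub , h) → let (r , l , u) = <-dense h in r , u , b , ub , l
(n · x) .disjoint    = λ (a , la , h) (b , ub , h′) →
  <-asym (<-≤-trans h (*-monoˡ (0≤ι n) (<⇒≤ (L<U x la ub)))) h′
(n · x) .located     = loc
  where
  loc : ∀ {p q} → p < q → (∃ λ a → L x a × p < ι n * a) ⊎ (∃ λ b → U x b × ι n * b < q)
  loc {p} {q} p<q =
    let 0<e = p<q⇒0<q-p p<q
        (ε , 0<ε , _ , εK<) = small 0<e 0<e (0<+ 0<1 (0≤ι n))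
        (a , la , ua) = approximate x 0<ε
    in pick la ua 0<ε εK<
    where
    open ≤-Reasoning
    pick : ∀ {a ε} → L x a → U x (a + ε) → 0ℚ < ε → ε * (1ℚ + ι n) < q - p →
           (∃ λ a → L x a × p < ι n * a) ⊎ (∃ λ b → U x b × ι n * b < q)
    pick {a} {ε} la ua 0<ε h with p <? ι n * a
    ... | yes lt = inj₁ (a , la , lt)
    ... | no ¬lt = inj₂ (a + ε , ua , (begin-strict
      ι n * (a + ε)            ≡⟨ *-distribˡ-+ (ι n) a ε ⟩
      ι n * a + ι n * ε        ≤⟨ +-monoˡ-≤ (ι n * ε) (≮⇒≥ ¬lt) ⟩
      p + ι n * ε              ≡⟨ cong (λ k → p + k) (*-comm (ι n) ε) ⟩
      p + ε * ι n              <⟨ +-monoʳ-< p (*-monoˡ-< 0<ε (p<p+q (ι n) 0<1)) ⟩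
      p + ε * (ι n + 1ℚ)       ≡⟨ cong (λ k → p + ε * k) (+-comm (ι n) 1ℚ) ⟩
      p + ε * (1ℚ + ι n)       <⟨ +-monoʳ-< p h ⟩
      p + (q - p)              ≡⟨ solve 2 (λ p q → p :+ (q :- p) := q) refl p q ⟩
      q ∎))

record Positive (x : ℝ) : Set where
  constructor mkPositive
  field positive : fromℕ 0 <ᴿ x

open Positive {{...}}

*-cancelʳ-< : ∀ {r p q} → 0ℚ < r → p * r < q * r → p < q
*-cancelʳ-< {r} 0<r = *-cancelʳ-<-nonNeg r {{nonNegative (<⇒≤ 0<r)}}

module _ {p i q : ℚ} (0<p : 0ℚ < p) (pi≡1 : p * i ≡ 1ℚ) where

  private
    ip≡1 : i * p ≡ 1ℚ
    ip≡1 = trans (*-comm i p) pi≡1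

  <inverse⇒<1 : q < i → q * p < 1ℚ
  <inverse⇒<1 h = subst (q * p <_) ip≡1 (*-monoʳ-< {p} {q} {i} 0<p h)

  <1⇒<inverse : q * p < 1ℚ → q < i
  <1⇒<inverse h = *-cancelʳ-< {p} {q} {i} 0<p (subst (q * p <_) (sym ip≡1) h)

  inverse<⇒1< : i < q → 1ℚ < q * p
  inverse<⇒1< h = subst (_< q * p) ip≡1 (*-monoʳ-< {p} {i} {q} 0<p h)

  1<⇒inverse< : 1ℚ < q * p → i < q
  1<⇒inverse< h = *-cancelʳ-< {p} {i} {q} 0<p (subst (_< q * p) (sym ip≡1) h)

0<U : ∀ {x b} {{_ : Positive x}} → U x b → 0ℚ < b
0<U {x} ub = let (a , 0<a , la) = positive in <-trans 0<a (L<U x la ub)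

inverse-anti : ∀ {p q i j} → 0ℚ < i → 0ℚ < j → p * i ≡ 1ℚ → q * j ≡ 1ℚ → p < q → j < i
inverse-anti {p} {q} {i} {j} 0<i 0<j pi≡1 qj≡1 p<q =
  subst₂ _<_
    (trans (solve 3 (λ p i j → p :* (i :* j) := p :* i :* j) refl p i j)
           (trans (cong (_* j) pi≡1) (*-identityˡ j)))
    (trans (solve 3 (λ q i j → q :* (i :* j) := q :* j :* i) refl q i j)
           (trans (cong (_* i) qj≡1) (*-identityˡ i)))
    (*-monoʳ-< (0<* 0<i 0<j) p<q)

-- q < 1 / x iff q b < 1 for some b > x, since every such b is positive.

_⁻¹ : (x : ℝ) {{_ : Positive x}} → ℝ
(x ⁻¹) .L           = λ q → ∃ λ b → U x b × q * b < 1ℚ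
(x ⁻¹) .U           = λ q → ∃ λ a → L x a × 0ℚ < a × 1ℚ < q * a
(x ⁻¹) .L-inhabited = let (b , ub) = U-inhabited x in
  0ℚ , b , ub , subst (_< 1ℚ) (sym (*-zeroˡ b)) 0<1
(x ⁻¹) .U-inhabited =
  let (a , 0<a , la)  = positive
      (i , _ , ai≡1)  = inverse 0<a
  in i + 1ℚ , a , la , 0<a , inverse<⇒1< {a} {i} 0<a ai≡1 (p<p+q i 0<1)
(x ⁻¹) .L-closed {p} {q} = λ p<q (b , ub , h) → b , ub , <-trans (*-monoʳ-< {b} {p} {q} (0<U {x} ub) p<q) h
(x ⁻¹) .U-closed {p} {q} = λ p<q (a , la , 0<a , h) → a , la , 0<a , <-trans h (*-monoʳ-< {a} {p} {q} 0<a p<q)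
(x ⁻¹) .L-rounded {q} = λ (b , ub , h) →
  let (i , _ , bi≡1)  = inverse (0<U {x} ub)
      (r , q<r , r<i) = <-dense (<1⇒<inverse {b} {i} {q} (0<U {x} ub) bi≡1 h)
  in r , q<r , b , ub , <inverse⇒<1 {b} {i} {r} (0<U {x} ub) bi≡1 r<i
(x ⁻¹) .U-rounded {q} = λ (a , la , 0<a , h) →
  let (i , _ , ai≡1)  = inverse 0<a
      (r , i<r , r<q) = <-dense (1<⇒inverse< {a} {i} {q} 0<a ai≡1 h)
  in r , r<q , a , la , 0<a , inverse<⇒1< {a} {i} {r} 0<a ai≡1 i<r
(x ⁻¹) .disjoint {q} = λ (b , ub , qb<1) (a , la , 0<a , 1<qa) →
  let 0<q = *-cancelʳ-< {a} {0ℚ} {q} 0<a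
              (subst (_< q * a) (sym (*-zeroˡ a)) (<-trans 0<1 1<qa))
  in <-asym (<-trans 1<qa (*-monoˡ-< {q} {a} {b} 0<q (L<U x la ub))) qb<1
(x ⁻¹) .located     = loc
  where
  loc : ∀ {p q} → p < q → (∃ λ b → U x b × p * b < 1ℚ) ⊎ (∃ λ a → L x a × 0ℚ < a × 1ℚ < q * a)
  loc {p} {q} p<q with p ≤? 0ℚ
  ... | yes p≤0 =
    let (b , ub) = U-inhabited x
    in inj₁ (b , ub , ≤-<-trans (subst (p * b ≤_) (*-zeroˡ b) (*-monoʳ (<⇒≤ (0<U {x} ub)) p≤0)) 0<1)
  ... | no p≰0 =
    let 0<p = ≰⇒> p≰0
        0<q = <-trans 0<p p<q
        (i , 0<i , pi≡1) = inverse 0<p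
        (j , 0<j , qj≡1) = inverse 0<q
    in pick 0<p 0<q 0<j pi≡1 qj≡1 (located x (inverse-anti 0<i 0<j pi≡1 qj≡1 p<q))
    where
    pick : ∀ {i j} → 0ℚ < p → 0ℚ < q → 0ℚ < j → p * i ≡ 1ℚ → q * j ≡ 1ℚ → L x j ⊎ U x i →
           (∃ λ b → U x b × p * b < 1ℚ) ⊎ (∃ λ a → L x a × 0ℚ < a × 1ℚ < q * a)
    pick 0<p 0<q 0<j pi≡1 qj≡1 (inj₁ lj) = let (a , j<a , la) = L-rounded x lj in
      inj₂ (a , la , <-trans 0<j j<a , subst (_< q * a) qj≡1 (*-monoˡ-< 0<q j<a))
    pick 0<p 0<q 0<j pi≡1 qj≡1 (inj₂ ui) = let (b , b<i , ub) = U-rounded x ui in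
      inj₁ (b , ub , subst (p * b <_) pi≡1 (*-monoˡ-< 0<p b<i))

-- 2 ^ (a / b) < n iff 2 ^ a < n ^ b; restricted to n ≥ 2, where log₂ n > 0.

module Log₂ (n : ℕ) .{{_ : NonTrivial n}} where

  instance
    n≢0 : NonZero n
    n≢0 = ℕ.nonTrivial⇒nonZero n
  -1ℚ = ℤ.- (+ 1) / 1
  z = 0ℚ ⊔ ι n

  1≤ι : ∀ n .{{_ : NonZero n}} → 1ℚ ≤ ι n
  1≤ι (suc n) = subst (1ℚ ≤_) (sym (ι-suc n)) (subst (_≤ 1ℚ + ι n) (+-identityʳ 1ℚ) (+-monoʳ-≤ 1ℚ (0≤ι n)))
  0<z : 0ℚ < z
  0<z = <-≤-trans 0<1 (≤-trans (1≤ι n) (p≤q⊔p 0ℚ (ι n)))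
  ½<n : ½ * 1ℚ < z * 1ℚ
  ½<n = *-monoʳ-< 0<1 (<-≤-trans ½<1 (≤-trans (1≤ι n) (p≤q⊔p 0ℚ (ι n))))

  rounded↑ : ∀ q → ι n >2^ q → ∃ λ r → q < r × ι n >2^ r
  rounded↑ q@(mkℚ a b-1 _) h =
    let (k , h′) = ^-archimedean 2ℚ (0<2^ᶻ a) h
        b = suc b-1
        m = b ℕ.* suc k
        c = ℤ.suc (a ℤ.* + suc k)
        q<r : a ℤ.* + m ℤ.< c ℤ.* + b
        q<r = subst (ℤ._< c ℤ.* + b)
          (trans (ℤ.*-assoc a (+ suc k) (+ b))
            (cong (a ℤ.*_) (trans (sym (ℤ.pos-* (suc k) b)) (cong +_ (ℕ.*-comm (suc k) b)))))
          (ℤ.*-monoʳ-<-pos (+ b) (i<suc[i] (a ℤ.* + suc k)))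
        h″ : 2^ᶻ c < z ^ m
        h″ = subst₂ _<_
          (sym (trans (2^ᶻ-suc (a ℤ.* + suc k)) (cong (2ℚ *_) (2^ᶻ-^ a (suc k)))))
          (^-assocʳ z b (suc k)) h′
    in c / m , </-cross q c m q<r , >2^-/ {ι n} c m h″

  rounded↓ : ∀ q → ι n <2^ q → ∃ λ r → r < q × ι n <2^ r
  rounded↓ q@(mkℚ a b-1 _) h =
    let (k , h′) = ^-archimedean 2ℚ (0<^ (suc b-1) 0<z) h
        b = suc b-1
        m = b ℕ.* suc k
        c = ℤ.pred (a ℤ.* + suc k)
        r<q : c ℤ.* + b ℤ.< a ℤ.* + m
        r<q = subst (c ℤ.* + b ℤ.<_)
          (trans (ℤ.*-assoc a (+ suc k) (+ b))
            (cong (a ℤ.*_) (trans (sym (ℤ.pos-* (suc k) b)) (cong +_ (ℕ.*-comm (suc k) b)))))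
          (ℤ.*-monoʳ-<-pos (+ b) (pred[i]<i (a ℤ.* + suc k)))
        h″ : z ^ m < 2^ᶻ c
        h″ = *-cancelˡ-<-nonNeg 2ℚ (subst₂ _<_
          (cong (2ℚ *_) (^-assocʳ z b (suc k)))
          (trans (sym (2^ᶻ-^ a (suc k)))
            (trans (cong 2^ᶻ (sym (ℤ.suc-pred (a ℤ.* + suc k)))) (2^ᶻ-suc c)))
          h′)
    in c / m , /<-cross q c m r<q , <2^-/ {ι n} c m h″

  loc : ∀ {p q} → p < q → ι n >2^ p ⊎ ι n <2^ q
  loc {p@record{}} {q@record{}} p<q with 2^ᶻ (↥ p) <? z ^ ↧ₙ p
  ... | yes lt = inj₁ lt
  ... | no ¬lt = inj₂ (cross-≤2^ (↥ p) (↧ₙ p) (↥ q) (↧ₙ q) (<⇒≤ 0<z) (drop-*<* p<q) (≮⇒≥ ¬lt))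

log₂ : (n : ℕ) .{{_ : NonTrivial n}} → ℝ
log₂ n .L           = ι n >2^_
log₂ n .U           = ι n <2^_
log₂ n .L-inhabited = Log₂.-1ℚ n , >2^-/ {ι n} (ℤ.- (+ 1)) 1 (Log₂.½<n n)
log₂ n .U-inhabited = ι n , <2^-/ {ι n} (+ n) 1
  (subst (_< 2ℚ ^ n) (sym (trans (*-identityʳ (0ℚ ⊔ ι n)) (p≤q⇒p⊔q≡q (0≤ι n)))) (n<2^n n))
log₂ n .L-closed    = λ p<q → >2^-monoʳ {ι n} (<⇒≤ p<q)
log₂ n .U-closed    = λ p<q → <2^-monoʳ {ι n} (<⇒≤ p<q)
log₂ n .L-rounded {q} = Log₂.rounded↑ n q
log₂ n .U-rounded {q} = Log₂.rounded↓ n q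
log₂ n .disjoint    = <-asym
log₂ n .located     = Log₂.loc n

large : ∀ s → (2^ᶻ (↥ s) + 1ℚ) >2^ s
large s = <-≤-trans (p<p+q T 0<1) (subst (λ z → T + 1ℚ ≤ z ^ ↧ₙ s)
  (sym (p≤q⇒p⊔q≡q (≤-trans (<⇒≤ 0<1) 1≤T+1))) (x≤x^ (↧ₙ s) 1≤T+1))
  where
  T = 2^ᶻ (↥ s)
  1≤T+1 : 1ℚ ≤ T + 1ℚ
  1≤T+1 = subst (_≤ T + 1ℚ) (+-identityˡ 1ℚ) (+-monoˡ-≤ 1ℚ (<⇒≤ (0<2^ᶻ (↥ s))))

2^ᴿ_ : ℝ → ℝ
(2^ᴿ x) .L           = λ q → ∃ λ s → L x s × q <2^ s
(2^ᴿ x) .U           = λ q → ∃ λ s → U x s × q >2^ s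
(2^ᴿ x) .L-inhabited = let (s , ls) = L-inhabited x in 0ℚ , s , ls , 0<2^ s
(2^ᴿ x) .U-inhabited = let (s , us) = U-inhabited x in 2^ᶻ (↥ s) + 1ℚ , s , us , large s
(2^ᴿ x) .L-closed    = λ p<q (s , ls , h) → s , ls , <2^-monoˡ s (<⇒≤ p<q) h
(2^ᴿ x) .U-closed    = λ p<q (s , us , h) → s , us , >2^-monoˡ s (<⇒≤ p<q) h
(2^ᴿ x) .L-rounded {q} = λ (s , ls , h) →
  let (r , q<r , h′) = ^-continuous↑ (↧ₙ s) (0≤0⊔ q) h
  in r , ≤-<-trans (p≤q⊔p 0ℚ q) q<r , s , ls ,
     subst (λ z → z ^ ↧ₙ s < 2^ᶻ (↥ s)) (sym (p≤q⇒p⊔q≡q (≤-trans (0≤0⊔ q) (<⇒≤ q<r)))) h′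
(2^ᴿ x) .U-rounded {q} = λ (s , us , h) →
  let 0<q = >2^-positive {q} s h
      (r , 0≤r , r<q , h′) = ^-continuous↓ (↧ₙ s) 0<q
        (subst (λ z → 2^ᶻ (↥ s) < z ^ ↧ₙ s) (p≤q⇒p⊔q≡q (<⇒≤ 0<q)) h)
  in r , r<q , s , us ,
     subst (λ z → 2^ᶻ (↥ s) < z ^ ↧ₙ s) (sym (p≤q⇒p⊔q≡q 0≤r)) h′
(2^ᴿ x) .disjoint {q} = λ (s , ls , h) (t , ut , h′) →
  <-asym (<2^-monoʳ {q} (<⇒≤ (L<U x ls ut)) h) h′
(2^ᴿ x) .located     = loc
  where
  loc : ∀ {p q} → p < q → (∃ λ s → L x s × p <2^ s) ⊎ (∃ λ s → U x s × q >2^ s)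
  loc {p} {q} p<q with p ≤? 0ℚ
  ... | yes p≤0 = let (s , ls) = L-inhabited x in inj₁ (s , ls , <2^-monoˡ s p≤0 (0<2^ s))
  ... | no p≰0 = let (m , k , lo , hi) = separate (≰⇒> p≰0) p<q in
    pick m k lo hi (located x (/-suc k m))
    where
    0<p = ≰⇒> p≰0
    pick : ∀ m k → p ^ suc m < 2^ᶻ k → 2^ᶻ (ℤ.suc k) < q ^ suc m →
           L x (k / suc m) ⊎ U x (ℤ.suc k / suc m) →
           (∃ λ s → L x s × p <2^ s) ⊎ (∃ λ s → U x s × q >2^ s)
    pick m k lo hi (inj₁ l) = inj₁ (k / suc m , l , <2^-/ {p} k (suc m)
      (subst (λ z → z ^ suc m < 2^ᶻ k) (sym (p≤q⇒p⊔q≡q (<⇒≤ 0<p))) lo))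
    pick m k lo hi (inj₂ u) = inj₂ (ℤ.suc k / suc m , u , >2^-/ {q} (ℤ.suc k) (suc m)
      (subst (λ z → 2^ᶻ (ℤ.suc k) < z ^ suc m) (sym (p≤q⇒p⊔q≡q (<⇒≤ (<-trans 0<p p<q)))) hi))

instance

  fromℕ-positive : ∀ {n} .{{_ : NonZero n}} → Positive (fromℕ n)
  fromℕ-positive {suc n} = mkPositive (<-dense (0<ι-suc n))

  +ᴿ-positive : ∀ {x y} {{_ : Positive x}} {{_ : Positive y}} → Positive (x +ᴿ y)
  +ᴿ-positive {x} {y} {{mkPositive (a , 0<a , la)}} {{mkPositive (b , 0<b , lb)}} =
    let (q , 0<q , q<a+b) = <-dense (0<+ 0<a (<⇒≤ 0<b))
    in mkPositive (q , 0<q , a , b , la , lb , q<a+b)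

  ·-positive : ∀ {n x} .{{_ : NonZero n}} {{_ : Positive x}} → Positive (n · x)
  ·-positive {suc n} {x} {{_}} {{mkPositive (a , 0<a , la)}} =
    let (q , 0<q , q<na) = <-dense (0<* (0<ι-suc n) 0<a)
    in mkPositive (q , 0<q , a , la , q<na)

  log₂-positive : ∀ {n} .{{_ : NonTrivial n}} → Positive (log₂ n)
  log₂-positive {n@(suc (suc m))} = mkPositive (½ , 0<½ ,
    <-≤-trans (Dec.toWitness {a? = 2ℚ ^ 1 <? 2ℚ ^ 2} _)
      (^-mono-≤ 2 (<⇒≤ 0<2ℚ) (≤-trans (2≤ι m) (p≤q⊔p 0ℚ (ι n)))))
    where
    2≤ι : ∀ n → 2ℚ ≤ ι (2 ℕ.+ n)
    2≤ι n = subst (2ℚ ≤_) (sym (trans (ι-suc (suc n)) (trans (cong (λ k → 1ℚ + k) (ι-suc n)) (sym (+-assoc 1ℚ 1ℚ (ι n))))))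
      (+-monoʳ-≤ 2ℚ (0≤ι n))

-- i : Fin n stands for the element toℕ i + 1 of {1, …, n}.

element : ∀ {n} → Fin n → ℕ
element i = suc (toℕ i)

data Coloring (r : ℕ) : ∀ {n} → Subset n → Set where
  []   : Coloring r []
  _∷_  : ∀ {n} {A : Subset n} → Fin r → Coloring r A → Coloring r (inside ∷ A)
  skip : ∀ {n} {A : Subset n} → Coloring r A → Coloring r (outside ∷ A)

color : ∀ {r n} {A : Subset n} {i} → Coloring r A → i ∈ A → Fin r
color (c ∷ κ)  here        = c
color (c ∷ κ)  (there i∈A) = color κ i∈A
color (skip κ) (there i∈A) = color κ i∈A

colorings : ∀ r {n} (A : Subset n) → List (Coloring r A)
colorings r []            = [] ∷ []
colorings r (inside ∷ A)  = cartesianProductWith _∷_ (allFin r) (colorings r A)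
colorings r (outside ∷ A) = map skip (colorings r A)

colorings-complete : ∀ {r n} {A : Subset n} (κ : Coloring r A) → κ ∈ˡ colorings r A
colorings-complete []       = Any.here refl
colorings-complete (c ∷ κ)  = ∈-cartesianProductWith⁺ _∷_ (∈-allFin c) (colorings-complete κ)
colorings-complete (skip κ) = ∈-map⁺ skip (colorings-complete κ)

colorings-unique : ∀ r {n} (A : Subset n) → Unique (colorings r A)
colorings-unique r []            = [] ∷ []
colorings-unique r (inside ∷ A)  =
  cartesianProductWith⁺ _∷_ (λ { refl → refl , refl }) (allFin⁺ r) (colorings-unique r A)
colorings-unique r (outside ∷ A) = map⁺ (λ { refl → refl }) (colorings-unique r A)

IsAP : ∀ {n} → Fin n → Fin n → Fin n → Set
IsAP {n} i j k = ∃ λ (d : Fin n) →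
  element j ≡ element i ℕ.+ element d × element k ≡ element i ℕ.+ 2 ℕ.* element d

Rainbow : ∀ {r} → Fin r → Fin r → Fin r → Set
Rainbow a b c = a ≢ b × a ≢ c × b ≢ c

RainbowFree : ∀ {r n} {A : Subset n} → Coloring r A → Set
RainbowFree {A = A} κ =
  ∀ i (i∈A : i ∈ A) j (j∈A : j ∈ A) k (k∈A : k ∈ A) → IsAP i j k →
  ¬ Rainbow (color κ i∈A) (color κ j∈A) (color κ k∈A)

all∈? : ∀ {n} {A : Subset n} {P : ∀ i → i ∈ A → Set} →
        (∀ i i∈A → Dec (P i i∈A)) → Dec (∀ i i∈A → P i i∈A)
all∈? {A = A} {P} P? = all? dec
  where
  dec : ∀ i → Dec (∀ i∈A → P i i∈A)
  dec i with i ∈? A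
  ... | yes i∈A = Dec.map′ (λ p i∈A′ → subst (P i) ([]=-irrelevant i∈A i∈A′) p) (λ h → h i∈A) (P? i i∈A)
  ... | no  i∉A = yes (λ i∈A → ⊥-elim (i∉A i∈A))

isAP? : ∀ {n} (i j k : Fin n) → Dec (IsAP i j k)
isAP? i j k = any? λ d → (element j ℕ.≟ _) ×-dec (element k ℕ.≟ _)

rainbow? : ∀ {r} (a b c : Fin r) → Dec (Rainbow a b c)
rainbow? a b c = ¬? (a Fin.≟ b) ×-dec ¬? (a Fin.≟ c) ×-dec ¬? (b Fin.≟ c)

rainbowFree? : ∀ {r n} {A : Subset n} (κ : Coloring r A) → Dec (RainbowFree κ)
rainbowFree? κ =
  all∈? λ i i∈A → all∈? λ j j∈A → all∈? λ k k∈A →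
  isAP? i j k →-dec ¬? (rainbow? (color κ i∈A) (color κ j∈A) (color κ k∈A))

g : ∀ r {n} → Subset n → ℕ
g r A = length (filter rainbowFree? (colorings r A))

{-# OPTIONS --safe #-}
module Submission where

-- A sample S of at most δ n elements of A, together with its colors, has 2 ^ (ε n) descriptions, where
-- ε tends to 0 with δ.
-- If many progressions through z have two differently colored other terms (z is rich), then S
-- contains such a pair for almost all such z, which leaves only two colors for z. The other elements
-- are poor: the coloring is almost constant on the pairs completing them to a progression.
--
-- If there are many poor elements, a second sample determines, through links at poor elements b, all
-- colors outside a set U that has few links left. Then the midpoints of b with the elements of U of
-- the parity of b are missing from A, so there are at most |[n] ∖ A| + ε n such elements, and
-- 8 |[n] ∖ A| log₂ r ≤ 3 n bounds their contribution.
--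
-- If there are few poor elements, almost all z have a list (type) of two colors. This is enough
-- unless A is almost all of [n]. If linearly many disjoint progressions have types that are not all
-- equal, each of them has a rainbow choice of colors that must be avoided. Otherwise almost all types
-- are equal to one {a, b}, and an element x of a third color forces the same color on the two other
-- terms of each progression through x.

-- Vectors of colors are counted entry by entry from the last position to the first. Which positions
-- are forced depends on the coloring itself, so no fixed set of positions can be credited; each
-- forced position gets weight 2 instead, and Kraft's inequality bounds the total weight. Hence
-- every condition must refer to later positions only.
--
-- The part `S` of a sample has size independent of n and of the threshold for being poor. So this
-- threshold can be chosen after `S` is bounded, and the exceptions to the links at the centers in
-- `S` are few enough to be recorded.
--
-- Let m elements be missing from A. If both parities contain many poor elements, the undetermined
-- colors cost about 2 m log₂ r ≤ 3 n / 4 bits. Otherwise one parity costs m log₂ r ≤ 3 n / 8 bits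
-- and the typed elements of the other n / 2, together 7 n / 8.
--
-- All colorings with more than two colors number at most 2 ^ (n - n / (4 K)), where K depends on r
-- only. This is a linear saving, so it beats n / (36 log₂ n) once log₂ n exceeds a constant.

-- The density hypothesis and the error term in natural numbers

module Reals where

  open import Algebra.Bundles using (CommutativeRing)
  import Algebra.Properties.CommutativeSemiring.Exp as Exp
  open import Data.Empty using (⊥; ⊥-elim)
  import Data.Integer as ℤ
  import Data.Integer.Properties as ℤ
  import Data.Rational.Unnormalised as ℚᵘ
  import Data.Rational.Unnormalised.Properties as ℚᵘ
  open import Data.Nat as ℕ using (ℕ; zero; suc; NonZero; NonTrivial)
  import Data.Nat.Properties as ℕ
  open import Data.Product using (∃; _×_; _,_)
  open import Data.Rational hiding (NonZero; Positive; positive)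
  open import Data.Rational.Properties
  open import Data.Rational.Solver using (module +-*-Solver)
  open import Data.Sum using (_⊎_; inj₁; inj₂)
  open import Relation.Binary.PropositionalEquality
  open import Relation.Nullary using (yes; no)
  open import Defs
  open +-*-Solver using (solve; _:+_; _:*_; _:-_; :-_; _:=_; con)
  open Exp (CommutativeRing.commutativeSemiring +-*-commutativeRing) using (_^_)
  open ℝ

  ι-+ : ∀ a b → ι (a ℕ.+ b) ≡ ι a + ι b
  ι-+ zero    b = sym (+-identityˡ (ι b))
  ι-+ (suc a) b = trans (ι-suc (a ℕ.+ b)) (trans (cong (1ℚ +_) (ι-+ a b))
    (trans (sym (+-assoc 1ℚ (ι a) (ι b))) (cong (_+ ι b) (sym (ι-suc a)))))

  ι-* : ∀ a b → ι (a ℕ.* b) ≡ ι a * ι b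
  ι-* zero    b = sym (*-zeroˡ (ι b))
  ι-* (suc a) b = trans (ι-+ b (a ℕ.* b)) (trans (cong (ι b +_) (ι-* a b))
    (trans (solve 2 (λ x y → y :+ x :* y := (con 1ℚ :+ x) :* y) refl (ι a) (ι b)) (cong (_* ι b) (sym (ι-suc a)))))

  ι-^ : ∀ a b → ι (a ℕ.^ b) ≡ ι a ^ b
  ι-^ a zero    = refl
  ι-^ a (suc b) = trans (ι-* a (a ℕ.^ b)) (cong (ι a *_) (ι-^ a b))

  ι-mono-≤ : ∀ {a b} → a ℕ.≤ b → ι a ≤ ι b
  ι-mono-≤ {a} {b} a≤b = subst₂ _≤_ (+-identityʳ (ι a)) (trans (sym (ι-+ a (b ℕ.∸ a))) (cong ι (ℕ.m+[n∸m]≡n a≤b)))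
    (+-monoʳ-≤ (ι a) (0≤ι (b ℕ.∸ a)))

  ι-mono-< : ∀ {a b} → a ℕ.< b → ι a < ι b
  ι-mono-< {a} a<b = <-≤-trans (ι<ι-suc a) (ι-mono-≤ a<b)

  0<ι : ∀ {n} → 1 ℕ.≤ n → 0ℚ < ι n
  0<ι = ι-mono-<

  /-cancel : ∀ a b .{{_ : NonZero b}} → ((ℤ.+ a) / b) * ι b ≡ ι a
  /-cancel a b@(suc b-1) = toℚᵘ-injective (ℚᵘ.≃-trans (toℚᵘ-homo-* ((ℤ.+ a) / b) (ι b))
    (ℚᵘ.≃-trans (ℚᵘ.*-cong (toℚᵘ-/ (ℤ.+ a) b) (toℚᵘ-/ (ℤ.+ b) 1))
      (ℚᵘ.≃-trans (ℚᵘ.*≡* (trans (ℤ.*-identityʳ _) (cong (λ x → (ℤ.+ a) ℤ.* x) (cong (λ x → ℤ.+ suc x) (sym (ℕ.*-identityʳ b-1))))))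
        (ℚᵘ.≃-sym (toℚᵘ-/ (ℤ.+ a) 1)))))

  -- If 2 ^ (3 n) < r ^ (8 m) then 8 log₂ r > 3 n / m, so 3 / (13 + 8 log₂ r) < m / n; hence
  -- ξ < m / n and (1 - ξ) n > n - m.
  module Density (r m n k : ℕ) .{{_ : NonTrivial r}} (1≤n : 1 ℕ.≤ n) (k+m≡n : k ℕ.+ m ≡ n)
    (ξ : ℝ) (ξ≤ : ξ ≤ᴿ 3 · (fromℕ 13 +ᴿ 8 · log₂ r) ⁻¹) (dense : n · (fromℕ 1 -ᴿ ξ) ≤ᴿ fromℕ k)
    (large : 2 ℕ.^ (3 ℕ.* n) ℕ.< r ℕ.^ (8 ℕ.* m)) where

    1≤m : 1 ℕ.≤ m
    1≤m = positive m large
      where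
      positive : ∀ m → 2 ℕ.^ (3 ℕ.* n) ℕ.< r ℕ.^ (8 ℕ.* m) → 1 ℕ.≤ m
      positive zero    h = ⊥-elim (ℕ.<-irrefl refl (ℕ.<-≤-trans h (ℕ.m^n>0 2 (3 ℕ.* n))))
      positive (suc m) h = ℕ.s≤s ℕ.z≤n

    instance
      8m≢0 : NonZero (8 ℕ.* m)
      8m≢0 = ℕ.>-nonZero (ℕ.≤-trans 1≤m (ℕ.m≤n*m m 8))

    s : ℚ
    s = (ℤ.+ (3 ℕ.* n)) / (8 ℕ.* m)

    Ls : L (log₂ r) s
    Ls = >2^-/ {ι r} (ℤ.+ (3 ℕ.* n)) (8 ℕ.* m)
      (subst₂ _<_ (ι-^ 2 (3 ℕ.* n)) (trans (ι-^ r (8 ℕ.* m)) (cong (_^ (8 ℕ.* m)) (sym (p≤q⇒p⊔q≡q (0≤ι r))))) (ι-mono-< large))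

    8sm : ι 8 * s * ι m ≡ ι 3 * ι n
    8sm = begin
      ι 8 * s * ι m          ≡⟨ solve 3 (λ e s m → e :* s :* m := s :* (e :* m)) refl (ι 8) s (ι m) ⟩
      s * (ι 8 * ι m)        ≡⟨ cong (s *_) (sym (ι-* 8 m)) ⟩
      s * ι (8 ℕ.* m)        ≡⟨ /-cancel (3 ℕ.* n) (8 ℕ.* m) ⟩
      ι (3 ℕ.* n)            ≡⟨ ι-* 3 n ⟩
      ι 3 * ι n ∎
      where open ≡-Reasoning

    -- The lower bound 8 s + 1 for the denominator leaves room for strict inequalities.
    d : ℚ
    d = ι 8 * s + 1ℚ

    Ld : L (fromℕ 13 +ᴿ 8 · log₂ r) d
    Ld = ι 12 , ι 8 * s - 1ℚ , ι<ι-suc 12 , (s , Ls , p-q<p (ι 8 * s) 0<1) ,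
      subst (d <_) (solve 1 (λ x → (x :+ con 1ℚ) :+ con (ι 10) := con (ι 12) :+ (x :- con 1ℚ)) refl (ι 8 * s)) (p<p+q d (0<ι-suc 9))

    0<8s : 0ℚ < ι 8 * s
    0<8s = *-cancelʳ-< {ι m} (0<ι 1≤m) (subst₂ _<_ (sym (*-zeroˡ (ι m))) (sym 8sm) (0<* (0<ι-suc 2) (0<ι 1≤n)))

    contradiction : ⊥
    contradiction =
      let (j , 0<j , 8sj≡1) = inverse 0<8s
          0<d               = <-trans 0<8s (p<p+q (ι 8 * s) 0<1)
          (i , 0<i , di≡1)  = inverse 0<d
          i<j               = inverse-anti 0<j 0<i 8sj≡1 di≡1 (p<p+q (ι 8 * s) 0<1)
          (b , i<b , b<j)   = <-dense i<j
          (u , 3b<u , u<3j) = <-dense (*-monoˡ-< (0<ι-suc 2) b<j)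
          (v , u<v , v<3j)  = <-dense u<3j
          Uη : U (3 · (fromℕ 13 +ᴿ 8 · log₂ r) ⁻¹) u
          Uη = b , (d , Ld , 0<d , inverse<⇒1< 0<d di≡1 i<b) , 3b<u
          Uξ : U ξ v
          Uξ = upper u<v Uη (located ξ u<v)
          (a , lo , hi)     = <-dense (+-monoʳ-< 1ℚ (neg-antimono-< v<3j))
          (c , lo′ , hi′)   = <-dense (subst (a + v <_) (solve 1 (λ v → con 1ℚ :- v :+ v := con 1ℚ) refl v) (+-monoˡ-< v hi))
      -- Since 3 j = m / n, the number n (1 - 3 j) equals k. As a > 1 - 3 j, the rational k lies in
      -- the lower cut of n (1 - ξ), and `dense` would give k < k.
      in <-irrefl refl (dense (ι k) (a , (c , - v , hi′ , subst (U ξ) (sym (neg² v)) Uξ ,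
           subst (_< c - v) (solve 2 (λ a v → a :+ v :- v := a) refl a v) (+-monoˡ-< (- v) lo′)) ,
           subst (_< ι n * a) (total j 8sj≡1) (*-monoˡ-< (0<ι 1≤n) lo)))
      where
      -- `≤ᴿ` compares lower cuts only; locatedness turns it into an upper bound for ξ.
      upper : ∀ {u v} → u < v → U (3 · (fromℕ 13 +ᴿ 8 · log₂ r) ⁻¹) u → L ξ u ⊎ U ξ v → U ξ v
      upper {u} u<v uη (inj₁ l) = ⊥-elim (disjoint (3 · (fromℕ 13 +ᴿ 8 · log₂ r) ⁻¹) (ξ≤ u l) uη)
      upper u<v uη (inj₂ h) = h
      total : ∀ j → ι 8 * s * j ≡ 1ℚ → ι n * (1ℚ - ι 3 * j) ≡ ι k
      total j e = begin
        ι n * (1ℚ - ι 3 * j)             ≡⟨ solve 3 (λ n t j → n :* (con 1ℚ :- t :* j) := n :- (t :* n) :* j) refl (ι n) (ι 3) j ⟩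
        ι n - ι 3 * ι n * j              ≡⟨ cong (λ z → ι n - z * j) (sym 8sm) ⟩
        ι n - ι 8 * s * ι m * j          ≡⟨ cong (λ z → ι n - z) (solve 3 (λ x m j → x :* m :* j := x :* j :* m) refl (ι 8 * s) (ι m) j) ⟩
        ι n - ι 8 * s * j * ι m          ≡⟨ cong (λ z → ι n - z * ι m) e ⟩
        ι n - 1ℚ * ι m                   ≡⟨ cong (λ z → ι z - 1ℚ * ι m) (sym k+m≡n) ⟩
        ι (k ℕ.+ m) - 1ℚ * ι m           ≡⟨ cong (λ z → z - 1ℚ * ι m) (ι-+ k m) ⟩
        ι k + ι m - 1ℚ * ι m             ≡⟨ solve 2 (λ k m → k :+ m :- con 1ℚ :* m := k) refl (ι k) (ι m) ⟩
        ι k ∎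
        where open ≡-Reasoning

  -- The inequality 8 m log₂ r ≤ 3 n is the only form in which ξ and the size of A are used later.
  -- Between natural numbers it is decidable, so refuting its negation suffices.
  density : ∀ r m n k .{{_ : NonTrivial r}} → 1 ℕ.≤ n → k ℕ.+ m ≡ n → (ξ : ℝ) → ξ ≤ᴿ 3 · (fromℕ 13 +ᴿ 8 · log₂ r) ⁻¹ →
            n · (fromℕ 1 -ᴿ ξ) ≤ᴿ fromℕ k → r ℕ.^ (8 ℕ.* m) ℕ.≤ 2 ℕ.^ (3 ℕ.* n)
  density r m n k 1≤n e ξ ξ≤ dense with r ℕ.^ (8 ℕ.* m) ℕ.≤? 2 ℕ.^ (3 ℕ.* n)
  ... | yes le = le
  ... | no ¬le = ⊥-elim (Density.contradiction r m n k 1≤n e ξ ξ≤ dense (ℕ.≰⇒> ¬le))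

  ½^ι : ∀ n t → t ℕ.≤ n → ι (2 ℕ.^ (n ℕ.∸ t)) ≡ ι (2 ℕ.^ n) * ½ ^ t
  ½^ι n t t≤n = begin
    ι (2 ℕ.^ (n ℕ.∸ t))                     ≡⟨ *-identityʳ _ ⟨
    x * 1ℚ                                  ≡⟨ cong (x *_) (sym (½^*2^ t)) ⟩
    x * (½ ^ t * 2ℚ ^ t)                    ≡⟨ cong (λ z → x * (½ ^ t * z)) (sym (ι-^ 2 t)) ⟩
    x * (½ ^ t * ι (2 ℕ.^ t))               ≡⟨ solve 3 (λ x h y → x :* (h :* y) := x :* y :* h) refl x (½ ^ t) (ι (2 ℕ.^ t)) ⟩
    x * ι (2 ℕ.^ t) * ½ ^ t                 ≡⟨ cong (_* ½ ^ t) (sym (ι-* (2 ℕ.^ (n ℕ.∸ t)) (2 ℕ.^ t))) ⟩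
    ι (2 ℕ.^ (n ℕ.∸ t) ℕ.* 2 ℕ.^ t) * ½ ^ t ≡⟨ cong (λ z → ι z * ½ ^ t) (sym (ℕ.^-distribˡ-+-* 2 (n ℕ.∸ t) t)) ⟩
    ι (2 ℕ.^ (n ℕ.∸ t ℕ.+ t)) * ½ ^ t       ≡⟨ cong (λ z → ι (2 ℕ.^ z) * ½ ^ t) (ℕ.m∸n+n≡m t≤n) ⟩
    ι (2 ℕ.^ n) * ½ ^ t ∎
    where
    open ≡-Reasoning
    x = ι (2 ℕ.^ (n ℕ.∸ t))

  -- 2 ^ l < n puts l below log₂ n, hence below 36 log₂ n, so n / (36 log₂ n) < n / l < t.
  quotient-bound : ∀ n t l .{{_ : NonTrivial n}} → 1 ℕ.≤ l → 2 ℕ.^ l ℕ.< n → n ℕ.< t ℕ.* l →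
                   U (n · (36 · log₂ n) ⁻¹) (ι t)
  quotient-bound n t l 1≤l 2^l<n n<tl =
    let (i , 0<i , li≡1)   = inverse (0<ι 1≤l)
        (i′ , 0<i′ , ni≡1) = inverse (0<ι 1≤n)
        i<                 = i<t/n i i′ 0<i 0<i′ li≡1 ni≡1
        (b , i<b , b<)     = <-dense i<
    in b , (ι l , (ι l , log>l , l<36l) , 0<ι 1≤l , inverse<⇒1< (0<ι 1≤l) li≡1 i<b) ,
       subst (ι n * b <_) (trans (solve 3 (λ n t j → n :* (t :* j) := t :* (n :* j)) refl (ι n) (ι t) i′)
         (trans (cong (ι t *_) ni≡1) (*-identityʳ (ι t)))) (*-monoˡ-< (0<ι 1≤n) b<)
    where
    1≤n : 1 ℕ.≤ n
    1≤n = ℕ.≤-trans (ℕ.s≤s ℕ.z≤n) 2^l<n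
    log>l : L (log₂ n) (ι l)
    log>l = >2^-/ {ι n} (ℤ.+ l) 1 (subst₂ _<_ (ι-^ 2 l)
      (sym (trans (*-identityʳ (0ℚ ⊔ ι n)) (p≤q⇒p⊔q≡q (0≤ι n)))) (ι-mono-< 2^l<n))
    l<36l : ι l < ι 36 * ι l
    l<36l = subst (_< ι 36 * ι l) (*-identityˡ (ι l)) (*-monoʳ-< (0<ι 1≤l) (ι-mono-< {1} {36} (ℕ.s≤s (ℕ.s≤s ℕ.z≤n))))
    i<t/n : ∀ i i′ → 0ℚ < i → 0ℚ < i′ → ι l * i ≡ 1ℚ → ι n * i′ ≡ 1ℚ → i < ι t * i′
    i<t/n i i′ 0<i 0<i′ li ni = subst₂ _<_
      (trans (solve 3 (λ n i j → n :* (i :* j) := n :* j :* i) refl (ι n) i i′) (trans (cong (_* i) ni) (*-identityˡ i)))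
      (trans (cong (_* (i * i′)) (ι-* t l)) (trans (solve 4 (λ t l i j → t :* l :* (i :* j) := t :* j :* (l :* i)) refl (ι t) (ι l) i i′)
        (trans (cong (ι t * i′ *_) li) (*-identityʳ _))))
      (*-monoʳ-< (0<* 0<i 0<i′) (ι-mono-< n<tl))

  power-bound : ∀ (x : ℝ) t {a} → U x (ι t) → a < ½ ^ t → L (2^ᴿ (-ᴿ x)) a
  power-bound x t {a} u a< = (ℤ.- (ℤ.+ t)) / 1 , subst (U x) (ι-neg t) u ,
    <2^-/ {a} (ℤ.- (ℤ.+ t)) 1 (subst₂ _<_ (sym (*-identityʳ (0ℚ ⊔ a))) (sym (power t)) (clamp (⊔-sel 0ℚ a)))
    where
    ι-neg : ∀ t → ι t ≡ - ((ℤ.- (ℤ.+ t)) / 1)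
    ι-neg zero    = refl
    ι-neg (suc t) = sym (neg² (ι (suc t)))
    power : ∀ t → 2^ᶻ (ℤ.- (ℤ.+ t)) ≡ ½ ^ t
    power zero    = refl
    power (suc t) = refl
    clamp : 0ℚ ⊔ a ≡ 0ℚ ⊎ 0ℚ ⊔ a ≡ a → 0ℚ ⊔ a < ½ ^ t
    clamp (inj₁ e) = subst (_< ½ ^ t) (sym e) (0<^ t 0<½)
    clamp (inj₂ e) = subst (_< ½ ^ t) (sym e) a<

  -- The lower cut of a sum asks for strict bounds on both summands: q < P + Z leaves room first for
  -- b < Z, then for a < P. Here Z = 2 ^ n 2 ^ (-t) is below the error term because t exceeds n /
  -- (36 log₂ n).
  conclude : ∀ n G P t l .{{_ : NonTrivial n}} → 1 ℕ.≤ l → 2 ℕ.^ l ℕ.< n → n ℕ.< t ℕ.* l → t ℕ.≤ n →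
             G ℕ.≤ P ℕ.+ 2 ℕ.^ (n ℕ.∸ t) →
             fromℕ G ≤ᴿ fromℕ P +ᴿ (2 ℕ.^ n) · 2^ᴿ (-ᴿ (n · (36 · log₂ n) ⁻¹))
  conclude n G P t l 1≤l 2^l<n n<tl t≤n G≤ q q<G =
    at-b (<-dense (subst (q - ι P <_) (solve 2 (λ p z → p :+ z :- p := z) refl (ι P) Z) (+-monoˡ-< (- ι P) q<P+Z)))
    where
    Z : ℚ
    Z = ι (2 ℕ.^ (n ℕ.∸ t))
    q<P+Z : q < ι P + Z
    q<P+Z = <-≤-trans q<G (subst (ι G ≤_) (ι-+ P (2 ℕ.^ (n ℕ.∸ t))) (ι-mono-≤ G≤))
    scale : ∀ j → ι (2 ℕ.^ n) * j ≡ 1ℚ → Z * j ≡ ½ ^ t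
    scale j e = trans (cong (_* j) (½^ι n t t≤n)) (trans (solve 3 (λ x h j → x :* h :* j := x :* j :* h) refl (ι (2 ℕ.^ n)) (½ ^ t) j)
      (trans (cong (_* ½ ^ t) e) (*-identityˡ _)))
    unscale : ∀ b j → ι (2 ℕ.^ n) * j ≡ 1ℚ → ι (2 ℕ.^ n) * (b * j) ≡ b
    unscale b j e = trans (solve 3 (λ x b j → x :* (b :* j) := x :* j :* b) refl (ι (2 ℕ.^ n)) b j) (trans (cong (_* b) e) (*-identityˡ b))
    L-power : ∀ {b} j → 0ℚ < j → ι (2 ℕ.^ n) * j ≡ 1ℚ → b < Z →
              (∃ λ c → b * j < c × c < ½ ^ t) → L ((2 ℕ.^ n) · 2^ᴿ (-ᴿ (n · (36 · log₂ n) ⁻¹))) b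
    L-power {b} j 0<j e b<Z (c , bj<c , c<) = c ,
      power-bound (n · (36 · log₂ n) ⁻¹) t (quotient-bound n t l 1≤l 2^l<n n<tl) c< ,
      subst (_< ι (2 ℕ.^ n) * c) (unscale b j e) (*-monoˡ-< (0<ι (ℕ.m^n>0 2 n)) bj<c)
    L-below : ∀ {b} → b < Z → (∃ λ j → 0ℚ < j × ι (2 ℕ.^ n) * j ≡ 1ℚ) →
              L ((2 ℕ.^ n) · 2^ᴿ (-ᴿ (n · (36 · log₂ n) ⁻¹))) b
    L-below {b} b<Z (j , 0<j , e) = L-power j 0<j e b<Z (<-dense (subst (b * j <_) (scale j e) (*-monoʳ-< 0<j b<Z)))
    at-a : ∀ {b} → b < Z → (∃ λ a → q - b < a × a < ι P) →
           L (fromℕ P +ᴿ (2 ℕ.^ n) · 2^ᴿ (-ᴿ (n · (36 · log₂ n) ⁻¹))) q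
    at-a {b} b<Z (a , lo , a<P) = a , b , a<P , L-below b<Z (inverse (0<ι (ℕ.m^n>0 2 n))) ,
      subst (_< a + b) (solve 2 (λ q b → q :- b :+ b := q) refl q b) (+-monoˡ-< b lo)
    at-b : (∃ λ b → q - ι P < b × b < Z) → L (fromℕ P +ᴿ (2 ℕ.^ n) · 2^ᴿ (-ᴿ (n · (36 · log₂ n) ⁻¹))) q
    at-b (b , lo , b<Z) = at-a b<Z (<-dense (subst (q - b <_) (solve 2 (λ p b → b :+ p :- b := p) refl (ι P) b)
      (+-monoˡ-< (- b) (subst (_< b + ι P) (solve 2 (λ q p → q :- p :+ p := q) refl q (ι P)) (+-monoˡ-< (ι P) lo)))))

open import Data.Nat
open import Data.Nat.Properties
open import Algebra.Properties.CommutativeMonoid.Sum +-0-commutativeMonoid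
  using (sum; ∑-comm; ∑-distrib-+; sum-cong-≗)
open import Algebra.Properties.CommutativeMonoid.Sum *-1-commutativeMonoid
  using () renaming (sum to ∏; sum-cong-≗ to ∏-cong; ∑-distrib-+ to ∏-distrib-*)
open import Algebra.Properties.Semiring.Sum +-*-semiring using (*-distribˡ-sum)
open import Data.Bool.Base using (Bool; true; false; if_then_else_)
open import Data.Empty using (⊥; ⊥-elim)
open import Data.Fin as Fin using (Fin; zero; suc; toℕ; fromℕ<)
import Data.Fin.Properties as Fin
open import Data.Fin.Subset using (Subset; inside; outside; _∈_; _∉_; ∣_∣)
open import Data.Fin.Subset.Properties using (_∈?_)
open import Data.List as List using (List; []; _∷_; length; _++_)
open import Data.List.Membership.Propositional using () renaming (_∈_ to _∈′_)
open import Data.List.Membership.Propositional.Properties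
  using (∈-allFin; ∈-cartesianProduct⁺; ∈-filter⁺; ∈-map⁺)
open import Data.List.Properties using (filter-accept; filter-all; filter-reject; length-++; length-map)
open import Data.List.Relation.Unary.All using (All; []; _∷_)
open import Data.List.Relation.Unary.Any as Any using (Any; here; there)
import Data.List.Relation.Unary.Any.Properties as Any
open import Data.Maybe using (Maybe; just; nothing)
import Data.Maybe.Properties as Maybe
open import Data.Maybe.Properties using (just-injective)
open import Data.Nat.Base using (n>1⇒nonTrivial)
open import Data.Nat.Combinatorics using (_C_; nC1≡n; nCk+nC[k+1]≡[n+1]C[k+1])
open import Data.Nat.DivMod
open import Data.Nat.Tactic.RingSolver using (solve-∀)
open import Data.Parity.Base as ℙ using (Parity; 0ℙ; 1ℙ)
import Data.Parity.Properties as ℙ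
open import Data.Product using (∃; _×_; _,_; proj₁; proj₂)
import Data.Product.Properties as Product
open import Data.Sum as Sum using (_⊎_; inj₁; inj₂)
open import Data.Unit using (⊤; tt)
open import Data.Vec as Vec using (Vec; []; _∷_; lookup; tabulate; here; there)
open import Data.Vec.Properties using (lookup∘tabulate)
open import Defs
  using (Coloring; []; _∷_; skip; color; colorings; element; IsAP; Rainbow; RainbowFree; rainbowFree?; g)
open import Function using (_∘_; id)
open import Relation.Binary.Definitions using (tri<; tri≈; tri>)
open import Relation.Binary.PropositionalEquality
open import Relation.Nullary using (¬_; Dec; yes; no; does; ¬?; _×-dec_; _⊎-dec_; _→-dec_)
open import Relation.Nullary.Decidable using (decidable-stable)
open import Relation.Unary using (Decidable)

private variable
  r n l : ℕ
  𝕏 𝕐 : Set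

-- Counting in finite types

-- Linear arithmetic with a Farkas certificate: R - L = (Y - X) + s is a semiring identity once both
-- sides are moved so that no subtraction occurs, and the ring solver proves it.
farkas : ∀ {L R X Y} s → X ≤ Y → L + Y + s ≡ R + X → L ≤ R
farkas {L} {R} {X} {Y} s h e =
  +-cancelʳ-≤ Y L R (≤-trans (m≤m+n (L + Y) s) (≤-trans (≤-reflexive e) (+-monoʳ-≤ R h)))

infixr 6 _⊕_
infixr 7 _⊗_

_⊕_ : ∀ {a b c d} → a ≤ b → c ≤ d → a + c ≤ b + d
_⊕_ = +-mono-≤

_⊗_ : ∀ l {a b} → a ≤ b → l * a ≤ l * b
_⊗_ l = *-monoʳ-≤ l

sum-mono : ∀ {n} {a b : Fin n → ℕ} → (∀ i → a i ≤ b i) → sum a ≤ sum b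
sum-mono {zero}  h = z≤n
sum-mono {suc n} h = +-mono-≤ (h zero) (sum-mono (h ∘ suc))

sum-const : ∀ n c → sum {n} (λ _ → c) ≡ n * c
sum-const zero    c = refl
sum-const (suc n) c = cong (c +_) (sum-const n c)

sum-≤-const : ∀ {n} {a : Fin n → ℕ} c → (∀ i → a i ≤ c) → sum a ≤ n * c
sum-≤-const {n} c h = ≤-trans (sum-mono h) (≤-reflexive (sum-const n c))

term≤sum : ∀ {n} (a : Fin n → ℕ) i → a i ≤ sum a
term≤sum a zero    = m≤m+n _ _
term≤sum a (suc i) = m≤n⇒m≤o+n (a zero) (term≤sum (a ∘ suc) i)

⟦_⟧ : ∀ {P : Set} → Dec P → ℕ
⟦ p ⟧ = if does p then 1 else 0

⟦⟧≤1 : ∀ {P : Set} (p : Dec P) → ⟦ p ⟧ ≤ 1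
⟦⟧≤1 (yes _) = ≤-refl
⟦⟧≤1 (no _)  = z≤n

⟦⟧-true : ∀ {P : Set} (p : Dec P) → P → 1 ≤ ⟦ p ⟧
⟦⟧-true (yes _) _ = ≤-refl
⟦⟧-true (no ¬p) p = ⊥-elim (¬p p)

⟦⟧-false : ∀ {P : Set} (p : Dec P) → ¬ P → ⟦ p ⟧ ≡ 0
⟦⟧-false (yes p) ¬p = ⊥-elim (¬p p)
⟦⟧-false (no _)  _  = refl

⟦⟧-elim : ∀ {P : Set} (p : Dec P) {m} → (P → 1 ≤ m) → ⟦ p ⟧ ≤ m
⟦⟧-elim (yes p) h = h p
⟦⟧-elim (no _)  h = z≤n

⟦⟧-× : ∀ {P Q : Set} (p : Dec P) (q : Dec Q) → ⟦ p ×-dec q ⟧ ≡ ⟦ p ⟧ * ⟦ q ⟧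
⟦⟧-× (yes _) (yes _) = refl
⟦⟧-× (yes _) (no _)  = refl
⟦⟧-× (no _)  q       = refl

# : {P : Fin n → Set} → (∀ i → Dec (P i)) → ℕ
# P? = sum λ i → ⟦ P? i ⟧

#-mono : {P Q : Fin n → Set} (P? : ∀ i → Dec (P i)) (Q? : ∀ i → Dec (Q i)) →
         (∀ i → P i → Q i) → # P? ≤ # Q?
#-mono P? Q? h = sum-mono λ i → ⟦⟧-elim (P? i) (⟦⟧-true (Q? i) ∘ h i)

#≤n : {P : Fin n → Set} (P? : ∀ i → Dec (P i)) → # P? ≤ n
#≤n {n} P? = ≤-trans (sum-≤-const 1 (⟦⟧≤1 ∘ P?)) (≤-reflexive (*-identityʳ n))

#-⊎ : {P Q R : Fin n → Set} (P? : ∀ i → Dec (P i)) (Q? : ∀ i → Dec (Q i)) (R? : ∀ i → Dec (R i)) →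
      (∀ i → P i → Q i ⊎ R i) → # P? ≤ # Q? + # R?
#-⊎ P? Q? R? h = ≤-trans
  (sum-mono λ i → ⟦⟧-elim (P? i) λ p → Sum.[ (λ q → ≤-trans (⟦⟧-true (Q? i) q) (m≤m+n _ _))
                                           , (λ r → ≤-trans (⟦⟧-true (R? i) r) (m≤n+m _ _)) ] (h i p))
  (≤-reflexive (∑-distrib-+ (λ i → ⟦ Q? i ⟧) (λ i → ⟦ R? i ⟧)))

#-disjoint : {P Q R : Fin n → Set} (P? : ∀ i → Dec (P i)) (Q? : ∀ i → Dec (Q i)) (R? : ∀ i → Dec (R i)) →
             (∀ i → Q i → P i) → (∀ i → R i → P i) → (∀ i → Q i → ¬ R i) → # Q? + # R? ≤ # P?
#-disjoint P? Q? R? q⊆p r⊆p q∩r = ≤-trans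
  (≤-reflexive (sym (∑-distrib-+ (λ i → ⟦ Q? i ⟧) (λ i → ⟦ R? i ⟧))))
  (sum-mono λ i → pointwise i (Q? i) (R? i))
  where
  pointwise : ∀ i (q : Dec _) (r : Dec _) → ⟦ q ⟧ + ⟦ r ⟧ ≤ ⟦ P? i ⟧
  pointwise i (yes q) (yes r) = ⊥-elim (q∩r i q r)
  pointwise i (yes q) (no _)  = ⟦⟧-true (P? i) (q⊆p i q)
  pointwise i (no _)  r       = ⟦⟧-elim r (⟦⟧-true (P? i) ∘ r⊆p i)

#-none : {P : Fin n → Set} (P? : ∀ i → Dec (P i)) → (∀ i → ¬ P i) → # P? ≡ 0
#-none {n} P? h = trans (sum-cong-≗ λ i → ⟦⟧-false (P? i) (h i)) (trans (sum-const n 0) (*-zeroʳ n))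

#-inhabited : {P : Fin n → Set} (P? : ∀ i → Dec (P i)) → 0 < # P? → ∃ P
#-inhabited {P = P} P? h with Fin.any? P?
... | yes p = p
... | no ¬p = ⊥-elim (<⇒≢ h (sym (#-none P? λ i p → ¬p (i , p))))

#-positive : {P : Fin n → Set} (P? : ∀ i → Dec (P i)) → ∀ i → P i → 1 ≤ # P?
#-positive P? i p = ≤-trans (⟦⟧-true (P? i) p) (term≤sum _ i)

#-unique : {P : Fin n → Set} (P? : ∀ i → Dec (P i)) → (∀ i j → P i → P j → i ≡ j) → # P? ≤ 1
#-unique {zero}  P? h = z≤n
#-unique {suc n} P? h with P? zero
... | yes p = ≤-reflexive (cong suc (#-none (P? ∘ suc) λ i q → Fin.0≢1+n (h zero (suc i) p q)))
... | no _  = #-unique (P? ∘ suc) λ i j p q → Fin.suc-injective (h (suc i) (suc j) p q)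

#-list : {P : Fin n → Set} (P? : ∀ i → Dec (P i)) (xs : List (Fin n)) →
         (∀ i → P i → Any (i ≡_) xs) → # P? ≤ length xs
#-list P? []       h = ≤-reflexive (#-none P? λ i p → case-[] (h i p))
  where case-[] : ∀ {i} → ¬ Any (i ≡_) []
        case-[] ()
#-list {P = P} P? (x ∷ xs) h = ≤-trans
  (#-⊎ P? (Fin._≟ x) Q? split)
  (+-mono-≤ (#-unique (Fin._≟ x) λ i j p q → trans p (sym q)) (#-list Q? xs λ { i (q , _) → q }))
  where
  Q? : ∀ i → Dec (Any (i ≡_) xs × P i)
  Q? i = Any.any? (i Fin.≟_) xs ×-dec P? i
  split : ∀ i → P i → i ≡ x ⊎ (Any (i ≡_) xs × P i)
  split i p with h i p
  ... | here e  = inj₁ e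
  ... | there a = inj₂ (a , p)

#-degrees : {P : Fin n → Set} {E : Fin n → Fin l → Set}
            (P? : ∀ i → Dec (P i)) (E? : ∀ i j → Dec (E i j)) (a : ℕ) →
            (∀ i → P i → a ≤ # (E? i)) → a * # P? ≤ sum λ j → # λ i → P? i ×-dec E? i j
#-degrees {n} {l} {P} P? E? a lo = begin
  a * # P?                                   ≡⟨ *-distribˡ-sum a (λ i → ⟦ P? i ⟧) ⟩
  sum (λ i → a * ⟦ P? i ⟧)                   ≤⟨ sum-mono (λ i → row i (P? i)) ⟩
  sum (λ i → sum λ j → ⟦ P? i ⟧ * ⟦ E? i j ⟧) ≡⟨ ∑-comm (λ i j → ⟦ P? i ⟧ * ⟦ E? i j ⟧) ⟩
  sum (λ j → sum λ i → ⟦ P? i ⟧ * ⟦ E? i j ⟧) ≡⟨ sum-cong-≗ (λ j → sum-cong-≗ λ i → sym (⟦⟧-× (P? i) (E? i j))) ⟩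
  sum (λ j → # λ i → P? i ×-dec E? i j) ∎
  where
  open ≤-Reasoning
  row : ∀ i (p : Dec (P i)) → a * ⟦ p ⟧ ≤ sum λ j → ⟦ p ⟧ * ⟦ E? i j ⟧
  row i (yes p) = ≤-trans (≤-reflexive (*-identityʳ a)) (≤-trans (lo i p)
    (sum-mono {l} λ j → ≤-reflexive (sym (*-identityˡ _))))
  row i (no _) = ≤-trans (≤-reflexive (*-zeroʳ a)) z≤n

#-edges : {P : Fin n → Set} {Q : Fin l → Set} {E : Fin n → Fin l → Set}
          (P? : ∀ i → Dec (P i)) (Q? : ∀ j → Dec (Q j)) (E? : ∀ i j → Dec (E i j)) (a b : ℕ) →
          (∀ i → P i → a ≤ # λ j → Q? j ×-dec E? i j) →
          (∀ j → Q j → # (λ i → P? i ×-dec E? i j) ≤ b) → a * # P? ≤ b * # Q?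
#-edges {n} {l} {P} {Q} P? Q? E? a b lo hi = begin
  a * # P?                                             ≤⟨ #-degrees P? (λ i j → Q? j ×-dec E? i j) a lo ⟩
  sum (λ j → # λ i → P? i ×-dec (Q? j ×-dec E? i j))   ≤⟨ sum-mono (λ j → column j (Q? j)) ⟩
  sum (λ j → b * ⟦ Q? j ⟧)                             ≡⟨ *-distribˡ-sum b (λ j → ⟦ Q? j ⟧) ⟨
  b * # Q? ∎
  where
  open ≤-Reasoning
  column : ∀ j (q : Dec (Q j)) → # (λ i → P? i ×-dec (q ×-dec E? i j)) ≤ b * ⟦ q ⟧
  column j (yes q) = ≤-trans
    (#-mono (λ i → P? i ×-dec (yes q ×-dec E? i j)) (λ i → P? i ×-dec E? i j) λ _ (p , _ , e) → p , e)
    (≤-trans (hi j q) (≤-reflexive (sym (*-identityʳ b))))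
  column j (no ¬q) = ≤-trans
    (≤-reflexive (#-none (λ i → P? i ×-dec (no ¬q ×-dec E? i j)) λ _ (_ , q , _) → ¬q q)) z≤n

#-inject : {P : Fin n → Set} {Q : Fin l → Set} {E : Fin n → Fin l → Set}
           (P? : ∀ i → Dec (P i)) (Q? : ∀ j → Dec (Q j)) (E? : ∀ i j → Dec (E i j)) →
           (∀ i → P i → ∃ λ j → Q j × E i j) →
           (∀ j i i′ → E i j → E i′ j → i ≡ i′) → # P? ≤ # Q?
#-inject P? Q? E? f inj = subst₂ _≤_ (*-identityˡ _) (*-identityˡ _)
  (#-edges P? Q? E? 1 1
    (λ i p → let (j , qe) = f i p in #-positive (λ j → Q? j ×-dec E? i j) j qe)
    (λ j _ → #-unique (λ i → P? i ×-dec E? i j) λ i i′ (_ , e) (_ , e′) → inj j i i′ e e′))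

#-inject-fun : {P : Fin n → Set} {Q : Fin l → Set} (P? : ∀ i → Dec (P i)) (Q? : ∀ j → Dec (Q j))
               (h : Fin n → Fin l) → (∀ i → P i → Q (h i)) → (∀ i j → h i ≡ h j → i ≡ j) → # P? ≤ # Q?
#-inject-fun P? Q? h pq inj = #-inject P? Q? (λ i j → h i Fin.≟ j) (λ i p → h i , pq i p , refl)
  λ j i i′ e e′ → inj i i′ (trans e (sym e′))

#-all : ∀ {n} → # {n} {λ _ → ⊤} (λ _ → yes tt) ≡ n
#-all {n} = trans (sum-const n 1) (*-identityʳ n)

#-complement : {P : Fin n → Set} (P? : ∀ i → Dec (P i)) → # P? + # (¬? ∘ P?) ≡ n
#-complement {zero}  P? = refl
#-complement {suc n} P? with P? zero
... | yes _ = cong suc (#-complement (P? ∘ suc))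
... | no _  = trans (+-suc _ _) (cong suc (#-complement (P? ∘ suc)))

sum-<-const : ∀ {n} {a : Fin (suc n) → ℕ} {c} → (∀ i → a i < c) → sum a < suc n * c
sum-<-const {zero}  h = +-mono-<-≤ (h zero) z≤n
sum-<-const {suc n} h = +-mono-< (h zero) (sum-<-const (h ∘ suc))

average : ∀ (a : Fin (suc n) → ℕ) → ∃ λ i → sum a ≤ suc n * a i
average {n} a with Fin.any? (λ i → sum a ≤? suc n * a i)
... | yes p = p
... | no ¬p = ⊥-elim (<-irrefl (sym (*-distribˡ-sum (suc n) a))
                       (sum-<-const λ i → ≰⇒> λ h → ¬p (i , h)))

-- Greedy covers and hitting sets

-- A greedy cover: as long as e elements are not hit, some element hits at least e Δ / n of them.
module _ {n} {G : Fin n → Set} {E : Fin n → Fin n → Set}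
         (G? : ∀ z → Dec (G z)) (E? : ∀ z s → Dec (E z s)) (Δ e : ℕ)
         (degree : ∀ z → G z → Δ ≤ # (E? z)) where

  Unhit? : ∀ xs z → Dec (G z × ¬ Any (E z) xs)
  Unhit? xs z = G? z ×-dec ¬? (Any.any? (E? z) xs)

  -- n times the number of unhit elements is the potential, and `J` is the number of picks still
  -- affordable; each pick lowers the potential by at least e Δ.
  cover-from : ∀ J xs → n * # (Unhit? xs) < J * (e * Δ) →
               ∃ λ ys → length ys ≤ J + length xs × # (Unhit? ys) ≤ e
  cover-from J xs h with # (Unhit? xs) ≤? e
  ... | yes le = xs , m≤n+m _ J , le
  cover-from zero xs () | no _
  cover-from (suc J) xs h | no gt =
    let (y , gain) = best
        (ys , len , le) = cover-from J (y ∷ xs) (step y gain)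
    in ys , ≤-trans len (≤-reflexive (+-suc J _)) , le
    where
    hits : Fin n → ℕ
    hits y = # (λ z → Unhit? xs z ×-dec E? z y)
    total : e * Δ ≤ sum hits
    total = ≤-trans (*-monoˡ-≤ Δ (<⇒≤ (≰⇒> gt)))
      (≤-trans (≤-reflexive (*-comm _ Δ)) (#-degrees (Unhit? xs) E? Δ λ z (g , _) → degree z g))
    averaged : ∀ {m} (a : Fin m → ℕ) → 0 < m → ∃ λ i → sum a ≤ m * a i
    averaged {suc m} a _ = average a
    nonempty : 0 < n
    nonempty = ≤-trans (≤-trans (s≤s z≤n) (≰⇒> gt)) (#≤n (Unhit? xs))
    best : ∃ λ y → e * Δ ≤ n * hits y
    best = let (y , h) = averaged hits nonempty in y , ≤-trans total h
    step : ∀ y → e * Δ ≤ n * hits y → n * # (Unhit? (y ∷ xs)) < J * (e * Δ)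
    step y gain = +-cancelˡ-< (e * Δ) _ _ (begin-strict
      e * Δ + n * # (Unhit? (y ∷ xs))    ≤⟨ +-monoˡ-≤ _ gain ⟩
      n * hits y + n * # (Unhit? (y ∷ xs)) ≡⟨ *-distribˡ-+ n (hits y) _ ⟨
      n * (hits y + # (Unhit? (y ∷ xs))) ≤⟨ *-monoʳ-≤ n (#-disjoint (Unhit? xs) (λ z → Unhit? xs z ×-dec E? z y) (Unhit? (y ∷ xs))
         (λ _ → proj₁) (λ { _ (g , ¬a) → g , ¬a ∘ there }) (λ { _ (_ , e) (_ , ¬a) → ¬a (here e) })) ⟩
      n * # (Unhit? xs)                  <⟨ h ⟩
      suc J * (e * Δ) ∎)
      where open ≤-Reasoning

  cover : ∀ J → n * n < J * (e * Δ) → ∃ λ ys → length ys ≤ J × # (Unhit? ys) ≤ e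
  cover J h =
    let (ys , len , le) = cover-from J [] (≤-<-trans (*-monoʳ-≤ n (#≤n (Unhit? []))) h)
    in ys , ≤-trans len (≤-reflexive (+-identityʳ J)) , le

-- For random sets S and R the pairs (s, x) with Rel z s x are hit with high probability; here S is
-- built in Δ rounds so that almost all z see Δ different x through S, and then R hits one of these x.
module Hitting {n} {Rel : Fin n → Fin n → Fin n → Set} (Rel? : ∀ z s x → Dec (Rel z s x))
               (few : ∀ z x → # (λ s → Rel? z s x) ≤ 3) where

  Partner? : ∀ z s → Dec (∃ (Rel z s))
  Partner? z s = Fin.any? (Rel? z s)

  deg : Fin n → ℕ
  deg z = # (Partner? z)

  Seen : List (Fin n) → Fin n → Fin n → Set
  Seen S z x = Any (λ s → Rel z s x) S

  Seen? : ∀ S z x → Dec (Seen S z x)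
  Seen? S z x = Any.any? (λ s → Rel? z s x) S

  Hit : List (Fin n) → List (Fin n) → Fin n → Set
  Hit S R z = Any (Seen S z) R

  Hit? : ∀ S R z → Dec (Hit S R z)
  Hit? S R z = Any.any? (Seen? S z) R

  module _ (t Δ : ℕ) where

    Lagging? : ∀ j S z → Dec (n ≤ t * deg z × # (Seen? S z) < j)
    Lagging? j S z = (n ≤? t * deg z) ×-dec (# (Seen? S z) <? j)

    -- A round covers by the s that show z something new. If z has seen at most j ≤ Δ elements x,
    -- each of them spoils at most 3 of its partners s, so at least Δ′ partners are new. Every round
    -- leaves at most e further elements behind.
    saturate : ∀ Δ′ e J → n * n < J * (e * Δ′) → (∀ d → n ≤ t * d → Δ′ + 3 * Δ ≤ d) →
               ∀ j → j ≤ Δ → ∃ λ S → length S ≤ j * J × # (Lagging? j S) ≤ j * e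
    saturate Δ′ e J big deg≥ zero _ = [] , z≤n , ≤-reflexive (#-none (Lagging? 0 []) λ { _ (_ , ()) })
    saturate Δ′ e J big deg≥ (suc j) j<Δ =
      let (S , len , lag)  = saturate Δ′ e J big deg≥ j (<⇒≤ j<Δ)
          (ys , len′ , un) = cover (Good? S) (New? S) Δ′ e (degree S) J big
      in ys ++ S , ≤-trans (≤-reflexive (length-++ ys)) (+-mono-≤ len′ len) ,
         ≤-trans (#-⊎ (Lagging? (suc j) (ys ++ S)) (Unhit? (Good? S) (New? S) Δ′ e (degree S) ys)
                   (Lagging? j S) (split S ys))
           (+-mono-≤ un lag)
      where
      Good? : ∀ S z → Dec (n ≤ t * deg z × # (Seen? S z) ≤ j)
      Good? S z = (n ≤? t * deg z) ×-dec (# (Seen? S z) ≤? j)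
      New? : ∀ S z s → Dec (∃ λ x → Rel z s x × ¬ Seen S z x)
      New? S z s = Fin.any? λ x → Rel? z s x ×-dec ¬? (Seen? S z x)
      degree : ∀ S z → n ≤ t * deg z × # (Seen? S z) ≤ j → Δ′ ≤ # (New? S z)
      degree S z (good , seen) = +-cancelʳ-≤ (3 * Δ) _ _ (begin
        Δ′ + 3 * Δ                     ≤⟨ deg≥ (deg z) good ⟩
        deg z                          ≤⟨ #-⊎ (Partner? z) (New? S z) Old? new-old ⟩
        # (New? S z) + # Old?          ≤⟨ +-monoʳ-≤ (# (New? S z)) (≤-trans (≤-reflexive (sym (*-identityˡ _))) old≤) ⟩
        # (New? S z) + 3 * # (Seen? S z) ≤⟨ +-monoʳ-≤ (# (New? S z)) (*-monoʳ-≤ 3 (≤-trans seen (<⇒≤ j<Δ))) ⟩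
        # (New? S z) + 3 * Δ ∎)
        where
        open ≤-Reasoning
        Old? : ∀ s → Dec (∃ λ x → Seen S z x × Rel z s x)
        Old? s = Fin.any? λ x → Seen? S z x ×-dec Rel? z s x
        new-old : ∀ s → ∃ (Rel z s) → (∃ λ x → Rel z s x × ¬ Seen S z x) ⊎ (∃ λ x → Seen S z x × Rel z s x)
        new-old s (x , r) with Seen? S z x
        ... | yes q = inj₂ (x , q , r)
        ... | no ¬q = inj₁ (x , r , ¬q)
        old≤ : 1 * # Old? ≤ 3 * # (Seen? S z)
        old≤ = #-edges Old? (Seen? S z) (Rel? z) 1 3
          (λ s (x , q , r) → #-positive (λ x → Seen? S z x ×-dec Rel? z s x) x (q , r))
          (λ x _ → ≤-trans (#-mono (λ s → Old? s ×-dec Rel? z s x) (λ s → Rel? z s x) λ _ → proj₂) (few z x))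
      split : ∀ S ys z → n ≤ t * deg z × # (Seen? (ys ++ S) z) < suc j →
              ((n ≤ t * deg z × # (Seen? S z) ≤ j) × ¬ Any (λ s → ∃ λ x → Rel z s x × ¬ Seen S z x) ys)
              ⊎ (n ≤ t * deg z × # (Seen? S z) < j)
      split S ys z (good , lt) with # (Seen? S z) <? j
      ... | yes l = inj₂ (good , l)
      ... | no ¬l = inj₁ ((good , ≤-trans mono (s≤s⁻¹ lt)) , λ hit → ¬l (≤-trans (grow hit) (s≤s⁻¹ lt)))
        where
        mono : # (Seen? S z) ≤ # (Seen? (ys ++ S) z)
        mono = #-mono (Seen? S z) (Seen? (ys ++ S) z) λ x → Any.++⁺ʳ ys
        grow : Any (λ s → ∃ λ x → Rel z s x × ¬ Seen S z x) ys → # (Seen? S z) < # (Seen? (ys ++ S) z)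
        grow hit = let (x , q , ¬q) = extract ys hit in begin-strict
          # (Seen? S z)                    <⟨ ≤-refl ⟩
          1 + # (Seen? S z)                ≤⟨ +-monoˡ-≤ _ (#-positive (Fin._≟ x) x refl) ⟩
          # (Fin._≟ x) + # (Seen? S z)     ≤⟨ #-disjoint (Seen? (ys ++ S) z) (Fin._≟ x) (Seen? S z)
             (λ { _ refl → Any.++⁺ˡ q }) (λ _ → Any.++⁺ʳ ys) (λ { _ refl → ¬q }) ⟩
          # (Seen? (ys ++ S) z) ∎
          where
          open ≤-Reasoning
          extract : ∀ ys → Any (λ s → ∃ λ x → Rel z s x × ¬ Seen S z x) ys → ∃ λ x → Seen ys z x × ¬ Seen S z x
          extract (s ∷ ys) (here (x , r , ¬q)) = x , here r , ¬q
          extract (s ∷ ys) (there a) = let (x , q , ¬q) = extract ys a in x , there q , ¬q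

    -- Every z that does not lag sees at least Δ elements x, so Δ serves as the degree in a second
    -- greedy cover.
    hit-after : ∀ S e₁ e₂ J → n * n < J * (e₂ * Δ) → # (Lagging? Δ S) ≤ e₁ →
                ∃ λ R → length R ≤ J × # (λ z → (n ≤? t * deg z) ×-dec ¬? (Hit? S R z)) ≤ e₂ + e₁
    hit-after S e₁ e₂ J big lag =
      let (R , len , un) = cover Good? (Seen? S) Δ e₂ (λ _ → proj₂) J big
      in R , len , ≤-trans (#-⊎ (λ z → (n ≤? t * deg z) ×-dec ¬? (Hit? S R z)) (Unhit? Good? (Seen? S) Δ e₂ (λ _ → proj₂) R) (Lagging? Δ S) (split R)) (+-mono-≤ un lag)
      where
      Good? : ∀ z → Dec (n ≤ t * deg z × Δ ≤ # (Seen? S z))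
      Good? z = (n ≤? t * deg z) ×-dec (Δ ≤? # (Seen? S z))
      split : ∀ R z → n ≤ t * deg z × ¬ Hit S R z →
              ((n ≤ t * deg z × Δ ≤ # (Seen? S z)) × ¬ Hit S R z) ⊎ (n ≤ t * deg z × # (Seen? S z) < Δ)
      split R z (good , ¬hit) with Δ ≤? # (Seen? S z)
      ... | yes le = inj₁ ((good , le) , ¬hit)
      ... | no ¬le = inj₂ (good , ≰⇒> ¬le)

-- Rounding down costs at most a factor 2, which lets the later estimates stay multiplicative.
quotient : ∀ n d → 1 ≤ d → d ≤ n → ∃ λ q → 1 ≤ q × q * d ≤ n × n ≤ q * (2 * d)
quotient n d 1≤d d≤n = n / d , 1≤q , m/n*n≤m n d , (begin
  n                      ≡⟨ m≡m%n+[m/n]*n n d ⟩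
  n % d + n / d * d      ≤⟨ +-monoˡ-≤ _ (<⇒≤ (m%n<n n d)) ⟩
  d + n / d * d          ≡⟨ cong (_+ n / d * d) (*-identityˡ d) ⟨
  1 * d + n / d * d      ≤⟨ +-monoˡ-≤ _ (*-monoˡ-≤ d 1≤q) ⟩
  n / d * d + n / d * d  ≡⟨ lemma (n / d) d ⟩
  n / d * (2 * d) ∎)
  where
  open ≤-Reasoning
  instance _ = >-nonZero 1≤d
  1≤q : 1 ≤ n / d
  1≤q = ≤-trans (≤-reflexive (sym (n/n≡1 d))) (/-monoˡ-≤ d d≤n)
  lemma : ∀ q d → q * d + q * d ≡ q * (2 * d)
  lemma = solve-∀

1≤* : ∀ {a b} → 1 ≤ a → 1 ≤ b → 1 ≤ a * b
1≤* = *-mono-≤ {1} {_} {1}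

module HittingSet (t ε k : ℕ) (1≤t : 1 ≤ t) (1≤ε : 1 ≤ ε) (1≤k : 1 ≤ k) where

  -- With e₂ ≥ n / (4 ε) and J ≥ n / (2 k), the choice of `Δ₀` makes J e₂ Δ₀ at least 2 n². With e₁
  -- ≥ n / (4 ε Δ₀) and Δ′ ≥ n / (4 t), `J₀` picks per round suffice. So `size₀` does not depend on
  -- n. Both error terms, e₂ and Δ₀ e₁, are at most n / (2 ε).
  Δ₀ J₀ size₀ n₀ : ℕ
  Δ₀    = 16 * (ε * k)
  J₀    = suc (16 * (t * (ε * Δ₀)))
  size₀ = Δ₀ * J₀
  n₀    = 2 * (ε * Δ₀) + 12 * (t * Δ₀) + 2 * ε + 2 * k + 2 * t

  1≤Δ₀ : 1 ≤ Δ₀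
  1≤Δ₀ = 1≤* {16} (s≤s z≤n) (1≤* 1≤ε 1≤k)

  hitting-set : ∀ {n} → n₀ ≤ n → {Rel : Fin n → Fin n → Fin n → Set} (Rel? : ∀ z s x → Dec (Rel z s x)) →
    (few : ∀ z x → # (λ s → Rel? z s x) ≤ 3) → let open Hitting Rel? few in
    ∃ λ S → ∃ λ R → length S ≤ size₀ × length R * k ≤ n ×
      # (λ z → (n ≤? t * deg z) ×-dec ¬? (Hit? S R z)) * ε ≤ n
  hitting-set {n} n₀≤n Rel? few =
    let (e₁ , 1≤e₁ , e₁≤ , ≤e₁) = quotient n (2 * (ε * Δ₀)) (1≤* {2} (s≤s z≤n) (1≤* 1≤ε 1≤Δ₀))
                                   (≤-trans (farkas (12 * (t * Δ₀) + 2 * ε + 2 * k + 2 * t) (z≤n {0}) (eq₁ ε t k Δ₀)) n₀≤n)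
        (Δ′ , 1≤Δ′ , Δ′≤ , ≤Δ′) = quotient n (2 * t) (1≤* {2} (s≤s z≤n) 1≤t)
                                   (≤-trans (farkas (2 * (ε * Δ₀) + 12 * (t * Δ₀) + 2 * ε + 2 * k) (z≤n {0}) (eq₂ ε t k Δ₀)) n₀≤n)
        (e₂ , 1≤e₂ , e₂≤ , ≤e₂) = quotient n (2 * ε) (1≤* {2} (s≤s z≤n) 1≤ε)
                                   (≤-trans (farkas (2 * (ε * Δ₀) + 12 * (t * Δ₀) + 2 * k + 2 * t) (z≤n {0}) (eq₃ ε t k Δ₀)) n₀≤n)
        (J , 1≤J , J≤ , ≤J)     = quotient n k 1≤k
                                   (≤-trans (farkas (2 * (ε * Δ₀) + 12 * (t * Δ₀) + 2 * ε + k + 2 * t) (z≤n {0}) (eq₄ ε t k Δ₀)) n₀≤n)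
        3Δ≤Δ′ = *-cancelˡ-≤ {3 * Δ₀} {Δ′} (4 * t) {{>-nonZero (1≤* {4} (s≤s z≤n) 1≤t)}}
                 (farkas (2 * (ε * Δ₀) + 2 * ε + 2 * k + 2 * t) (n₀≤n ⊕ ≤Δ′) (eq₅ ε t k Δ₀ n Δ′))
        (S , lenS , lag) = Hitting.saturate Rel? few t Δ₀ Δ′ e₁ J₀
                             (big₁ e₁ Δ′ ≤e₁ ≤Δ′ (1≤* 1≤e₁ 1≤Δ′))
                             -- d ≥ n / t ≥ 2 Δ′ ≥ Δ′ + 3 Δ₀.
                             (λ d h → *-cancelˡ-≤ t {{>-nonZero 1≤t}}
                               (farkas 0 (Δ′≤ ⊕ h ⊕ t ⊗ 3Δ≤Δ′) (eq₆ t Δ₀ Δ′ n d)))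
                             Δ₀ ≤-refl
        (R , lenR , un) = Hitting.hit-after Rel? few t Δ₀ S (Δ₀ * e₁) e₂ J (big₂ e₂ J ≤e₂ ≤J (1≤* 1≤e₂ 1≤J)) lag
    in S , R , lenS , ≤-trans (*-monoˡ-≤ k lenR) J≤ ,
       ≤-trans (*-monoˡ-≤ ε un) (*-cancelˡ-≤ 2 (farkas 0 (e₁≤ ⊕ e₂≤) (eq₇ ε Δ₀ n e₁ e₂)))
    where
    eq₁ : ∀ ε t k Δ → 2 * (ε * Δ) + 0 + (12 * (t * Δ) + 2 * ε + 2 * k + 2 * t) ≡ 2 * (ε * Δ) + 12 * (t * Δ) + 2 * ε + 2 * k + 2 * t + 0
    eq₁ = solve-∀
    eq₂ : ∀ ε t k Δ → 2 * t + 0 + (2 * (ε * Δ) + 12 * (t * Δ) + 2 * ε + 2 * k) ≡ 2 * (ε * Δ) + 12 * (t * Δ) + 2 * ε + 2 * k + 2 * t + 0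
    eq₂ = solve-∀
    eq₃ : ∀ ε t k Δ → 2 * ε + 0 + (2 * (ε * Δ) + 12 * (t * Δ) + 2 * k + 2 * t) ≡ 2 * (ε * Δ) + 12 * (t * Δ) + 2 * ε + 2 * k + 2 * t + 0
    eq₃ = solve-∀
    eq₄ : ∀ ε t k Δ → k + 0 + (2 * (ε * Δ) + 12 * (t * Δ) + 2 * ε + k + 2 * t) ≡ 2 * (ε * Δ) + 12 * (t * Δ) + 2 * ε + 2 * k + 2 * t + 0
    eq₄ = solve-∀
    eq₅ : ∀ ε t k Δ n Δ′ → 4 * t * (3 * Δ) + (n + Δ′ * (2 * (2 * t))) + (2 * (ε * Δ) + 2 * ε + 2 * k + 2 * t)
          ≡ 4 * t * Δ′ + ((2 * (ε * Δ) + 12 * (t * Δ) + 2 * ε + 2 * k + 2 * t) + n)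
    eq₅ = solve-∀
    eq₆ : ∀ t Δ Δ′ n d → t * (Δ′ + 3 * Δ) + (n + (t * d + t * Δ′)) + 0 ≡ t * d + (Δ′ * (2 * t) + (n + t * (3 * Δ)))
    eq₆ = solve-∀
    eq₇ : ∀ ε Δ n e₁ e₂ → 2 * ((e₂ + Δ * e₁) * ε) + (n + n) + 0 ≡ 2 * n + (e₁ * (2 * (ε * Δ)) + e₂ * (2 * ε))
    eq₇ = solve-∀
    eq₈ : ∀ t ε Δ e Δ′ → e * (2 * (2 * (ε * Δ))) * (Δ′ * (2 * (2 * t))) ≡ 16 * (t * (ε * Δ)) * (e * Δ′)
    eq₈ = solve-∀
    eq₉ : ∀ ε k e J → e * (2 * (2 * ε)) * (J * (2 * k)) + 8 * (ε * k) * (e * J) ≡ J * (e * (16 * (ε * k)))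
    eq₉ = solve-∀
    open ≤-Reasoning
    big₁ : ∀ e Δ′ → n ≤ e * (2 * (2 * (ε * Δ₀))) → n ≤ Δ′ * (2 * (2 * t)) → 1 ≤ e * Δ′ → n * n < J₀ * (e * Δ′)
    big₁ e Δ′ h h′ pos = begin-strict
      n * n                                        ≤⟨ *-mono-≤ h h′ ⟩
      e * (2 * (2 * (ε * Δ₀))) * (Δ′ * (2 * (2 * t))) ≡⟨ eq₈ t ε Δ₀ e Δ′ ⟩
      16 * (t * (ε * Δ₀)) * (e * Δ′)               <⟨ m<n+m _ pos ⟩
      J₀ * (e * Δ′) ∎
    big₂ : ∀ e J → n ≤ e * (2 * (2 * ε)) → n ≤ J * (2 * k) → 1 ≤ e * J → n * n < J * (e * Δ₀)
    big₂ e J h h′ pos = begin-strict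
      n * n                                     ≤⟨ *-mono-≤ h h′ ⟩
      e * (2 * (2 * ε)) * (J * (2 * k))         <⟨ m<m+n _ (1≤* (1≤* {8} (s≤s z≤n) (1≤* 1≤ε 1≤k)) pos) ⟩
      e * (2 * (2 * ε)) * (J * (2 * k)) + 8 * (ε * k) * (e * J) ≡⟨ eq₉ ε k e J ⟩
      J * (e * Δ₀) ∎

-- Outer measures and Kraft's inequality

sumL : List 𝕏 → (𝕏 → ℕ) → ℕ
sumL []       F = 0
sumL (x ∷ xs) F = F x + sumL xs F

sumL-mono : ∀ (xs : List 𝕏) {F G : 𝕏 → ℕ} → (∀ x → F x ≤ G x) → sumL xs F ≤ sumL xs G
sumL-mono []       h = z≤n
sumL-mono (x ∷ xs) h = +-mono-≤ (h x) (sumL-mono xs h)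

sumL-cong : ∀ (xs : List 𝕏) {F G : 𝕏 → ℕ} → (∀ x → F x ≡ G x) → sumL xs F ≡ sumL xs G
sumL-cong []       h = refl
sumL-cong (x ∷ xs) h = cong₂ _+_ (h x) (sumL-cong xs h)

sumL-+ : ∀ (xs : List 𝕏) (F G : 𝕏 → ℕ) → sumL xs (λ x → F x + G x) ≡ sumL xs F + sumL xs G
sumL-+ []       F G = refl
sumL-+ (x ∷ xs) F G = trans (cong ((F x + G x) +_) (sumL-+ xs F G)) (lemma (F x) (G x) _ _)
  where
  lemma : ∀ a b c d → (a + b) + (c + d) ≡ (a + c) + (b + d)
  lemma = solve-∀

sumL-0 : ∀ (xs : List 𝕏) → sumL xs (λ _ → 0) ≡ 0
sumL-0 []       = refl
sumL-0 (x ∷ xs) = sumL-0 xs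

sumL-*ʳ : ∀ (xs : List 𝕏) (F : 𝕏 → ℕ) c → sumL xs (λ x → F x * c) ≡ sumL xs F * c
sumL-*ʳ []       F c = refl
sumL-*ʳ (x ∷ xs) F c = trans (cong (F x * c +_) (sumL-*ʳ xs F c)) (sym (*-distribʳ-+ c (F x) _))

sumL-const : ∀ (xs : List 𝕏) c → sumL xs (λ _ → c) ≡ length xs * c
sumL-const []       c = refl
sumL-const (x ∷ xs) c = cong (c +_) (sumL-const xs c)

sumL-map : ∀ (g : 𝕏 → 𝕐) xs (F : 𝕐 → ℕ) → sumL (List.map g xs) F ≡ sumL xs (F ∘ g)
sumL-map g []       F = refl
sumL-map g (x ∷ xs) F = cong (F (g x) +_) (sumL-map g xs F)

sumL-++ : ∀ (xs ys : List 𝕏) (F : 𝕏 → ℕ) → sumL (xs ++ ys) F ≡ sumL xs F + sumL ys F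
sumL-++ []       ys F = refl
sumL-++ (x ∷ xs) ys F = trans (cong (F x +_) (sumL-++ xs ys F)) (sym (+-assoc (F x) _ _))

sumL-term : ∀ {xs : List 𝕏} {x} (F : 𝕏 → ℕ) → x ∈′ xs → F x ≤ sumL xs F
sumL-term F (here refl)  = m≤m+n _ _
sumL-term F (there x∈xs) = ≤-trans (sumL-term F x∈xs) (m≤n+m _ _)

sumL-comm : ∀ (xs : List 𝕏) (ys : List 𝕐) (F : 𝕏 → 𝕐 → ℕ) →
            sumL xs (λ x → sumL ys (F x)) ≡ sumL ys (λ y → sumL xs λ x → F x y)
sumL-comm []       ys F = sym (sumL-0 ys)
sumL-comm (x ∷ xs) ys F = trans (cong (sumL ys (F x) +_) (sumL-comm xs ys F)) (sym (sumL-+ ys _ _))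

-- The head is summed innermost: the entry at position 0 is chosen last, when all later entries are
-- fixed.
sumV : List 𝕏 → ∀ n → (Vec 𝕏 n → ℕ) → ℕ
sumV xs zero    F = F []
sumV xs (suc n) F = sumV xs n λ t → sumL xs λ x → F (x ∷ t)

sumV-mono : ∀ (xs : List 𝕏) n {F G : Vec 𝕏 n → ℕ} → (∀ f → F f ≤ G f) → sumV xs n F ≤ sumV xs n G
sumV-mono xs zero    h = h []
sumV-mono xs (suc n) h = sumV-mono xs n λ t → sumL-mono xs λ x → h (x ∷ t)

sumV-cong : ∀ (xs : List 𝕏) n {F G : Vec 𝕏 n → ℕ} → (∀ f → F f ≡ G f) → sumV xs n F ≡ sumV xs n G
sumV-cong xs zero    h = h []
sumV-cong xs (suc n) h = sumV-cong xs n λ t → sumL-cong xs λ x → h (x ∷ t)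

sumV-+ : ∀ (xs : List 𝕏) n (F G : Vec 𝕏 n → ℕ) → sumV xs n (λ f → F f + G f) ≡ sumV xs n F + sumV xs n G
sumV-+ xs zero    F G = refl
sumV-+ xs (suc n) F G = trans (sumV-cong xs n λ t → sumL-+ xs _ _) (sumV-+ xs n _ _)

sumV-*ʳ : ∀ (xs : List 𝕏) n (F : Vec 𝕏 n → ℕ) c → sumV xs n (λ f → F f * c) ≡ sumV xs n F * c
sumV-*ʳ xs zero    F c = refl
sumV-*ʳ xs (suc n) F c = trans (sumV-cong xs n λ t → sumL-*ʳ xs _ c) (sumV-*ʳ xs n _ c)

sumV-term : ∀ {xs : List 𝕏} → (∀ x → x ∈′ xs) → ∀ {n} (F : Vec 𝕏 n → ℕ) f → F f ≤ sumV xs n F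
sumV-term ∈xs F []      = ≤-refl
sumV-term ∈xs F (x ∷ t) = ≤-trans (sumL-term (λ x → F (x ∷ t)) (∈xs x)) (sumV-term ∈xs _ t)

sumV-0 : ∀ (xs : List 𝕏) n → sumV xs n (λ _ → 0) ≡ 0
sumV-0 xs zero    = refl
sumV-0 xs (suc n) = trans (sumV-cong xs n λ _ → sumL-0 xs) (sumV-0 xs n)

sumV-sumL : ∀ (xs : List 𝕏) n (ys : List 𝕐) (F : Vec 𝕏 n → 𝕐 → ℕ) →
            sumV xs n (λ f → sumL ys (F f)) ≡ sumL ys (λ y → sumV xs n λ f → F f y)
sumV-sumL xs n []       F = sumV-0 xs n
sumV-sumL xs n (y ∷ ys) F = trans (sumV-+ xs n _ _) (cong (sumV xs n (λ f → F f y) +_) (sumV-sumL xs n ys F))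

sumV-comm : ∀ (xs : List 𝕏) n (ys : List 𝕐) m (F : Vec 𝕏 n → Vec 𝕐 m → ℕ) →
            sumV xs n (λ f → sumV ys m (F f)) ≡ sumV ys m (λ p → sumV xs n λ f → F f p)
sumV-comm xs n ys zero    F = refl
sumV-comm xs n ys (suc m) F = trans (sumV-comm xs n ys m _) (sumV-cong ys m λ t → sumV-sumL xs n ys _)

∏-mono : ∀ {n} {a b : Fin n → ℕ} → (∀ i → a i ≤ b i) → ∏ a ≤ ∏ b
∏-mono {zero}  h = ≤-refl
∏-mono {suc n} h = *-mono-≤ (h zero) (∏-mono (h ∘ suc))

∏-^ : ∀ c {n} (a : Fin n → ℕ) → ∏ (λ i → c ^ a i) ≡ c ^ sum a
∏-^ c {zero}  a = refl
∏-^ c {suc n} a = trans (cong (c ^ a zero *_) (∏-^ c (a ∘ suc))) (sym (^-distribˡ-+-* c (a zero) _))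

-- Kraft's inequality for a tree whose branching at v is governed by the later entries.
kraft : ∀ {k} (xs : List (Fin (suc k))) {n} (K : Fin n → Vec (Fin (suc k)) n → Fin (suc k) → ℕ) (u : Fin n → ℕ) →
        (∀ v f g → (∀ w → v Fin.< w → lookup f w ≡ lookup g w) → ∀ c → K v f c ≡ K v g c) →
        (∀ v f → sumL xs (K v f) ≤ u v) →
        sumV xs n (λ f → ∏ λ v → K v f (lookup f v)) ≤ ∏ u
kraft xs {zero}  K u local branch = ≤-refl
kraft {k} xs {suc n} K u local branch = begin
  sumV xs n (λ t → sumL xs λ c → K zero (c ∷ t) c * ∏ λ v → K (suc v) (c ∷ t) (lookup t v))
    -- No factor depends on the entry at position 0 except through the last argument of `K zero`, so
    -- a dummy `zero` can replace that entry everywhere else.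
    ≡⟨ sumV-cong xs n (λ t → sumL-cong xs λ c → cong₂ _*_ (local zero (c ∷ t) (zero ∷ t) (λ { (suc w) _ → refl }) c)
         (∏-cong λ v → local (suc v) (c ∷ t) (zero ∷ t) (λ { (suc w) _ → refl }) (lookup t v))) ⟩
  sumV xs n (λ t → sumL xs λ c → K zero (zero ∷ t) c * ∏ λ v → K′ v t (lookup t v))
    ≡⟨ sumV-cong xs n (λ t → sumL-*ʳ xs (K zero (zero ∷ t)) _) ⟩
  sumV xs n (λ t → sumL xs (K zero (zero ∷ t)) * ∏ λ v → K′ v t (lookup t v))
    ≤⟨ sumV-mono xs n (λ t → *-monoˡ-≤ _ (branch zero (zero ∷ t))) ⟩
  sumV xs n (λ t → u zero * ∏ λ v → K′ v t (lookup t v))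
    ≡⟨ sumV-cong xs n (λ t → *-comm (u zero) _) ⟩
  sumV xs n (λ t → (∏ λ v → K′ v t (lookup t v)) * u zero)
    ≡⟨ sumV-*ʳ xs n _ (u zero) ⟩
  sumV xs n (λ t → ∏ λ v → K′ v t (lookup t v)) * u zero
    ≤⟨ *-monoˡ-≤ (u zero) (kraft xs K′ (u ∘ suc)
         (λ v f g h → local (suc v) (zero ∷ f) (zero ∷ g) λ { (suc w) v<w → h w (s≤s⁻¹ v<w) })
         (λ v f → branch (suc v) (zero ∷ f))) ⟩
  ∏ (u ∘ suc) * u zero ≡⟨ *-comm (∏ (u ∘ suc)) (u zero) ⟩
  u zero * ∏ (u ∘ suc) ∎
  where
  open ≤-Reasoning
  K′ : Fin n → Vec (Fin (suc k)) n → Fin (suc k) → ℕ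
  K′ v t c = K (suc v) (zero ∷ t) c

sumL-tabulate : ∀ {n} (g : Fin n → 𝕏) (F : 𝕏 → ℕ) → sumL (List.tabulate g) F ≡ sum (F ∘ g)
sumL-tabulate {n = zero}  g F = refl
sumL-tabulate {n = suc n} g F = cong (F (g zero) +_) (sumL-tabulate (g ∘ suc) F)

⟦⟧-cong : ∀ {P Q : Set} (p : Dec P) (q : Dec Q) → (P → Q) → (Q → P) → ⟦ p ⟧ ≡ ⟦ q ⟧
⟦⟧-cong p q f g = ≤-antisym (⟦⟧-elim p (⟦⟧-true q ∘ f)) (⟦⟧-elim q (⟦⟧-true p ∘ g))

-- An outer measure rather than a count, so that P need not be decidable.
Bounded : List 𝕏 → ∀ {n} → (Vec 𝕏 n → Set) → ℕ → Set
Bounded {𝕏} xs {n} P M = ∃ λ (w : Vec 𝕏 n → ℕ) → (∀ f → P f → 1 ≤ w f) × sumV xs n w ≤ M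

module _ {xs : List 𝕏} {n : ℕ} where

  Bounded-mono : ∀ {P Q : Vec 𝕏 n → Set} {M N} → (∀ f → Q f → P f) → M ≤ N → Bounded xs P M → Bounded xs Q N
  Bounded-mono qp mn (w , h , b) = w , (λ f → h f ∘ qp f) , ≤-trans b mn

  Bounded-⊎ : ∀ {P Q : Vec 𝕏 n → Set} {M N} → Bounded xs P M → Bounded xs Q N → Bounded xs (λ f → P f ⊎ Q f) (M + N)
  Bounded-⊎ (w , h , b) (w′ , h′ , b′) = (λ f → w f + w′ f) ,
    (λ { f (inj₁ p) → ≤-trans (h f p) (m≤m+n _ _) ; f (inj₂ q) → ≤-trans (h′ f q) (m≤n+m _ _) }) ,
    ≤-trans (≤-reflexive (sumV-+ xs n w w′)) (+-mono-≤ b b′)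

  Bounded-∅ : ∀ {P : Vec 𝕏 n → Set} → (∀ f → ¬ P f) → Bounded xs P 0
  Bounded-∅ h = (λ _ → 0) , (λ f p → ⊥-elim (h f p)) , ≤-reflexive (sumV-0 xs n)

  -- The union bound over descriptions p. Only those with `K p` come with a bound, so the others get
  -- weight 0.
  Bounded-∃ : ∀ {ys : List 𝕐} → (∀ y → y ∈′ ys) → ∀ {m} {K : Vec 𝕐 m → Set} (K? : ∀ p → Dec (K p))
              {P : Vec 𝕐 m → Vec 𝕏 n → Set} {M N} → (∀ p → K p → Bounded xs (P p) M) →
              sumV ys m (λ p → ⟦ K? p ⟧) ≤ N → Bounded xs (λ f → ∃ λ p → K p × P p f) (N * M)
  Bounded-∃ {ys = ys} ∈ys {m} {K} K? {P} {M} {N} each N≥ =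
    (λ f → sumV ys m (λ p → weight p (K? p) f)) ,
    (λ { f (p , kp , pf) → ≤-trans (hit p (K? p) f kp pf) (sumV-term ∈ys (λ p → weight p (K? p) f) p) }) ,
    (begin
      sumV xs n (λ f → sumV ys m (λ p → weight p (K? p) f)) ≡⟨ sumV-comm xs n ys m _ ⟩
      sumV ys m (λ p → sumV xs n (weight p (K? p)))         ≤⟨ sumV-mono ys m (λ p → total p (K? p)) ⟩
      sumV ys m (λ p → ⟦ K? p ⟧ * M)                        ≡⟨ sumV-*ʳ ys m _ M ⟩
      sumV ys m (λ p → ⟦ K? p ⟧) * M                        ≤⟨ *-monoˡ-≤ M N≥ ⟩
      N * M ∎)
    where
    open ≤-Reasoning
    weight : ∀ p → Dec (K p) → Vec 𝕏 n → ℕ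
    weight p (yes k) = proj₁ (each p k)
    weight p (no _)  = λ _ → 0
    hit : ∀ p d f → K p → P p f → 1 ≤ weight p d f
    hit p (yes k) f _ pf = proj₁ (proj₂ (each p k)) f pf
    hit p (no ¬k) f k _  = ⊥-elim (¬k k)
    total : ∀ p d → sumV xs n (weight p d) ≤ ⟦ d ⟧ * M
    total p (yes k) = ≤-trans (proj₂ (proj₂ (each p k))) (≤-reflexive (sym (*-identityˡ M)))
    total p (no _)  = ≤-reflexive (sumV-0 xs n)

  Bounded-∃Fin : ∀ {m} {P : Fin m → Vec 𝕏 n → Set} {M} → (∀ i → Bounded xs (P i) M) →
                 Bounded xs (λ f → ∃ λ i → P i f) (m * M)
  Bounded-∃Fin {zero}  each = Bounded-∅ λ { _ (() , _) }
  Bounded-∃Fin {suc m} each = Bounded-mono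
    (λ { f (zero , p) → inj₁ p ; f (suc i , p) → inj₂ (i , p) }) ≤-refl
    (Bounded-⊎ (each zero) (Bounded-∃Fin (each ∘ suc)))

-- Entries are chosen from the last position down, so this is agreement in everything known when the
-- entry at v is chosen.
AgreeAbove : ∀ {n} → Fin n → Vec 𝕏 n → Vec 𝕏 n → Set
AgreeAbove v f g = ∀ w → v Fin.< w → lookup f w ≡ lookup g w

-- A weight 2 for each forced position compensates its lost choice, so Kraft's inequality still
-- bounds the total weight by the product of the local bounds. A coloring with F forced positions
-- has weight at least 2 ^ F, and Markov's inequality gives the count.
module Scheme {r n : ℕ}
  {Allowed : Fin n → Vec (Fin (suc r)) n → Fin (suc r) → Set} (Allowed? : ∀ v f c → Dec (Allowed v f c))
  {Forced : Fin n → Vec (Fin (suc r)) n → Set} (Forced? : ∀ v f → Dec (Forced v f))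
  (allowed-local : ∀ v f g → AgreeAbove v f g → ∀ c → Allowed v f c → Allowed v g c)
  (forced-local : ∀ v f g → AgreeAbove v f g → Forced v f → Forced v g)
  (b w : Fin n → ℕ)
  (branch : ∀ v f → # (Allowed? v f) * 2 ^ ⟦ Forced? v f ⟧ ≤ 2 ^ b v * r ^ w v) where

  scheme : ∀ F M → 2 ^ sum b * r ^ sum w ≤ M * 2 ^ F →
           Bounded (List.allFin (suc r)) (λ f → (∀ v → Allowed v f (lookup f v)) × F ≤ # (λ v → Forced? v f)) M
  scheme F M budget = (λ f → ⟦ Ok? f ⟧) , (λ f → ⟦⟧-true (Ok? f)) , *-cancelʳ-≤ _ M (2 ^ F) {{m^n≢0 2 F}} (begin
    sumV cs n (λ f → ⟦ Ok? f ⟧) * 2 ^ F         ≡⟨ sumV-*ʳ cs n _ (2 ^ F) ⟨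
    sumV cs n (λ f → ⟦ Ok? f ⟧ * 2 ^ F)         ≤⟨ sumV-mono cs n (λ f → pointwise f (Ok? f)) ⟩
    sumV cs n (λ f → ∏ λ v → K v f (lookup f v)) ≤⟨ kraft cs K u local (λ v f → ≤-trans (≤-reflexive (row v f)) (branch v f)) ⟩
    ∏ u                                         ≡⟨ ∏-distrib-* (λ v → 2 ^ b v) (λ v → r ^ w v) ⟩
    (∏ λ v → 2 ^ b v) * (∏ λ v → r ^ w v)       ≡⟨ cong₂ _*_ (∏-^ 2 b) (∏-^ r w) ⟩
    2 ^ sum b * r ^ sum w                       ≤⟨ budget ⟩
    M * 2 ^ F ∎)
    where
    open ≤-Reasoning
    cs = List.allFin (suc r)
    u : Fin n → ℕ
    u v = 2 ^ b v * r ^ w v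
    K : Fin n → Vec (Fin (suc r)) n → Fin (suc r) → ℕ
    K v f c = ⟦ Allowed? v f c ⟧ * 2 ^ ⟦ Forced? v f ⟧
    Ok? : ∀ f → Dec ((∀ v → Allowed v f (lookup f v)) × F ≤ # (λ v → Forced? v f))
    Ok? f = Fin.all? (λ v → Allowed? v f (lookup f v)) ×-dec (F ≤? # (λ v → Forced? v f))
    local : ∀ v f g → AgreeAbove v f g → ∀ c → K v f c ≡ K v g c
    local v f g agree c = cong₂ (λ x y → x * 2 ^ y)
      (⟦⟧-cong (Allowed? v f c) (Allowed? v g c) (allowed-local v f g agree c)
        (allowed-local v g f (λ w v<w → sym (agree w v<w)) c))
      (⟦⟧-cong (Forced? v f) (Forced? v g) (forced-local v f g agree)
        (forced-local v g f (λ w v<w → sym (agree w v<w))))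
    row : ∀ v f → sumL cs (K v f) ≡ # (Allowed? v f) * 2 ^ ⟦ Forced? v f ⟧
    row v f = trans (sumL-*ʳ cs (λ c → ⟦ Allowed? v f c ⟧) _)
      (cong (_* 2 ^ ⟦ Forced? v f ⟧) (sumL-tabulate id (λ c → ⟦ Allowed? v f c ⟧)))
    pointwise : ∀ f (ok : Dec ((∀ v → Allowed v f (lookup f v)) × F ≤ # (λ v → Forced? v f))) →
                ⟦ ok ⟧ * 2 ^ F ≤ ∏ λ v → K v f (lookup f v)
    pointwise f (no _) = z≤n
    pointwise f (yes (al , le)) = begin
      1 * 2 ^ F                                  ≡⟨ *-identityˡ _ ⟩
      2 ^ F                                      ≤⟨ ^-monoʳ-≤ 2 le ⟩
      2 ^ # (λ v → Forced? v f)                  ≡⟨ ∏-^ 2 (λ v → ⟦ Forced? v f ⟧) ⟨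
      (∏ λ v → 2 ^ ⟦ Forced? v f ⟧)              ≤⟨ ∏-mono (λ v → ≤-trans (≤-reflexive (sym (*-identityˡ _)))
                                                      (*-monoˡ-≤ (2 ^ ⟦ Forced? v f ⟧) (⟦⟧-true (Allowed? v f (lookup f v)) (al v)))) ⟩
      (∏ λ v → K v f (lookup f v)) ∎

-- Sparse partial vectors as short descriptions

Marked : ∀ {n} → Vec (Maybe 𝕏) n → Fin n → Set
Marked p i = ∃ λ x → lookup p i ≡ just x

Marked? : ∀ {n} (p : Vec (Maybe 𝕏) n) i → Dec (Marked p i)
Marked? p i with lookup p i
... | just x  = yes (x , refl)
... | nothing = no λ ()

markIf : {P : Set} → Dec P → 𝕏 → Maybe 𝕏
markIf (yes _) x = just x
markIf (no _)  x = nothing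

module _ {n} {P : Fin n → Set} (P? : ∀ i → Dec (P i)) (g : Fin n → 𝕏) where

  restrict : Vec (Maybe 𝕏) n
  restrict = tabulate λ i → markIf (P? i) (g i)

  restrict-just : ∀ i → P i → lookup restrict i ≡ just (g i)
  restrict-just i p = trans (lookup∘tabulate _ i) (at (P? i))
    where
    at : ∀ d → markIf d (g i) ≡ just (g i)
    at (yes _) = refl
    at (no ¬p) = ⊥-elim (¬p p)

  restrict-marked : ∀ i {x} → lookup restrict i ≡ just x → P i × x ≡ g i
  restrict-marked i {x} e = at (P? i) (trans (sym (lookup∘tabulate _ i)) e)
    where
    at : ∀ d → markIf d (g i) ≡ just x → P i × x ≡ g i
    at (yes p) e = p , just-injective (sym e)

  restrict-size : # (Marked? restrict) ≤ # P?
  restrict-size = #-mono (Marked? restrict) P? λ i (_ , e) → proj₁ (restrict-marked i e)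

marks : List 𝕏 → List (Maybe 𝕏)
marks vs = nothing ∷ List.map just vs

∈-marks : ∀ {vs : List 𝕏} → (∀ x → x ∈′ vs) → ∀ m → m ∈′ marks vs
∈-marks ∈vs nothing  = here refl
∈-marks ∈vs (just x) = there (∈-map⁺ just (∈vs x))

n<2^n : ∀ n → n < 2 ^ n
n<2^n zero    = s≤s z≤n
n<2^n (suc n) = ≤-trans (s≤s (n<2^n n)) (≤-trans (+-monoˡ-≤ _ (m^n>0 2 n)) (≤-reflexive (cong (2 ^ n +_) (sym (+-identityʳ _)))))

module _ (vs : List 𝕏) where

  private R = length vs

  -- This is Q to the number of unmarked entries, as a product that follows the recursion of `sumV`.
  blanks : ℕ → ∀ {n} → Vec (Maybe 𝕏) n → ℕ
  blanks Q []            = 1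
  blanks Q (nothing ∷ p) = blanks Q p * Q
  blanks Q (just _ ∷ p)  = blanks Q p * 1

  sum-blanks : ∀ Q n → sumV (marks vs) n (blanks Q) ≡ (Q + R) ^ n
  sum-blanks Q zero    = refl
  sum-blanks Q (suc n) = begin
    sumV (marks vs) n (λ t → blanks Q t * Q + sumL (List.map just vs) λ x → blanks Q (x ∷ t))
      ≡⟨ sumV-cong (marks vs) n (λ t → trans (cong (blanks Q t * Q +_) (just-part t)) (sym (*-distribˡ-+ (blanks Q t) Q R))) ⟩
    sumV (marks vs) n (λ t → blanks Q t * (Q + R)) ≡⟨ sumV-*ʳ (marks vs) n (blanks Q) (Q + R) ⟩
    sumV (marks vs) n (blanks Q) * (Q + R)         ≡⟨ cong (_* (Q + R)) (sum-blanks Q n) ⟩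
    (Q + R) ^ n * (Q + R)                          ≡⟨ *-comm _ (Q + R) ⟩
    (Q + R) * (Q + R) ^ n ∎
    where
    open ≡-Reasoning
    just-part : ∀ t → sumL (List.map just vs) (λ x → blanks Q (x ∷ t)) ≡ blanks Q t * R
    just-part t = trans (sumL-map just vs _) (trans (sumL-const vs (blanks Q t * 1))
      (trans (*-comm R _) (cong (_* R) (*-identityʳ (blanks Q t)))))

  blanks-marked : ∀ Q {n} (p : Vec (Maybe 𝕏) n) → Q ^ # (Marked? p) * blanks Q p ≡ Q ^ n
  blanks-marked Q []            = refl
  blanks-marked Q (nothing ∷ p) = trans (sym (*-assoc (Q ^ # (Marked? p)) (blanks Q p) Q))
    (trans (*-comm _ Q) (cong (Q *_) (blanks-marked Q p)))
  blanks-marked Q (just _ ∷ p)  = trans (cong (Q * Q ^ # (Marked? p) *_) (*-identityʳ _))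
    (trans (*-assoc Q _ _) (cong (Q *_) (blanks-marked Q p)))

  -- Markov's inequality for the generating function of the number of unmarked entries.
  sparse-weight : ∀ Q .{{_ : NonZero Q}} n k →
                  sumV (marks vs) n (λ p → ⟦ # (Marked? p) ≤? k ⟧) * Q ^ n ≤ (Q + R) ^ n * Q ^ k
  sparse-weight Q n k = begin
    sumV (marks vs) n (λ p → ⟦ # (Marked? p) ≤? k ⟧) * Q ^ n ≡⟨ sumV-*ʳ (marks vs) n _ (Q ^ n) ⟨
    sumV (marks vs) n (λ p → ⟦ # (Marked? p) ≤? k ⟧ * Q ^ n) ≤⟨ sumV-mono (marks vs) n (λ p → pointwise p (# (Marked? p) ≤? k)) ⟩
    sumV (marks vs) n (λ p → blanks Q p * Q ^ k)             ≡⟨ sumV-*ʳ (marks vs) n _ (Q ^ k) ⟩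
    sumV (marks vs) n (blanks Q) * Q ^ k                     ≡⟨ cong (_* Q ^ k) (sum-blanks Q n) ⟩
    (Q + R) ^ n * Q ^ k ∎
    where
    open ≤-Reasoning
    pointwise : ∀ p (d : Dec (# (Marked? p) ≤ k)) → ⟦ d ⟧ * Q ^ n ≤ blanks Q p * Q ^ k
    pointwise p (no _)  = z≤n
    pointwise p (yes h) = begin
      1 * Q ^ n                         ≡⟨ *-identityˡ _ ⟩
      Q ^ n                             ≡⟨ blanks-marked Q p ⟨
      Q ^ # (Marked? p) * blanks Q p    ≤⟨ *-monoˡ-≤ _ (^-monoʳ-≤ Q h) ⟩
      Q ^ k * blanks Q p                ≡⟨ *-comm (Q ^ k) _ ⟩
      blanks Q p * Q ^ k ∎

-- (1 + 1 / q) ^ j ≤ 1 / (1 - j / q)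
compound : ∀ q j {l} → j + l ≡ q → suc q ^ j * l ≤ q ^ j * q
compound q zero    refl = ≤-refl
compound q (suc j) {l} e = begin
  suc q * suc q ^ j * l         ≡⟨ *-assoc (suc q) (suc q ^ j) l ⟩
  suc q * (suc q ^ j * l)       ≡⟨ swap (suc q) (suc q ^ j) l ⟩
  suc q ^ j * (suc q * l)       ≤⟨ *-monoʳ-≤ (suc q ^ j) (farkas (suc j) (≤-refl {0}) (eq q j l e)) ⟩
  suc q ^ j * (q * suc l)       ≡⟨ swap (suc q ^ j) q (suc l) ⟩
  q * (suc q ^ j * suc l)       ≤⟨ *-monoʳ-≤ q (compound q j (trans (+-suc j l) e)) ⟩
  q * (q ^ j * q)               ≡⟨ *-assoc q (q ^ j) q ⟨
  q * q ^ j * q ∎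
  where
  open ≤-Reasoning
  swap : ∀ a b c → a * (b * c) ≡ b * (a * c)
  swap = solve-∀
  eq′ : ∀ j l → suc (suc j + l) * l + 0 + suc j ≡ (suc j + l) * suc l + 0
  eq′ = solve-∀
  eq : ∀ q j l → suc j + l ≡ q → suc q * l + 0 + suc j ≡ q * suc l + 0
  eq _ j l refl = eq′ j l

compound-half : ∀ h .{{_ : NonZero h}} → suc (2 * h) ^ h ≤ 2 * (2 * h) ^ h
compound-half h = *-cancelʳ-≤ _ _ h (≤-trans (compound (2 * h) h (cong (h +_) (sym (+-identityʳ h))))
  (≤-reflexive (eq h ((2 * h) ^ h))))
  where
  eq : ∀ h x → x * (2 * h) ≡ 2 * x * h
  eq = solve-∀

^-distribʳ-* : ∀ k a b → (a * b) ^ k ≡ a ^ k * b ^ k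
^-distribʳ-* zero    a b = refl
^-distribʳ-* (suc k) a b = trans (cong (a * b *_) (^-distribʳ-* k a b)) (lemma a b (a ^ k) (b ^ k))
  where
  lemma : ∀ a b x y → a * b * (x * y) ≡ a * x * (b * y)
  lemma = solve-∀

-- (1 + 1 / (2 h)) ^ h ≤ 2 is applied to each block of h factors; d pads n to a multiple of h.
compound-pow : ∀ h .{{_ : NonZero h}} n → suc (2 * h) ^ n ≤ 2 ^ suc (n / h) * (2 * h) ^ n
compound-pow h n = *-cancelʳ-≤ _ _ ((2 * h) ^ d) {{m^n≢0 (2 * h) d}} (begin
  suc (2 * h) ^ n * (2 * h) ^ d        ≤⟨ *-monoʳ-≤ (suc (2 * h) ^ n) (^-monoˡ-≤ d (n≤1+n (2 * h))) ⟩
  suc (2 * h) ^ n * suc (2 * h) ^ d    ≡⟨ ^-distribˡ-+-* (suc (2 * h)) n d ⟨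
  suc (2 * h) ^ (n + d)                ≡⟨ cong (suc (2 * h) ^_) (m+[n∸m]≡n n≤) ⟩
  suc (2 * h) ^ (h * q)                ≡⟨ ^-*-assoc (suc (2 * h)) h q ⟨
  (suc (2 * h) ^ h) ^ q                ≤⟨ ^-monoˡ-≤ q (compound-half h) ⟩
  (2 * (2 * h) ^ h) ^ q                ≡⟨ ^-distribʳ-* q 2 ((2 * h) ^ h) ⟩
  2 ^ q * ((2 * h) ^ h) ^ q            ≡⟨ cong (2 ^ q *_) (^-*-assoc (2 * h) h q) ⟩
  2 ^ q * (2 * h) ^ (h * q)            ≡⟨ cong (λ m → 2 ^ q * (2 * h) ^ m) (m+[n∸m]≡n n≤) ⟨
  2 ^ q * (2 * h) ^ (n + d)            ≡⟨ cong (2 ^ q *_) (^-distribˡ-+-* (2 * h) n d) ⟩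
  2 ^ q * ((2 * h) ^ n * (2 * h) ^ d)  ≡⟨ *-assoc (2 ^ q) _ _ ⟨
  2 ^ q * (2 * h) ^ n * (2 * h) ^ d ∎)
  where
  open ≤-Reasoning
  q = suc (n / h)
  instance
    2h≢0 : NonZero (2 * h)
    2h≢0 = m*n≢0 2 h
  n≤ : n ≤ h * q
  n≤ = ≤-trans (≤-reflexive (m≡m%n+[m/n]*n n h)) (≤-trans (+-monoˡ-≤ _ (<⇒≤ (m%n<n n h))) (≤-reflexive (*-comm q h)))
  d = h * q ∸ n

-- With Q = 2 h R the generating function contributes (1 + 1 / (2 h)) ^ n, about n / h bits, while k
-- ≤ n / (Q h) marks cost a factor Q ^ k, at most Q k ≤ n / h bits. With rounding this is 3 n / h.
module Sparse (vs : List 𝕏) (h : ℕ) (1≤R : 1 ≤ length vs) (1≤h : 1 ≤ h) where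

  private
    R = length vs
    Q = 2 * h * R

  abstract
    gap : ℕ
    gap = Q * h

    gap≡ : gap ≡ 2 * h * length vs * h
    gap≡ = refl

    1≤gap : 1 ≤ gap
    1≤gap = 1≤* (1≤* (1≤* {2} (s≤s z≤n) 1≤h) 1≤R) 1≤h

  SparseMarks? : ∀ {n} (p : Vec (Maybe 𝕏) n) → Dec (# (Marked? p) * gap ≤ n)
  SparseMarks? {n} p = # (Marked? p) * gap ≤? n

  sparse-count : ∀ n → h ≤ n → ∃ λ e → e * h ≤ 3 * n × sumV (marks vs) n (λ p → ⟦ SparseMarks? p ⟧) ≤ 2 ^ e
  sparse-count n h≤n = suc (n / h) + Q * k , small , *-cancelʳ-≤ _ _ (Q ^ n) {{m^n≢0 Q n}} (begin
    sumV (marks vs) n (λ p → ⟦ SparseMarks? p ⟧) * Q ^ n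
      ≤⟨ *-monoˡ-≤ (Q ^ n) (sumV-mono (marks vs) n (λ p → ⟦⟧-elim (SparseMarks? p) λ s → ⟦⟧-true (# (Marked? p) ≤? k) (to s))) ⟩
    sumV (marks vs) n (λ p → ⟦ # (Marked? p) ≤? k ⟧) * Q ^ n
      ≤⟨ sparse-weight vs Q n k ⟩
    (Q + R) ^ n * Q ^ k
      ≡⟨ cong (λ x → x ^ n * Q ^ k) (eq h R) ⟩
    (suc (2 * h) * R) ^ n * Q ^ k
      ≡⟨ cong (_* Q ^ k) (^-distribʳ-* n (suc (2 * h)) R) ⟩
    suc (2 * h) ^ n * R ^ n * Q ^ k
      ≤⟨ *-monoˡ-≤ (Q ^ k) (*-monoˡ-≤ (R ^ n) (compound-pow h n)) ⟩
    2 ^ suc (n / h) * (2 * h) ^ n * R ^ n * Q ^ k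
      ≡⟨ cong (_* Q ^ k) (trans (*-assoc (2 ^ suc (n / h)) _ _) (cong (2 ^ suc (n / h) *_) (sym (^-distribʳ-* n (2 * h) R)))) ⟩
    2 ^ suc (n / h) * Q ^ n * Q ^ k
      ≤⟨ *-monoʳ-≤ (2 ^ suc (n / h) * Q ^ n) (≤-trans (^-monoˡ-≤ k (<⇒≤ (n<2^n Q))) (≤-reflexive (^-*-assoc 2 Q k))) ⟩
    2 ^ suc (n / h) * Q ^ n * 2 ^ (Q * k)
      ≡⟨ eq′ (2 ^ suc (n / h)) (Q ^ n) (2 ^ (Q * k)) ⟩
    2 ^ suc (n / h) * 2 ^ (Q * k) * Q ^ n
      ≡⟨ cong (_* Q ^ n) (^-distribˡ-+-* 2 (suc (n / h)) (Q * k)) ⟨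
    2 ^ (suc (n / h) + Q * k) * Q ^ n ∎)
    where
    open ≤-Reasoning
    instance
      h≢0 : NonZero h
      h≢0 = >-nonZero 1≤h
      R≢0 : NonZero R
      R≢0 = >-nonZero 1≤R
      Q≢0 : NonZero Q
      Q≢0 = >-nonZero (1≤* (1≤* {2} (s≤s z≤n) 1≤h) 1≤R)
      gap≢0 : NonZero gap
      gap≢0 = >-nonZero 1≤gap
    k = n / gap
    to : ∀ {m} → m * gap ≤ n → m ≤ k
    to {m} le = ≤-trans (≤-reflexive (sym (m*n/n≡m m gap))) (/-monoˡ-≤ gap le)
    eq : ∀ h R → 2 * h * R + R ≡ suc (2 * h) * R
    eq = solve-∀
    eq′ : ∀ x y z → x * y * z ≡ x * z * y
    eq′ = solve-∀
    eq″ : ∀ a h Q k n → (suc a + Q * k) * h + (n + (n + n)) + 0 ≡ 3 * n + (h + (a * h + k * (Q * h)))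
    eq″ = solve-∀
    small : (suc (n / h) + Q * k) * h ≤ 3 * n
    small = farkas 0 (h≤n ⊕ m/n*n≤m n h ⊕ subst (λ g → k * g ≤ n) gap≡ (m/n*n≤m n gap)) (eq″ (n / h) h Q k n)

-- Progressions and colorings

Mid : Fin n → Fin n → Fin n → Set
Mid x y z = toℕ x + toℕ z ≡ 2 * toℕ y

Mid-sym : ∀ {x y z : Fin n} → Mid x y z → Mid z y x
Mid-sym {x = x} {z = z} m = trans (+-comm (toℕ z) (toℕ x)) m

-- Any of the three terms may be the middle one, so that a pair completing z may lie on both sides
-- of z or on one side.
AP3 : Fin n → Fin n → Fin n → Set
AP3 x y z = (x ≢ y × y ≢ z × x ≢ z) × (Mid x y z ⊎ Mid y x z ⊎ Mid x z y)

abstract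
  AP3? : ∀ (x y z : Fin n) → Dec (AP3 x y z)
  AP3? x y z = (¬? (x Fin.≟ y) ×-dec ¬? (y Fin.≟ z) ×-dec ¬? (x Fin.≟ z)) ×-dec
               ((_ ≟ _) ⊎-dec (_ ≟ _) ⊎-dec (_ ≟ _))

AP3-swap₁₂ : ∀ {x y z : Fin n} → AP3 x y z → AP3 y x z
AP3-swap₁₂ {x = x} {y} {z} ((xy , yz , xz) , m) = (xy ∘ sym , xz , yz) , swap m
  where
  swap : Mid x y z ⊎ Mid y x z ⊎ Mid x z y → Mid y x z ⊎ Mid x y z ⊎ Mid y z x
  swap (inj₁ m)        = inj₂ (inj₁ m)
  swap (inj₂ (inj₁ m)) = inj₁ m
  swap (inj₂ (inj₂ m)) = inj₂ (inj₂ (Mid-sym {x = x} {z} {y} m))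

AP3-swap₂₃ : ∀ {x y z : Fin n} → AP3 x y z → AP3 x z y
AP3-swap₂₃ {x = x} {y} {z} ((xy , yz , xz) , m) = (xz , yz ∘ sym , xy) , swap m
  where
  swap : Mid x y z ⊎ Mid y x z ⊎ Mid x z y → Mid x z y ⊎ Mid z x y ⊎ Mid x y z
  swap (inj₁ m)        = inj₂ (inj₂ m)
  swap (inj₂ (inj₁ m)) = inj₂ (inj₁ (Mid-sym {x = y} {x} {z} m))
  swap (inj₂ (inj₂ m)) = inj₁ m

toℕ-cancel : ∀ {a b : Fin n} c → toℕ a + c ≡ toℕ b + c → a ≡ b
toℕ-cancel {a = a} {b} c e = Fin.toℕ-injective (+-cancelʳ-≡ c (toℕ a) (toℕ b) e)

toℕ-cancel₂ : ∀ {a b : Fin n} → 2 * toℕ a ≡ 2 * toℕ b → a ≡ b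
toℕ-cancel₂ {a = a} {b} e = Fin.toℕ-injective (*-cancelˡ-≡ (toℕ a) (toℕ b) 2 e)

-- Once it is fixed which term is the middle, z and x determine s.
AP3-few : ∀ (z x : Fin n) → # (λ s → AP3? z s x) ≤ 3
AP3-few z x = ≤-trans
  (#-⊎ (λ s → AP3? z s x) A? (λ s → B? s ⊎-dec C? s) (λ _ → proj₂))
  (+-mono-≤ (#-unique A? λ s s′ p q → toℕ-cancel₂ (trans (sym p) q))
    (≤-trans (#-⊎ (λ s → B? s ⊎-dec C? s) B? C? (λ _ → id))
      (+-mono-≤ (#-unique B? λ s s′ p q → toℕ-cancel (toℕ x) (trans p (sym q)))
                (#-unique C? λ s s′ p q → toℕ-cancel (toℕ z) (trans (+-comm (toℕ s) (toℕ z)) (trans p (trans (sym q) (+-comm (toℕ z) (toℕ s′)))))))))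
  where
  A? : ∀ s → Dec (Mid z s x)
  A? s = _ ≟ _
  B? : ∀ s → Dec (Mid s z x)
  B? s = _ ≟ _
  C? : ∀ s → Dec (Mid z x s)
  C? s = _ ≟ _

par : Fin n → Parity
par i = parity (toℕ i)

even-half : ∀ m → parity m ≡ 0ℙ → ∃ λ w → 2 * w ≡ m
even-half zero          _ = 0 , refl
even-half (suc (suc m)) e = let (w , h) = even-half m e in suc w , trans (*-suc 2 w) (cong (2 +_) h)

p+p : ∀ p → p ℙ.+ p ≡ 0ℙ
p+p 0ℙ = refl
p+p 1ℙ = refl

midpoint : ∀ (x z : Fin n) → par x ≡ par z → ∃ λ w → Mid x w z
midpoint {n} x z e =
  let (w , h) = even-half (toℕ x + toℕ z) (trans (ℙ.+-homo-+ (toℕ x) (toℕ z)) (trans (cong (ℙ._+ par z) e) (p+p (par z))))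
      w<n = *-cancelˡ-< 2 w n (≤-<-trans (≤-reflexive h)
              (subst (toℕ x + toℕ z <_) (cong (n +_) (sym (+-identityʳ n))) (+-mono-< (Fin.toℕ<n x) (Fin.toℕ<n z))))
  in fromℕ< w<n , sym (trans (cong (2 *_) (Fin.toℕ-fromℕ< w<n)) h)

Mid⇒AP3 : ∀ {x w z : Fin n} → x ≢ z → Mid x w z → AP3 x w z
Mid⇒AP3 {x = x} {w} {z} x≢z m = ((λ { refl → x≢z (x≡z m) }) , (λ { refl → x≢z (z≡x m) }) , x≢z) , inj₁ m
  where
  x≡z : toℕ x + toℕ z ≡ 2 * toℕ x → x ≡ z
  x≡z e = sym (Fin.toℕ-injective (+-cancelˡ-≡ (toℕ x) (toℕ z) (toℕ x) (trans e (cong (toℕ x +_) (+-identityʳ _)))))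
  z≡x : toℕ x + toℕ z ≡ 2 * toℕ z → x ≡ z
  z≡x e = Fin.toℕ-injective (+-cancelʳ-≡ (toℕ z) (toℕ x) (toℕ z) (trans e (cong (toℕ z +_) (+-identityʳ _))))

par? : ∀ p (i : Fin n) → Dec (par i ≡ p)
par? p i = par i ℙ.≟ p

one-of-two : ∀ p → ⟦ 0ℙ ℙ.≟ p ⟧ + ⟦ 1ℙ ℙ.≟ p ⟧ ≡ 1
one-of-two 0ℙ = refl
one-of-two 1ℙ = refl

#-parity-step : ∀ n p → # {suc (suc n)} (par? p) ≡ suc (# {n} (par? p))
#-parity-step n p = trans (sym (+-assoc ⟦ 0ℙ ℙ.≟ p ⟧ ⟦ 1ℙ ℙ.≟ p ⟧ _)) (cong (_+ # {n} (par? p)) (one-of-two p))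

#-parity-≤ : ∀ n p → 2 * # {n} (par? p) ≤ suc n
#-parity-≤ zero          p = z≤n
#-parity-≤ (suc zero)    p = *-monoʳ-≤ 2 (#≤n {1} (par? p))
#-parity-≤ (suc (suc n)) p = ≤-trans (≤-reflexive (trans (cong (2 *_) (#-parity-step n p)) (*-suc 2 _)))
  (s≤s (s≤s (#-parity-≤ n p)))

#-parity-≥ : ∀ n p → n ≤ suc (2 * # {n} (par? p))
#-parity-≥ zero          p = z≤n
#-parity-≥ (suc zero)    p = s≤s z≤n
#-parity-≥ (suc (suc n)) p = ≤-trans (s≤s (s≤s (#-parity-≥ n p)))
  (≤-reflexive (cong suc (sym (trans (cong (2 *_) (#-parity-step n p)) (*-suc 2 _)))))

-- Colorings as vectors

-- One alphabet for all positions puts the colorings of every A into the same space of vectors, over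
-- which the outer measures are defined.
embed : ∀ {r} {A : Subset n} → Coloring r A → Vec (Fin (suc r)) n
embed []       = []
embed (c ∷ κ)  = suc c ∷ embed κ
embed (skip κ) = zero ∷ embed κ

embed-∈ : ∀ {r} {A : Subset n} (κ : Coloring r A) {i} (i∈A : i ∈ A) → lookup (embed κ) i ≡ suc (color κ i∈A)
embed-∈ (c ∷ κ)  here        = refl
embed-∈ (c ∷ κ)  (there i∈A) = embed-∈ κ i∈A
embed-∈ (skip κ) (there i∈A) = embed-∈ κ i∈A

embed-∉ : ∀ {r} {A : Subset n} (κ : Coloring r A) {i} → i ∉ A → lookup (embed κ) i ≡ zero
embed-∉ (c ∷ κ)  {zero}  i∉A = ⊥-elim (i∉A here)
embed-∉ (c ∷ κ)  {suc i} i∉A = embed-∉ κ (i∉A ∘ there)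
embed-∉ (skip κ) {zero}  i∉A = refl
embed-∉ (skip κ) {suc i} i∉A = embed-∉ κ (i∉A ∘ there)

-- The color zero means absence from A.
record Good {r n} (A : Subset n) (f : Vec (Fin (suc r)) n) : Set where
  field
    present : ∀ i → i ∈ A → lookup f i ≢ zero
    absent  : ∀ i → i ∉ A → lookup f i ≡ zero
    free    : ∀ {x y z} → AP3 x y z → x ∈ A → y ∈ A → z ∈ A → ¬ Rainbow (lookup f x) (lookup f y) (lookup f z)

module _ {r} {A : Subset n} {κ : Coloring r A} (κ-free : RainbowFree κ) where

  private
    f = lookup (embed κ)

    increasing : ∀ {x y z : Fin n} → toℕ x < toℕ y → Mid x y z → IsAP x y z
    increasing {x} {y} {z} x<y m = fromℕ< d<n ,
      trans (cong suc y≡) (cong (suc (toℕ x) +_) (sym el)) ,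
      trans (cong suc z≡) (cong (λ e → suc (toℕ x) + 2 * e) (sym el))
      where
      -- `element` adds 1, so the index standing for the difference y - x is one less than it.
      d = toℕ y ∸ suc (toℕ x)
      y≡ : toℕ y ≡ toℕ x + suc d
      y≡ = trans (sym (m+[n∸m]≡n x<y)) (sym (+-suc (toℕ x) d))
      d<n : d < _
      d<n = ≤-<-trans (m∸n≤m (toℕ y) (suc (toℕ x))) (Fin.toℕ<n y)
      el : element (fromℕ< d<n) ≡ suc d
      el = cong suc (Fin.toℕ-fromℕ< d<n)
      eq : ∀ x d → 2 * (x + d) ≡ x + (x + 2 * d)
      eq = solve-∀
      z≡ : toℕ z ≡ toℕ x + 2 * suc d
      z≡ = +-cancelˡ-≡ (toℕ x) _ _ (trans m (trans (cong (2 *_) y≡) (eq (toℕ x) (suc d))))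

    Rainbow-embed : ∀ {x y z} (x∈A : x ∈ A) (y∈A : y ∈ A) (z∈A : z ∈ A) → Rainbow (f x) (f y) (f z) →
                    Rainbow (color κ x∈A) (color κ y∈A) (color κ z∈A)
    Rainbow-embed x∈A y∈A z∈A (xy , xz , yz) =
      (λ e → xy (trans (embed-∈ κ x∈A) (trans (cong suc e) (sym (embed-∈ κ y∈A))))) ,
      (λ e → xz (trans (embed-∈ κ x∈A) (trans (cong suc e) (sym (embed-∈ κ z∈A))))) ,
      (λ e → yz (trans (embed-∈ κ y∈A) (trans (cong suc e) (sym (embed-∈ κ z∈A)))))

    mid-free : ∀ {x y z} → x ≢ y → Mid x y z → x ∈ A → y ∈ A → z ∈ A → ¬ Rainbow (f x) (f y) (f z)
    mid-free {x} {y} {z} x≢y m x∈A y∈A z∈A rb@(xy , xz , yz) with <-cmp (toℕ x) (toℕ y)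
    ... | tri< x<y _ _ = κ-free x x∈A y y∈A z z∈A (increasing x<y m) (Rainbow-embed x∈A y∈A z∈A rb)
    ... | tri≈ _ e _   = x≢y (Fin.toℕ-injective e)
    ... | tri> _ _ y<x = κ-free z z∈A y y∈A x x∈A (increasing z<y (Mid-sym {x = x} {y} {z} m))
                           (Rainbow-embed z∈A y∈A x∈A (yz ∘ sym , xz ∘ sym , xy ∘ sym))
      where
      z<y : toℕ z < toℕ y
      z<y = +-cancelˡ-< (toℕ y) _ _ (<-≤-trans (+-monoˡ-< (toℕ z) y<x)
              (≤-reflexive (trans m (cong (toℕ y +_) (+-identityʳ _)))))

  embed-good : Good A (embed κ)
  embed-good = record
    { present = λ i i∈A e → Fin.0≢1+n (trans (sym e) (embed-∈ κ i∈A))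
    ; absent  = λ i i∉A → embed-∉ κ i∉A
    ; free    = λ { ((xy , yz , xz) , inj₁ m) x∈A y∈A z∈A rb → mid-free xy m x∈A y∈A z∈A rb
                  ; ((xy , yz , xz) , inj₂ (inj₁ m)) x∈A y∈A z∈A (fxy , fxz , fyz) →
                      mid-free (xy ∘ sym) m y∈A x∈A z∈A (fxy ∘ sym , fyz , fxz)
                  ; ((xy , yz , xz) , inj₂ (inj₂ m)) x∈A y∈A z∈A (fxy , fxz , fyz) →
                      mid-free xz m x∈A z∈A y∈A (fxz , fxy , fyz ∘ sym) } }

-- Injectivity of `embed` in summed form: distinct colorings use distinct terms of the right-hand
-- side, and the induction selects those terms position by position.
sum-colorings : ∀ r (A : Subset n) (w : Vec (Fin (suc r)) n → ℕ) →
                sumL (colorings r A) (w ∘ embed) ≤ sumV (List.allFin (suc r)) n w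
sum-colorings r [] w = ≤-reflexive (+-identityʳ _)
sum-colorings {suc n} r (outside Vec.∷ A) w = begin
  sumL (List.map skip (colorings r A)) (w ∘ embed)       ≡⟨ sumL-map skip (colorings r A) _ ⟩
  sumL (colorings r A) (λ κ → w (zero ∷ embed κ))        ≤⟨ sum-colorings r A (λ t → w (zero ∷ t)) ⟩
  sumV (List.allFin (suc r)) n (λ t → w (zero ∷ t))      ≤⟨ sumV-mono (List.allFin (suc r)) n (λ t → m≤m+n _ _) ⟩
  sumV (List.allFin (suc r)) (suc n) w ∎
  where open ≤-Reasoning
sum-colorings {suc n} r (inside Vec.∷ A) w = begin
  sumL (List.cartesianProductWith _∷_ (List.allFin r) (colorings r A)) (w ∘ embed)
    ≡⟨ product (List.allFin r) ⟩
  sumL (List.allFin r) (λ c → sumL (colorings r A) λ κ → w (suc c ∷ embed κ))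
    ≡⟨ sumL-comm (List.allFin r) (colorings r A) _ ⟩
  sumL (colorings r A) (λ κ → sumL (List.allFin r) λ c → w (suc c ∷ embed κ))
    ≤⟨ sum-colorings r A (λ t → sumL (List.allFin r) λ c → w (suc c ∷ t)) ⟩
  sumV (List.allFin (suc r)) n (λ t → sumL (List.allFin r) λ c → w (suc c ∷ t))
    ≤⟨ sumV-mono (List.allFin (suc r)) n (λ t → ≤-trans (≤-reflexive (trans (sumL-tabulate {n = r} id (λ c → w (suc c ∷ t))) (sym (sumL-tabulate {n = r} suc (λ c → w (c ∷ t)))))) (m≤n+m _ (w (zero ∷ t)))) ⟩
  sumV (List.allFin (suc r)) (suc n) w ∎
  where
  open ≤-Reasoning
  product : ∀ cs → sumL (List.cartesianProductWith _∷_ cs (colorings r A)) (w ∘ embed) ≡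
                   sumL cs (λ c → sumL (colorings r A) λ κ → w (suc c ∷ embed κ))
  product []       = refl
  product (c ∷ cs) = trans (sumL-++ (List.map (c ∷_) (colorings r A)) _ _)
    (cong₂ _+_ (sumL-map (c ∷_) (colorings r A) _) (product cs))

length-filter-≤ : ∀ {X : Set} {P : X → Set} (P? : Decidable P) {w : X → ℕ} → (∀ x → P x → 1 ≤ w x) →
                  ∀ xs → length (List.filter P? xs) ≤ sumL xs w
length-filter-≤ P? h []       = z≤n
length-filter-≤ P? {w} h (x ∷ xs) with P? x
... | yes p = +-mono-≤ (h x p) (length-filter-≤ P? h xs)
... | no _  = ≤-trans (length-filter-≤ P? h xs) (m≤n+m _ (w x))

g-bound : ∀ {r} (A : Subset n) {M} → Bounded (List.allFin (suc r)) (Good {r} A) M → g r A ≤ M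
g-bound {n} {r} A (w , h , b) = ≤-trans
  (length-filter-≤ rainbowFree? {w ∘ embed} (λ κ free → h (embed κ) (embed-good free)) (colorings r A))
  (≤-trans (sum-colorings r A w) b)

∣A∣≡# : ∀ (A : Subset n) → ∣ A ∣ ≡ # (_∈? A)
∣A∣≡# []              = refl
∣A∣≡# (inside Vec.∷ A)  = cong suc (trans (∣A∣≡# A) (shift {s = inside} A))
  where
  shift : ∀ {n} {s} (A : Subset n) → # (_∈? A) ≡ # (λ i → suc i ∈? (s Vec.∷ A))
  shift {s = s} A = sum-cong-≗ λ i → ⟦⟧-cong (i ∈? A) (suc i ∈? (s Vec.∷ A)) there λ { (there p) → p }
∣A∣≡# (outside Vec.∷ A) = trans (∣A∣≡# A)
  (sum-cong-≗ λ i → ⟦⟧-cong (i ∈? A) (suc i ∈? (outside Vec.∷ A)) there λ { (there p) → p })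

∣A∣+∁ : ∀ (A : Subset n) → ∣ A ∣ + # (λ i → ¬? (i ∈? A)) ≡ n
∣A∣+∁ A = trans (cong (_+ # (λ i → ¬? (i ∈? A))) (∣A∣≡# A)) (#-complement (_∈? A))

#-two : ∀ {k} {P : Fin k → Set} (P? : ∀ i → Dec (P i)) (a b : Fin k) → (∀ i → P i → i ≡ a ⊎ i ≡ b) → # P? ≤ 2
#-two P? a b h = #-list P? (a ∷ b ∷ []) λ i p → to (h i p)
  where
  to : ∀ {i} → i ≡ a ⊎ i ≡ b → Any (i ≡_) (a ∷ b ∷ [])
  to (inj₁ e) = here e
  to (inj₂ e) = there (here e)

#-one : ∀ {k} {P : Fin k → Set} (P? : ∀ i → Dec (P i)) (a : Fin k) → (∀ i → P i → i ≡ a) → # P? ≤ 1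
#-one P? a h = #-unique P? λ i j p q → trans (h i p) (sym (h j q))

#-nonzero : ∀ {r} {P : Fin (suc r) → Set} (P? : ∀ i → Dec (P i)) → (∀ i → P i → i ≢ zero) → # P? ≤ r
#-nonzero P? h = ≤-trans (≤-reflexive (cong (_+ # (P? ∘ suc)) (⟦⟧-false (P? zero) (λ p → h zero p refl)))) (#≤n (P? ∘ suc))

TwoColored : ∀ {r} → Subset n → Fin r → Fin r → Vec (Fin (suc r)) n → Set
TwoColored A a b f = ∀ i → i ∈ A → lookup f i ≡ suc a ⊎ lookup f i ≡ suc b

sum-toℕ : ∀ r → sum {r} toℕ ≡ r C 2
sum-toℕ zero    = refl
sum-toℕ (suc r) = begin
  sum {r} (λ i → 1 + toℕ i)        ≡⟨ ∑-distrib-+ {r} (λ _ → 1) toℕ ⟩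
  sum {r} (λ _ → 1) + sum {r} toℕ  ≡⟨ cong₂ _+_ (trans (sum-const r 1) (*-identityʳ r)) (sum-toℕ r) ⟩
  r + r C 2                        ≡⟨ cong (_+ r C 2) (nC1≡n r) ⟨
  r C 1 + r C 2                    ≡⟨ nCk+nC[k+1]≡[n+1]C[k+1] r 1 ⟩
  suc r C 2 ∎
  where
  open ≡-Reasoning

#-below : ∀ {r} (b : Fin r) → # {r} (λ a → a Fin.<? b) ≤ toℕ b
#-below {suc r} zero    = ≤-reflexive (#-none {suc r} (λ a → a Fin.<? zero {r}) λ _ ())
#-below {suc r} (suc b) = s≤s (≤-trans
  (#-mono {r} (λ a → suc a Fin.<? suc b) (Fin._<? b) λ _ → s≤s⁻¹) (#-below b))

-- The main term, by a union bound over the pairs a < b. A pair is written as a vector of length 2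
-- because `Bounded-∃` sums over vectors.
two-colored-bound : ∀ r (A : Subset n) →
  Bounded (List.allFin (suc r)) (λ f → Good {r} A f × ∃ λ a → ∃ λ b → a Fin.< b × TwoColored A a b f) ((r C 2) * 2 ^ ∣ A ∣)
two-colored-bound {n} r A = Bounded-mono
  (λ { f (good , a , b , a<b , two) → a ∷ b ∷ [] , a<b , good , two }) ≤-refl
  (Bounded-∃ ∈-allFin {m = 2} K? {λ { (a ∷ b ∷ []) f → Good A f × TwoColored A a b f }} (λ { (a ∷ b ∷ []) _ → pair a b }) (begin
    sumL (List.allFin r) (λ b → sumL (List.allFin r) λ a → ⟦ a Fin.<? b ⟧)
      ≡⟨ sumL-tabulate {n = r} id _ ⟩
    sum {r} (λ b → sumL (List.allFin r) λ a → ⟦ a Fin.<? b ⟧)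
      ≤⟨ sum-mono {r} (λ b → ≤-trans (≤-reflexive (sumL-tabulate {n = r} id (λ a → ⟦ a Fin.<? b ⟧))) (#-below b)) ⟩
    sum {r} toℕ ≡⟨ sum-toℕ r ⟩
    r C 2 ∎))
  where
  open ≤-Reasoning
  K? : ∀ (p : Vec (Fin r) 2) → Dec (lookup p zero Fin.< lookup p (suc zero))
  K? (a ∷ b ∷ []) = a Fin.<? b
  pair : ∀ a b → Bounded (List.allFin (suc r)) (λ f → Good A f × TwoColored A a b f) (2 ^ ∣ A ∣)
  pair a b = Bounded-mono
    (λ f (good , two) → (λ v → allowed f good two v (v ∈? A)) , z≤n) ≤-refl
    (Scheme.scheme {Allowed = Allowed} Allowed? {λ _ _ → ⊥} (λ _ _ → no λ ()) (λ _ _ _ _ _ → id) (λ _ _ _ _ → id)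
      (λ v → ⟦ v ∈? A ⟧) (λ _ → 0) (λ v f → branch v {f} (v ∈? A)) 0 (2 ^ ∣ A ∣)
      (≤-reflexive (cong₂ (λ x y → 2 ^ x * r ^ y) (sym (∣A∣≡# A)) (trans (sum-const n 0) (*-zeroʳ n)))))
    where
    Allowed : Fin n → Vec (Fin (suc r)) n → Fin (suc r) → Set
    Allowed v _ c = (v ∈ A × (c ≡ suc a ⊎ c ≡ suc b)) ⊎ (v ∉ A × c ≡ zero)
    Allowed? : ∀ v f c → Dec (Allowed v f c)
    Allowed? v f c = ((v ∈? A) ×-dec ((c Fin.≟ suc a) ⊎-dec (c Fin.≟ suc b))) ⊎-dec (¬? (v ∈? A) ×-dec (c Fin.≟ zero))
    allowed : ∀ f → Good A f → TwoColored A a b f → ∀ v → Dec (v ∈ A) → Allowed v f (lookup f v)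
    allowed f good two v (yes v∈A) = inj₁ (v∈A , two v v∈A)
    allowed f good two v (no v∉A)  = inj₂ (v∉A , Good.absent good v v∉A)
    branch : ∀ v {f} (d : Dec (v ∈ A)) → # (Allowed? v f) * 1 ≤ 2 ^ ⟦ d ⟧ * 1
    branch v {f} (yes v∈A) = *-monoˡ-≤ 1 (#-two (Allowed? v f) (suc a) (suc b)
      λ { c (inj₁ (_ , e)) → e ; c (inj₂ (v∉A , _)) → ⊥-elim (v∉A v∈A) })
    branch v {f} (no v∉A) = *-monoˡ-≤ 1 (#-one (Allowed? v f) zero
      λ { c (inj₁ (v∈A , _)) → ⊥-elim (v∉A v∈A) ; c (inj₂ (_ , e)) → e })

-- Types determined by a sample

Col : ℕ → Set
Col r = Fin (suc r)

-- In a partial coloring the Boolean flags the poor elements used as centers of links.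
Mark : ℕ → Set
Mark r = Bool × Col r

Partial : ℕ → ℕ → Set
Partial r n = Vec (Maybe (Mark r)) n

colorOf : Maybe (Mark r) → Col r
colorOf nothing        = zero
colorOf (just (_ , c)) = c

-- `zero` can mean "not recorded" without ambiguity on A, since as a color it means absence from A.
known : Partial r n → Fin n → Col r
known p i = colorOf (lookup p i)

Agree : Partial r n → Vec (Col r) n → Set
Agree p f = ∀ i → known p i ≢ zero → known p i ≡ lookup f i

known-restrict : ∀ {P : Fin n → Set} (P? : ∀ i → Dec (P i)) (flag : Fin n → Bool) (f : Vec (Col r) n) →
                 ∀ i → P i → known (restrict P? λ i → flag i , lookup f i) i ≡ lookup f i
known-restrict P? flag f i p = cong colorOf (restrict-just P? _ i p)

agree-restrict : ∀ {P : Fin n → Set} (P? : ∀ i → Dec (P i)) (flag : Fin n → Bool) (f : Vec (Col r) n) →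
                 Agree (restrict P? λ i → flag i , lookup f i) f
agree-restrict P? flag f i ne with lookup (restrict P? λ i → flag i , lookup f i) i in e
... | nothing = ⊥-elim (ne refl)
... | just x  = cong proj₂ (proj₂ (restrict-marked P? _ i e))

unknown-restrict : ∀ {P : Fin n → Set} (P? : ∀ i → Dec (P i)) (flag : Fin n → Bool) (f : Vec (Col r) n) i →
                   lookup f i ≢ zero → known (restrict P? λ i → flag i , lookup f i) i ≡ zero → ¬ P i
unknown-restrict P? flag f i ne e p = ne (trans (sym (known-restrict P? flag f i p)) e)

-- A witness leaves only the two known colors for z; ordering them makes the type canonical.
Witness : Partial r n → Fin n → Fin n → Fin n → Set
Witness p z s x = AP3 z s x × known p s ≢ zero × known p s Fin.< known p x

Typed : Partial r n → Fin n → Set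
Typed p z = ∃ λ s → ∃ λ x → Witness p z s x

abstract
  Typed? : ∀ (p : Partial r n) z → Dec (Typed p z)
  Typed? p z = Fin.any? λ s → Fin.any? λ x → AP3? z s x ×-dec ¬? (known p s Fin.≟ zero) ×-dec (known p s Fin.<? known p x)

typeFrom : ∀ (p : Partial r n) {z} → Dec (Typed p z) → Maybe (Col r × Col r)
typeFrom p (yes (s , x , _)) = just (known p s , known p x)
typeFrom p (no _)            = nothing

type : Partial r n → Fin n → Maybe (Col r × Col r)
type p z = typeFrom p (Typed? p z)

type-witness : ∀ (p : Partial r n) z {a b} → type p z ≡ just (a , b) →
               ∃ λ s → ∃ λ x → AP3 z s x × known p s ≡ a × known p x ≡ b × a ≢ zero × a Fin.< b
type-witness p z e with Typed? p z
type-witness p z refl | yes (s , x , ap , ne , lt) = s , x , ap , refl , refl , ne , lt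

type-typed : ∀ (p : Partial r n) z → Typed p z → ∃ λ a → ∃ λ b → type p z ≡ just (a , b)
type-typed p z t with Typed? p z
... | yes (s , x , _) = _ , _ , refl
... | no ¬t = ⊥-elim (¬t t)

Untyped? : ∀ (p : Partial r n) (A : Subset n) z → Dec (z ∈ A × ¬ Typed p z)
Untyped? p A z = (z ∈? A) ×-dec ¬? (Typed? p z)

Good-∈ : ∀ {A : Subset n} {f : Vec (Col r) n} → Good A f → ∀ {i} → lookup f i ≢ zero → i ∈ A
Good-∈ {A = A} good {i} ne with i ∈? A
... | yes i∈A = i∈A
... | no i∉A  = ⊥-elim (ne (Good.absent good i i∉A))

agree-∈ : ∀ {A : Subset n} {f : Vec (Col r) n} {p} → Good A f → Agree p f → ∀ {i} → known p i ≢ zero → i ∈ A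
agree-∈ good ag {i} ne = Good-∈ good λ e → ne (trans (ag i ne) e)

third-color : ∀ {A : Subset n} {f : Vec (Col r) n} → Good A f → ∀ {z s x} → AP3 z s x → z ∈ A → s ∈ A → x ∈ A →
              lookup f s ≢ lookup f x → lookup f z ≡ lookup f s ⊎ lookup f z ≡ lookup f x
third-color {f = f} good {z} {s} {x} ap z∈ s∈ x∈ ne with lookup f z Fin.≟ lookup f s | lookup f z Fin.≟ lookup f x
... | yes e | _     = inj₁ e
... | no _  | yes e = inj₂ e
... | no ¬s | no ¬x = ⊥-elim (Good.free good ap z∈ s∈ x∈ (¬s , ¬x , ne))

<ᶠ⇒≢ : ∀ {a b : Fin n} → a Fin.< b → a ≢ b
<ᶠ⇒≢ lt refl = <-irrefl refl lt

typed-color : ∀ {A : Subset n} {f : Vec (Col r) n} {p} → Good A f → Agree p f → ∀ {z a b} → z ∈ A →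
              type p z ≡ just (a , b) → lookup f z ≡ a ⊎ lookup f z ≡ b
typed-color {f = f} {p} good ag {z} z∈ e with type-witness p z e
... | s , x , ap , refl , refl , ne , lt =
  Sum.map (λ h → trans h (sym s≡)) (λ h → trans h (sym x≡))
    (third-color good ap z∈ (agree-∈ {p = p} good ag ne) (agree-∈ {p = p} good ag ne′) λ h → <ᶠ⇒≢ lt (trans s≡ (trans h (sym x≡))))
  where
  ne′ : known p x ≢ zero
  ne′ e = <⇒≢ (≤-<-trans z≤n lt) (sym (cong toℕ e))
  s≡ = ag s ne
  x≡ = ag x ne′

InType : Maybe (Col r × Col r) → Col r → Set
InType nothing        c = ⊤
InType (just (a , b)) c = c ≡ a ⊎ c ≡ b

InType? : ∀ (m : Maybe (Col r × Col r)) c → Dec (InType m c)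
InType? nothing        c = yes tt
InType? (just (a , b)) c = (c Fin.≟ a) ⊎-dec (c Fin.≟ b)

typed-color′ : ∀ {A : Subset n} {f : Vec (Col r) n} {p} → Good A f → Agree p f → ∀ {z} → z ∈ A →
               InType (type p z) (lookup f z)
typed-color′ {p = p} good ag {z} z∈ with type p z in e
... | nothing      = tt
... | just (a , b) = typed-color good ag z∈ e

colors : ∀ r → List (Col r)
colors r = List.allFin (suc r)

-- Each v with Cond v f saves a factor 2, because Excl v f excludes one of the two colors of its type.
module TypedScheme {r n} (1≤r : 1 ≤ r) (A : Subset n) (p q : Partial r n)
  {Cond : Fin n → Vec (Col r) n → Set} (Cond? : ∀ v f → Dec (Cond v f))
  {Excl : Fin n → Vec (Col r) n → Col r → Set} (Excl? : ∀ v f c → Dec (Excl v f c))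
  (cond-local : ∀ v f g → AgreeAbove v f g → Cond v f → Cond v g)
  (excl-local : ∀ v f g → AgreeAbove v f g → ∀ c → Excl v f c → Excl v g c)
  (forcing : ∀ v f → Cond v f → v ∈ A × ∃ λ a → ∃ λ b → type p v ≡ just (a , b) ×
               (known q v ≡ zero → Excl v f a ⊎ Excl v f b)) where

  Respects : Vec (Col r) n → Set
  Respects f = ∀ v → known q v ≡ zero → Cond v f → ¬ Excl v f (lookup f v)

  private
    Inside : Fin n → Vec (Col r) n → Col r → Set
    Inside v f c = c ≢ zero × InType (type p v) c × (known q v ≢ zero → c ≡ known q v) ×
                   (known q v ≡ zero → Cond v f → ¬ Excl v f c)

    Allowed : Fin n → Vec (Col r) n → Col r → Set
    Allowed v f c = (v ∈ A × Inside v f c) ⊎ (v ∉ A × c ≡ zero)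

    Inside? : ∀ v f c → Dec (Inside v f c)
    Inside? v f c = ¬? (c Fin.≟ zero) ×-dec InType? (type p v) c ×-dec
      (¬? (known q v Fin.≟ zero) →-dec (c Fin.≟ known q v)) ×-dec
      ((known q v Fin.≟ zero) →-dec (Cond? v f →-dec ¬? (Excl? v f c)))

    Allowed? : ∀ v f c → Dec (Allowed v f c)
    Allowed? v f c = ((v ∈? A) ×-dec Inside? v f c) ⊎-dec (¬? (v ∈? A) ×-dec (c Fin.≟ zero))

    agree-sym : ∀ {v} {f g : Vec (Col r) n} → AgreeAbove v f g → AgreeAbove v g f
    agree-sym h w v<w = sym (h w v<w)

    local : ∀ v f g → AgreeAbove v f g → ∀ c → Allowed v f c → Allowed v g c
    local v f g h c (inj₂ o) = inj₂ o
    local v f g h c (inj₁ (v∈A , nz , ty , kn , ex)) = inj₁ (v∈A , nz , ty , kn ,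
      λ k cond e → ex k (cond-local v g f (agree-sym {v} {f} {g} h) cond) (excl-local v g f (agree-sym {v} {f} {g} h) c e))

    in-A : ∀ v {f} → v ∈ A → ∀ c → Allowed v f c → Inside v f c
    in-A v v∈A c (inj₁ (_ , h)) = h
    in-A v v∈A c (inj₂ (v∉A , _)) = ⊥-elim (v∉A v∈A)

    forced-one : ∀ v f → v ∈ A → Cond v f → ∀ a b → type p v ≡ just (a , b) →
                 (known q v ≡ zero → Excl v f a ⊎ Excl v f b) → # (Allowed? v f) ≤ 1
    forced-one v f v∈A cond a b ty ex = by (known q v Fin.≟ zero)
      where
      which : ∀ {c} → Inside v f c → c ≡ a ⊎ c ≡ b
      which {c} (_ , h , _) = subst (λ m → InType m c) ty h
      by : Dec (known q v ≡ zero) → # (Allowed? v f) ≤ 1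
      same : known q v ≡ zero → ∀ {c c′} → Excl v f a ⊎ Excl v f b → Inside v f c → Inside v f c′ → c ≡ c′
      same kn e i@(_ , _ , _ , h) i′@(_ , _ , _ , h′) with which i | which i′
      ... | inj₁ refl | inj₁ refl = refl
      ... | inj₂ refl | inj₂ refl = refl
      same kn (inj₁ e) i@(_ , _ , _ , h) i′@(_ , _ , _ , h′) | inj₁ refl | inj₂ refl = ⊥-elim (h kn cond e)
      same kn (inj₂ e) i@(_ , _ , _ , h) i′@(_ , _ , _ , h′) | inj₁ refl | inj₂ refl = ⊥-elim (h′ kn cond e)
      same kn (inj₁ e) i@(_ , _ , _ , h) i′@(_ , _ , _ , h′) | inj₂ refl | inj₁ refl = ⊥-elim (h′ kn cond e)
      same kn (inj₂ e) i@(_ , _ , _ , h) i′@(_ , _ , _ , h′) | inj₂ refl | inj₁ refl = ⊥-elim (h kn cond e)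
      -- A recorded element has only its recorded color left, so it counts as forced even though
      -- nothing is excluded there.
      by (no kn)  = #-one (Allowed? v f) (known q v) λ c al → proj₁ (proj₂ (proj₂ (in-A v v∈A c al))) kn
      by (yes kn) = #-unique (Allowed? v f) λ c c′ al al′ → same kn (ex kn) (in-A v v∈A c al) (in-A v v∈A c′ al′)

    branch : ∀ v f → # (Allowed? v f) * 2 ^ ⟦ Cond? v f ⟧ ≤ 2 ^ ⟦ v ∈? A ⟧ * r ^ ⟦ Untyped? p A v ⟧
    branch v f = at (v ∈? A) (Typed? p v) (Cond? v f)
      where
      at : (d : Dec (v ∈ A)) (t : Dec (Typed p v)) (c : Dec (Cond v f)) →
           # (Allowed? v f) * 2 ^ ⟦ c ⟧ ≤ 2 ^ ⟦ d ⟧ * r ^ ⟦ d ×-dec ¬? t ⟧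
      at (no v∉A) t (yes cond) = ⊥-elim (v∉A (proj₁ (forcing v f cond)))
      at (no v∉A) t (no _) = *-monoˡ-≤ 1 (#-one (Allowed? v f) zero
        λ { c (inj₁ (v∈A , _)) → ⊥-elim (v∉A v∈A) ; c (inj₂ (_ , e)) → e })
      at (yes v∈A) t (yes cond) with forcing v f cond
      ... | _ , a , b , ty , ex = ≤-trans (*-monoˡ-≤ 2 (forced-one v f v∈A cond a b ty ex)) (≤-trans (*-monoʳ-≤ 2
              (m^n>0 r {{>-nonZero 1≤r}} ⟦ (yes v∈A) ×-dec ¬? t ⟧)) ≤-refl)
      at (yes v∈A) (yes t) (no _) with type-typed p v t
      ... | a , b , ty = *-monoˡ-≤ 1 (#-two (Allowed? v f) a b
        λ c al → subst (λ m → InType m c) ty (proj₁ (proj₂ (in-A v v∈A c al))))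
      -- An untyped element is charged 2 r instead of r, so that the total is simply 2 ^ |A| times r
      -- to the number of untyped elements.
      at (yes v∈A) (no _) (no _) = ≤-trans (≤-reflexive (*-identityʳ _)) (≤-trans
        (#-nonzero (Allowed? v f) λ c al → proj₁ (in-A v v∈A c al))
        (≤-trans (m≤n*m r 2) (≤-reflexive (cong (2 *_) (sym (*-identityʳ r))))))

  typed-scheme : ∀ F M → 2 ^ ∣ A ∣ * r ^ # (Untyped? p A) ≤ M * 2 ^ F →
    Bounded (colors r) (λ f → Good {r} A f × Agree p f × Agree q f × Respects f × F ≤ # (λ v → Cond? v f)) M
  typed-scheme F M budget = Bounded-mono
    (λ f (good , ag , ag′ , resp , le) → (λ v → allowed f good ag ag′ resp v (v ∈? A)) , le) ≤-refl
    (Scheme.scheme Allowed? Cond? local cond-local (λ v → ⟦ v ∈? A ⟧) (λ v → ⟦ Untyped? p A v ⟧) branch F M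
      (≤-trans (≤-reflexive (cong (λ x → 2 ^ x * r ^ # (Untyped? p A)) (sym (∣A∣≡# A)))) budget))
    where
    allowed : ∀ f → Good A f → Agree p f → Agree q f → Respects f → ∀ v → Dec (v ∈ A) → Allowed v f (lookup f v)
    allowed f good ag ag′ resp v (no v∉A) = inj₂ (v∉A , Good.absent good v v∉A)
    allowed f good ag ag′ resp v (yes v∈A) = inj₁ (v∈A , Good.present good v v∈A , typed-color′ good ag v∈A ,
      (λ kn → sym (ag′ v kn)) , resp v)

-- Rich and poor elements, and the sample that types the rich ones

Split : Subset n → Vec (Col r) n → Fin n → Fin n → Fin n → Set
Split A f z s x = AP3 z s x × (z ∈ A × s ∈ A × x ∈ A) × lookup f s ≢ lookup f x

Split? : ∀ (A : Subset n) (f : Vec (Col r) n) z s x → Dec (Split A f z s x)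
Split? A f z s x = AP3? z s x ×-dec ((z ∈? A) ×-dec (s ∈? A) ×-dec (x ∈? A)) ×-dec ¬? (lookup f s Fin.≟ lookup f x)

Split-few : ∀ (A : Subset n) (f : Vec (Col r) n) z x → # (λ s → Split? A f z s x) ≤ 3
Split-few A f z x = ≤-trans (#-mono (λ s → Split? A f z s x) (λ s → AP3? z s x) λ _ → proj₁) (AP3-few z x)

splits : Subset n → Vec (Col r) n → Fin n → ℕ
splits A f z = Hitting.deg (Split? A f) (Split-few A f) z

Rich? : ∀ t (A : Subset n) (f : Vec (Col r) n) z → Dec (z ∈ A × n ≤ t * splits A f z)
Rich? t A f z = (z ∈? A) ×-dec (_ ≤? t * splits A f z)

Poor? : ∀ t (A : Subset n) (f : Vec (Col r) n) z → Dec (z ∈ A × ¬ (n ≤ t * splits A f z))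
Poor? t A f z = (z ∈? A) ×-dec ¬? (_ ≤? t * splits A f z)

RichUntyped? : ∀ t (A : Subset n) (f : Vec (Col r) n) (p : Partial r n) z →
               Dec ((z ∈ A × n ≤ t * splits A f z) × ¬ Typed p z)
RichUntyped? t A f p z = Rich? t A f z ×-dec ¬? (Typed? p z)

_∈L_ : Fin n → List (Fin n) → Set
i ∈L xs = Any (i ≡_) xs

_∈L?_ : ∀ (i : Fin n) xs → Dec (i ∈L xs)
i ∈L? xs = Any.any? (i Fin.≟_) xs

Any⇒∃∈ : ∀ {P : Fin n → Set} {xs} → Any P xs → ∃ λ x → x ∈L xs × P x
Any⇒∃∈ (here p)  = _ , here refl , p
Any⇒∃∈ (there a) = let (x , m , p) = Any⇒∃∈ a in x , there m , p

∃∈⇒Any : ∀ {P : Fin n → Set} {xs x} → x ∈L xs → P x → Any P xs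
∃∈⇒Any {P = P} m p = Any.map (λ e → subst P e p) m

module Sampling (t ε gap : ℕ) (1≤t : 1 ≤ t) (1≤ε : 1 ≤ ε) (1≤gap : 1 ≤ gap) where

  open HittingSet t ε (2 * gap) 1≤t 1≤ε (1≤* {2} (s≤s z≤n) 1≤gap) renaming (n₀ to n₁)

  n₀ : ℕ
  n₀ = n₁ + 2 * (gap * size₀)

  -- All colors on S and R are recorded, so a hit pair of differently colored s in S and x in R is a
  -- witness for the type of z. S has bounded size and R at most n / (2 gap), hence the factor 2 in
  -- the parameter of the hitting set.
  sample : n₀ ≤ n → (A : Subset n) {f : Vec (Col r) n} → Good A f →
           ∃ λ (p : Partial r n) → # (Marked? p) * gap ≤ n × Agree p f × # (RichUntyped? t A f p) * ε ≤ n
  sample {n} {r} n₀≤n A {f} good =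
    let (S , R , lenS , lenR , un) = hitting-set (≤-trans (m≤m+n n₁ _) n₀≤n) (Split? A f) (Split-few A f)
    in build S R lenS lenR un
    where
    open Hitting (Split? A f) (Split-few A f)
    build : ∀ S R → length S ≤ size₀ → length R * (2 * gap) ≤ n →
            # (λ z → (n ≤? t * deg z) ×-dec ¬? (Hit? S R z)) * ε ≤ n →
            ∃ λ (p : Partial r n) → # (Marked? p) * gap ≤ n × Agree p f × # (RichUntyped? t A f p) * ε ≤ n
    build S R lenS lenR un = p , size , agree-restrict In? (λ _ → false) f ,
      ≤-trans (*-monoˡ-≤ ε (#-mono (RichUntyped? t A f p) (λ z → (n ≤? t * deg z) ×-dec ¬? (Hit? S R z))
        λ { z ((_ , rich) , ¬t) → rich , λ hit → ¬t (hit⇒typed hit) })) un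
      where
      In? : ∀ i → Dec (i ∈L (S ++ R) × i ∈ A)
      In? i = (i ∈L? (S ++ R)) ×-dec (i ∈? A)
      p : Partial r n
      p = restrict In? λ i → false , lookup f i
      size : # (Marked? p) * gap ≤ n
      size = *-cancelˡ-≤ 2 (begin
        2 * (# (Marked? p) * gap)             ≤⟨ *-monoʳ-≤ 2 (*-monoˡ-≤ gap (≤-trans (restrict-size In? _)
                                                   (≤-trans (#-list In? (S ++ R) λ _ → proj₁) (≤-reflexive (length-++ S))))) ⟩
        2 * ((length S + length R) * gap)     ≡⟨ lemma (length S) (length R) gap ⟩
        2 * (gap * length S) + length R * (2 * gap) ≤⟨ +-mono-≤ (≤-trans (*-monoʳ-≤ 2 (*-monoʳ-≤ gap lenS)) (≤-trans (m≤n+m _ n₁) n₀≤n)) lenR ⟩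
        n + n                                 ≡⟨ cong (n +_) (+-identityʳ n) ⟨
        2 * n ∎)
        where
        open ≤-Reasoning
        lemma : ∀ s r g → 2 * ((s + r) * g) ≡ 2 * (g * s) + r * (2 * g)
        lemma = solve-∀
      hit⇒typed : ∀ {z} → Hit S R z → Typed p z
      hit⇒typed {z} hit =
        let (x , x∈R , seen) = Any⇒∃∈ hit
            (s , s∈S , ap , (z∈ , s∈ , x∈) , ne) = Any⇒∃∈ seen
        in typed ap ne (known-restrict In? (λ _ → false) f s (Any.++⁺ˡ s∈S , s∈))
                       (known-restrict In? (λ _ → false) f x (Any.++⁺ʳ S x∈R , x∈))
                       (Good.present good s s∈) (Good.present good x x∈)
        where
        typed : ∀ {z s x} → AP3 z s x → lookup f s ≢ lookup f x → known p s ≡ lookup f s → known p x ≡ lookup f x →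
                lookup f s ≢ zero → lookup f x ≢ zero → Typed p z
        typed {z} {s} {x} ap ne es ex s≢0 x≢0 with Fin.<-cmp (known p s) (known p x)
        ... | tri< lt _ _ = s , x , ap , (λ e → s≢0 (trans (sym es) e)) , lt
        ... | tri≈ _ e _  = ⊥-elim (ne (trans (sym es) (trans e ex)))
        ... | tri> _ _ gt = x , s , AP3-swap₂₃ ap , (λ e → x≢0 (trans (sym ex) e)) , gt

typed-bound : 1 ≤ r → ∀ (A : Subset n) (p : Partial r n) →
              Bounded (colors r) (λ f → Good {r} A f × Agree p f) (2 ^ ∣ A ∣ * r ^ # (Untyped? p A))
typed-bound {r} {n} 1≤r A p = Bounded-mono (λ f (good , ag) → good , ag , ag , (λ _ _ ()) , z≤n) ≤-refl
  (TypedScheme.typed-scheme 1≤r A p p {λ _ _ → ⊥} (λ _ _ → no λ ()) {λ _ _ _ → ⊥} (λ _ _ _ → no λ ())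
    (λ _ _ _ _ → id) (λ _ _ _ _ _ → id) (λ _ _ ()) 0 _ (≤-reflexive (sym (*-identityʳ _))))

-- Colorings with many poor elements

Flagged : Partial r n → Fin n → Set
Flagged q u = ∃ λ c → lookup q u ≡ just (true , c)

Flagged? : ∀ (q : Partial r n) u → Dec (Flagged q u)
Flagged? q u with lookup q u
... | nothing          = no λ ()
... | just (true , c)  = yes (c , refl)
... | just (false , _) = no λ ()

Link : Partial r n → Fin n → Fin n → Fin n → Set
Link q v u w = Flagged q u × known q w ≢ zero × AP3 v u w

abstract
  Link? : ∀ (q : Partial r n) v u w → Dec (Link q v u w)
  Link? q v u w = Flagged? q u ×-dec ¬? (known q w Fin.≟ zero) ×-dec AP3? v u w

-- At a poor center u the two other terms of a progression have equal colors with few exceptions.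
-- The exceptions are recorded in q, so copying is demanded of unrecorded v only.
record Follows (A : Subset n) (q : Partial r n) (f : Vec (Col r) n) : Set where
  field
    agree : Agree q f
    copy  : ∀ {v u w} → v ∈ A → known q v ≡ zero → Link q v u w → lookup f v ≡ lookup f w

Linked : Partial r n → Fin n → Set
Linked q v = ∃ λ u → ∃ (Link q v u)

abstract
  Linked? : ∀ (q : Partial r n) v → Dec (Linked q v)
  Linked? q v = Fin.any? λ u → Fin.any? (Link? q v u)

Unknown? : ∀ (A : Subset n) (q : Partial r n) v → Dec (v ∈ A × known q v ≡ zero × ¬ Linked q v)
Unknown? A q v = (v ∈? A) ×-dec (known q v Fin.≟ zero) ×-dec ¬? (Linked? q v)

-- Recorded and linked elements are determined by q alone. Only the unknown ones have a choice,
-- among two colors if typed and r otherwise.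
module LinkScheme {r n} (A : Subset n) (p q : Partial r n) where

  UnknownTyped? : ∀ v → Dec ((v ∈ A × known q v ≡ zero × ¬ Linked q v) × Typed p v)
  UnknownTyped? v = Unknown? A q v ×-dec Typed? p v

  UnknownUntyped? : ∀ v → Dec ((v ∈ A × known q v ≡ zero × ¬ Linked q v) × ¬ Typed p v)
  UnknownUntyped? v = Unknown? A q v ×-dec ¬? (Typed? p v)

  private
    Inside : Fin n → Col r → Set
    Inside v c = c ≢ zero × InType (type p v) c × (known q v ≢ zero → c ≡ known q v) ×
                 (known q v ≡ zero → ∀ u w → Link q v u w → c ≡ known q w)

    Allowed : Fin n → Vec (Col r) n → Col r → Set
    Allowed v f c = (v ∈ A × Inside v c) ⊎ (v ∉ A × c ≡ zero)

    Inside? : ∀ v c → Dec (Inside v c)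
    Inside? v c = ¬? (c Fin.≟ zero) ×-dec InType? (type p v) c ×-dec
      (¬? (known q v Fin.≟ zero) →-dec (c Fin.≟ known q v)) ×-dec
      ((known q v Fin.≟ zero) →-dec Fin.all? λ u → Fin.all? λ w → Link? q v u w →-dec (c Fin.≟ known q w))

    Allowed? : ∀ v f c → Dec (Allowed v f c)
    Allowed? v f c = ((v ∈? A) ×-dec Inside? v c) ⊎-dec (¬? (v ∈? A) ×-dec (c Fin.≟ zero))

    in-A : ∀ v {f} → v ∈ A → ∀ c → Allowed v f c → Inside v c
    in-A v v∈A c (inj₁ (_ , h)) = h
    in-A v v∈A c (inj₂ (v∉A , _)) = ⊥-elim (v∉A v∈A)

    branch : ∀ v f → # (Allowed? v f) * 1 ≤ 2 ^ ⟦ UnknownTyped? v ⟧ * r ^ ⟦ UnknownUntyped? v ⟧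
    branch v f = ≤-trans (≤-reflexive (*-identityʳ _)) (at (v ∈? A) (known q v Fin.≟ zero) (Linked? q v) (Typed? p v))
      where
      at : (d : Dec (v ∈ A)) (k : Dec (known q v ≡ zero)) (l : Dec (Linked q v)) (t : Dec (Typed p v)) →
           # (Allowed? v f) ≤ 2 ^ ⟦ (d ×-dec k ×-dec ¬? l) ×-dec t ⟧ * r ^ ⟦ (d ×-dec k ×-dec ¬? l) ×-dec ¬? t ⟧
      at (no v∉A) k l t = #-one (Allowed? v f) zero
        λ { c (inj₁ (v∈A , _)) → ⊥-elim (v∉A v∈A) ; c (inj₂ (_ , e)) → e }
      at (yes v∈A) (no kn) l t = #-one (Allowed? v f) (known q v) λ c al → proj₁ (proj₂ (proj₂ (in-A v {f} v∈A c al))) kn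
      at (yes v∈A) (yes un) (yes (u , w , li)) t =
        #-one (Allowed? v f) (known q w) λ c al → proj₂ (proj₂ (proj₂ (in-A v {f} v∈A c al))) un u w li
      at (yes v∈A) (yes un) (no _) (yes t) with type-typed p v t
      ... | a , b , ty = #-two (Allowed? v f) a b
        λ c al → subst (λ m → InType m c) ty (proj₁ (proj₂ (in-A v {f} v∈A c al)))
      at (yes v∈A) (yes un) (no _) (no _) = ≤-trans
        (#-nonzero (Allowed? v f) λ c al → proj₁ (in-A v {f} v∈A c al))
        (≤-reflexive (sym (trans (*-identityˡ _) (*-identityʳ r))))

  link-scheme : ∀ M → 2 ^ # UnknownTyped? * r ^ # UnknownUntyped? ≤ M →
    Bounded (colors r) (λ f → Good {r} A f × Agree p f × Follows A q f) M
  link-scheme M budget = Bounded-mono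
    (λ f (good , ag , fo) → (λ v → allowed f good ag fo v (v ∈? A)) , z≤n) ≤-refl
    (Scheme.scheme Allowed? {λ _ _ → ⊥} (λ _ _ → no λ ()) (λ _ _ _ _ _ → id) (λ _ _ _ _ → id)
      (λ v → ⟦ UnknownTyped? v ⟧) (λ v → ⟦ UnknownUntyped? v ⟧) branch 0 M
      (≤-trans budget (≤-reflexive (sym (*-identityʳ M)))))
    where
    allowed : ∀ f → Good A f → Agree p f → Follows A q f → ∀ v → Dec (v ∈ A) → Allowed v f (lookup f v)
    allowed f good ag fo v (no v∉A) = inj₂ (v∉A , Good.absent good v v∉A)
    allowed f good ag fo v (yes v∈A) = inj₁ (v∈A , Good.present good v v∈A , typed-color′ good ag v∈A ,
      (λ kn → sym (Follows.agree fo v kn)) ,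
      λ un u w li → trans (Follows.copy fo v∈A un li) (sym (Follows.agree fo w (proj₁ (proj₂ li)))))

#-Any : ∀ {W : Fin n → Fin n → Set} (W? : ∀ u s → Dec (W u s)) t N → (∀ s → t * # (λ u → W? u s) ≤ N) →
        ∀ S → t * # (λ u → Any.any? (W? u) S) ≤ length S * N
#-Any {n} W? t N h []      = ≤-reflexive (trans (cong (t *_) (#-none {n} (λ u → Any.any? (W? u) []) λ _ ())) (*-zeroʳ t))
#-Any {n} {W} W? t N h (s ∷ S) = ≤-trans
  (*-monoʳ-≤ t (#-⊎ (λ u → Any.any? (W? u) (s ∷ S)) (λ u → W? u s) (λ u → Any.any? (W? u) S) split))
  (≤-trans (≤-reflexive (*-distribˡ-+ t _ _)) (+-mono-≤ (h s) (#-Any W? t N h S)))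
  where
  split : ∀ u → Any (W u) (s ∷ S) → W u s ⊎ Any (W u) S
  split u (here w)  = inj₁ w
  split u (there a) = inj₂ a

PoorLink : ℕ → Subset n → Vec (Col r) n → Fin n → Fin n → Fin n → Set
PoorLink {n} t A f u s x = AP3 u s x × (s ∈ A × ¬ (n ≤ t * splits A f s)) × x ∈ A

PoorLink? : ∀ t (A : Subset n) (f : Vec (Col r) n) u s x → Dec (PoorLink t A f u s x)
PoorLink? t A f u s x = AP3? u s x ×-dec Poor? t A f s ×-dec (x ∈? A)

PoorLink-few : ∀ t (A : Subset n) (f : Vec (Col r) n) u x → # (λ s → PoorLink? t A f u s x) ≤ 3
PoorLink-few t A f u x = ≤-trans (#-mono (λ s → PoorLink? t A f u s x) (λ s → AP3? u s x) λ _ → proj₁) (AP3-few u x)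

poor-links : ℕ → Subset n → Vec (Col r) n → Fin n → ℕ
poor-links t A f = Hitting.deg (PoorLink? t A f) (PoorLink-few t A f)

UnknownActive? : ∀ t t′ (A : Subset n) (f : Vec (Col r) n) (q : Partial r n) v →
  Dec ((v ∈ A × known q v ≡ zero × ¬ Linked q v) × n ≤ t′ * poor-links t A f v)
UnknownActive? t t′ A f q v = Unknown? A q v ×-dec (_ ≤? t′ * poor-links t A f v)

module PoorSampling (t′ ε gap : ℕ) (1≤t′ : 1 ≤ t′) (1≤ε : 1 ≤ ε) (1≤gap : 1 ≤ gap) where

  open HittingSet t′ ε (4 * gap) 1≤t′ 1≤ε (1≤* {4} (s≤s z≤n) 1≤gap) renaming (n₀ to n₁)

  -- The threshold t for poor is fixed after `size₀`: each of the at most `size₀` centers has at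
  -- most n / t exceptions, which makes n / (4 gap) in total.
  t n₀ : ℕ
  t  = 4 * (gap * size₀)
  n₀ = n₁ + 4 * (gap * size₀)

  1≤size₀ : 1 ≤ size₀
  1≤size₀ = 1≤* 1≤Δ₀ (s≤s z≤n)

  1≤t : 1 ≤ t
  1≤t = 1≤* {4} (s≤s z≤n) (1≤* 1≤gap 1≤size₀)

  poor-sample : n₀ ≤ n → (A : Subset n) {f : Vec (Col r) n} → Good A f →
    ∃ λ (q : Partial r n) → # (Marked? q) * gap ≤ n × Follows A q f × # (UnknownActive? t t′ A f q) * ε ≤ n
  poor-sample {n} {r} n₀≤n A {f} good =
    let (S , R , lenS , lenR , un) = hitting-set (≤-trans (m≤m+n n₁ _) n₀≤n) (PoorLink? t A f) (PoorLink-few t A f)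
    in build S R lenS lenR un
    where
    open Hitting (PoorLink? t A f) (PoorLink-few t A f)
    Exception : Fin n → Fin n → Set
    Exception u s = (s ∈ A × ¬ (n ≤ t * splits A f s)) × ∃ λ x → Split A f s u x
    Exception? : ∀ u s → Dec (Exception u s)
    Exception? u s = Poor? t A f s ×-dec Fin.any? (Split? A f s u)
    few-exceptions : ∀ s → t * # (λ u → Exception? u s) ≤ n
    few-exceptions s = by (Poor? t A f s)
      where
      by : Dec (s ∈ A × ¬ (n ≤ t * splits A f s)) → t * # (λ u → Exception? u s) ≤ n
      by (yes (_ , poor)) = ≤-trans
        (*-monoʳ-≤ t (#-mono (λ u → Exception? u s) (λ u → Fin.any? (Split? A f s u)) λ _ → proj₂)) (<⇒≤ (≰⇒> poor))
      by (no ¬poor) = ≤-trans (≤-reflexive (trans (cong (t *_) (#-none (λ u → Exception? u s) λ _ (p , _) → ¬poor p)) (*-zeroʳ t))) z≤n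
    build : ∀ S R → length S ≤ size₀ → length R * (4 * gap) ≤ n →
            # (λ z → (n ≤? t′ * deg z) ×-dec ¬? (Hit? S R z)) * ε ≤ n →
            ∃ λ (q : Partial r n) → # (Marked? q) * gap ≤ n × Follows A q f × # (UnknownActive? t t′ A f q) * ε ≤ n
    build S R lenS lenR un = q , size ,
      record { agree = agree-restrict In? flag f ; copy = copy } ,
      ≤-trans (*-monoˡ-≤ ε (#-mono (UnknownActive? t t′ A f q) (λ z → (n ≤? t′ * deg z) ×-dec ¬? (Hit? S R z))
        λ { z ((_ , _ , ¬l) , act) → act , λ hit → ¬l (hit⇒linked hit) })) un
      where
      E? : ∀ u → Dec (Any (Exception u) S)
      E? u = Any.any? (Exception? u) S
      In? : ∀ i → Dec (i ∈ A × (i ∈L (S ++ R) ⊎ Any (Exception i) S))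
      In? i = (i ∈? A) ×-dec ((i ∈L? (S ++ R)) ⊎-dec E? i)
      Center? : ∀ i → Dec (i ∈L S × (i ∈ A × ¬ (n ≤ t * splits A f i)))
      Center? i = (i ∈L? S) ×-dec Poor? t A f i
      flag : Fin n → Bool
      flag i = does (Center? i)
      q : Partial r n
      q = restrict In? λ i → flag i , lookup f i
      flagged⇒center : ∀ {u} → Flagged q u → u ∈L S × (u ∈ A × ¬ (n ≤ t * splits A f u))
      flagged⇒center {u} (c , e) = from (Center? u) (cong proj₁ (proj₂ (restrict-marked In? _ u e)))
        where
        from : ∀ d → true ≡ does d → u ∈L S × (u ∈ A × ¬ (n ≤ t * splits A f u))
        from (yes c) _ = c
        from (no _) ()
      copy : ∀ {v u w} → v ∈ A → known q v ≡ zero → Link q v u w → lookup f v ≡ lookup f w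
      copy {v} {u} {w} v∈A un (fl , kw , ap) with flagged⇒center fl
      -- If v and w differed in color, v would be an exception at u and hence recorded.
      ... | u∈S , poor = decidable-stable (lookup f v Fin.≟ lookup f w) λ ne →
        unknown-restrict In? flag f v (Good.present good v v∈A) un
          (v∈A , inj₂ (∃∈⇒Any u∈S (poor , w , AP3-swap₁₂ ap , (proj₁ poor , v∈A , w∈A) , ne)))
        where
        w∈A : w ∈ A
        w∈A = agree-∈ {p = q} good (agree-restrict In? flag f) kw
      hit⇒linked : ∀ {z} → Hit S R z → Linked q z
      hit⇒linked {z} hit =
        let (x , x∈R , seen) = Any⇒∃∈ hit
            (s , s∈S , ap , poor , x∈A) = Any⇒∃∈ seen
        in s , x , (lookup f s , trans (restrict-just In? _ s (proj₁ poor , inj₁ (Any.++⁺ˡ s∈S)))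
                     (cong (λ b → just (b , lookup f s)) (is-true (Center? s) (s∈S , poor)))) ,
           (λ e → unknown-restrict In? flag f x (Good.present good x x∈A) e (x∈A , inj₁ (Any.++⁺ʳ S x∈R))) , ap
        where
        is-true : ∀ {P : Set} (d : Dec P) → P → does d ≡ true
        is-true (yes _) _ = refl
        is-true (no ¬p) p = ⊥-elim (¬p p)
      exceptions : 4 * gap * # E? ≤ n
      exceptions = *-cancelˡ-≤ size₀ {{>-nonZero 1≤size₀}} (begin
        size₀ * (4 * gap * # E?)  ≡⟨ lemma size₀ gap (# E?) ⟩
        t * # E?                  ≤⟨ #-Any Exception? t n few-exceptions S ⟩
        length S * n              ≤⟨ *-monoˡ-≤ n lenS ⟩
        size₀ * n ∎)
        where
        open ≤-Reasoning
        lemma : ∀ s g e → s * (4 * g * e) ≡ 4 * (g * s) * e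
        lemma = solve-∀
      size : # (Marked? q) * gap ≤ n
      size = *-cancelˡ-≤ 4 (begin
        4 * (# (Marked? q) * gap) ≤⟨ *-monoʳ-≤ 4 (*-monoˡ-≤ gap (≤-trans (restrict-size In? _)
            (≤-trans (#-⊎ In? (λ i → i ∈L? (S ++ R)) E? λ _ → proj₂)
              (+-monoˡ-≤ _ (≤-trans (#-list (λ i → i ∈L? (S ++ R)) (S ++ R) λ _ → id) (≤-reflexive (length-++ S))))))) ⟩
        4 * ((length S + length R + # E?) * gap) ≡⟨ lemma (length S) (length R) (# E?) gap ⟩
        4 * (gap * length S) + (length R * (4 * gap) + 4 * gap * # E?)
          ≤⟨ +-mono-≤ (≤-trans (*-monoʳ-≤ 4 (*-monoʳ-≤ gap lenS)) (≤-trans (m≤n+m _ n₁) n₀≤n)) (+-mono-≤ lenR exceptions) ⟩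
        n + (n + n) ≤⟨ farkas n (z≤n {0}) (lemma′ n) ⟩
        4 * n ∎)
        where
        open ≤-Reasoning
        lemma : ∀ s r e g → 4 * ((s + r + e) * g) ≡ 4 * (g * s) + (r * (4 * g) + 4 * g * e)
        lemma = solve-∀
        lemma′ : ∀ n → n + (n + n) + 0 + n ≡ 4 * n + 0
        lemma′ = solve-∀

Missing? : ∀ (A : Subset n) i → Dec (i ∉ A)
Missing? A i = ¬? (i ∈? A)

PoorPar? : ∀ t (A : Subset n) (f : Vec (Col r) n) π z → Dec ((z ∈ A × ¬ (n ≤ t * splits A f z)) × par z ≡ π)
PoorPar? t A f π z = Poor? t A f z ×-dec par? π z

module _ (t h ε : ℕ) (1≤h : 1 ≤ h) (1≤ε : 1 ≤ ε) (A : Subset n) (f : Vec (Col r) n) (1≤n : 1 ≤ n)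
         {X : Fin n → Set} (X? : ∀ u → Dec (X u)) (inactive : ∀ u → X u → h * ε * poor-links t A f u < n) where

  Joined? : ∀ b u → Dec (X u × ∃ (PoorLink t A f u b))
  Joined? b u = X? u ×-dec Fin.any? (PoorLink? t A f u b)

  -- Averaging: the elements of X have at most n / (h ε) poor links each, so there are at most n² /
  -- (h ε) links. At least n / ε poor elements of parity π share them, so one of these is joined to
  -- at most n / h elements of X.
  sparse-center : ∀ π → n ≤ ε * # (PoorPar? t A f π) →
                  ∃ λ b → ((b ∈ A × ¬ (n ≤ t * splits A f b)) × par b ≡ π) × h * # (Joined? b) ≤ n
  sparse-center π many with Fin.any? (λ b → PoorPar? t A f π b ×-dec (h * # (Joined? b) ≤? n))
  ... | yes found = found
  ... | no ¬found = ⊥-elim (<-irrefl refl (begin-strict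
    n * n                           <⟨ *-monoˡ-< n {{>-nonZero 1≤n}} n<D ⟩
    h * D * n                       ≤⟨ *-monoʳ-≤ (h * D) many ⟩
    h * D * (ε * # (PoorPar? t A f π)) ≡⟨ lemma h D ε (# (PoorPar? t A f π)) ⟩
    h * ε * (D * # (PoorPar? t A f π)) ≤⟨ *-monoʳ-≤ (h * ε) edges ⟩
    h * ε * (n / (h * ε) * # X?)    ≡⟨ lemma′ (h * ε) (n / (h * ε)) (# X?) ⟩
    n / (h * ε) * (h * ε) * # X?    ≤⟨ *-mono-≤ (m/n*n≤m n (h * ε)) (#≤n X?) ⟩
    n * n ∎))
    where
    open ≤-Reasoning
    instance
      h≢0 : NonZero h
      h≢0 = >-nonZero 1≤h
      hε≢0 : NonZero (h * ε)
      hε≢0 = >-nonZero (1≤* 1≤h 1≤ε)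
    D = suc (n / h)
    n<D : n < h * D
    n<D = ≤-trans (s≤s (≤-reflexive (m≡m%n+[m/n]*n n h)))
      (≤-trans (+-monoˡ-≤ (n / h * h) (m%n<n n h)) (≤-reflexive (*-comm (suc (n / h)) h)))
    lemma : ∀ h D ε b → h * D * (ε * b) ≡ h * ε * (D * b)
    lemma = solve-∀
    lemma′ : ∀ a b c → a * (b * c) ≡ b * a * c
    lemma′ = solve-∀
    to-quotient : ∀ {x} → h * ε * x < n → x ≤ n / (h * ε)
    to-quotient {x} lt = ≤-trans (≤-reflexive (sym (m*n/n≡m x (h * ε))))
      (/-monoˡ-≤ (h * ε) (≤-trans (≤-reflexive (*-comm x (h * ε))) (<⇒≤ lt)))
    edges : D * # (PoorPar? t A f π) ≤ n / (h * ε) * # X?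
    edges = #-edges (PoorPar? t A f π) X? (λ b u → Fin.any? (PoorLink? t A f u b)) D (n / (h * ε))
      (λ b pb → *-cancelˡ-< h (n / h) _ (≤-<-trans (≤-trans (≤-reflexive (*-comm h _)) (m/n*n≤m n h)) (≰⇒> λ le → ¬found (b , pb , le))))
      (λ u xu → ≤-trans (#-mono (λ b → PoorPar? t A f π b ×-dec Fin.any? (PoorLink? t A f u b))
                                (λ b → Fin.any? (PoorLink? t A f u b)) λ _ → proj₂)
                        (to-quotient (inactive u xu)))

  -- An element u of the parity of b is b, or linked through b, or its midpoint with b is missing from A.
  parity-bound : ∀ π → n ≤ ε * # (PoorPar? t A f π) →
                 h * # (λ u → X? u ×-dec par? π u) ≤ n + h + h * # (Missing? A)
  parity-bound π many with sparse-center π many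
  ... | b , (poor , refl) , few = begin
    h * # (λ u → X? u ×-dec par? (par b) u)
      ≤⟨ *-monoʳ-≤ h (#-⊎ (λ u → X? u ×-dec par? (par b) u) (Joined? b) (λ u → (u Fin.≟ b) ⊎-dec Gap? u) split) ⟩
    h * (# (Joined? b) + # (λ u → (u Fin.≟ b) ⊎-dec Gap? u))
      ≤⟨ *-monoʳ-≤ h (+-monoʳ-≤ (# (Joined? b)) (≤-trans (#-⊎ (λ u → (u Fin.≟ b) ⊎-dec Gap? u) (Fin._≟ b) Gap? λ _ → id)
           (+-mono-≤ (#-one (Fin._≟ b) b λ _ → id) gaps))) ⟩
    h * (# (Joined? b) + (1 + # (Missing? A)))  ≡⟨ lemma h (# (Joined? b)) (# (Missing? A)) ⟩
    h * # (Joined? b) + h + h * # (Missing? A)  ≤⟨ +-monoˡ-≤ _ (+-monoˡ-≤ h few) ⟩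
    n + h + h * # (Missing? A) ∎
    where
    open ≤-Reasoning
    lemma : ∀ h x m → h * (x + (1 + m)) ≡ h * x + h + h * m
    lemma = solve-∀
    MidOf? : ∀ u w → Dec (Mid u w b)
    MidOf? u w = _ ≟ _
    Gap? : ∀ u → Dec (∃ λ w → w ∉ A × Mid u w b)
    Gap? u = Fin.any? λ w → Missing? A w ×-dec MidOf? u w
    gaps : # Gap? ≤ # (Missing? A)
    gaps = #-inject Gap? (Missing? A) MidOf? (λ _ → id) λ w u u′ e e′ → toℕ-cancel (toℕ b) (trans e (sym e′))
    split : ∀ u → X u × par u ≡ par b → (X u × ∃ (PoorLink t A f u b)) ⊎ (u ≡ b ⊎ ∃ λ w → w ∉ A × Mid u w b)
    split u (xu , e) with u Fin.≟ b | midpoint u b e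
    ... | yes eq | _ = inj₂ (inj₁ eq)
    ... | no ne | w , m with w ∈? A
    ...   | yes w∈A = inj₁ (xu , w , AP3-swap₂₃ (Mid⇒AP3 ne m) , poor , w∈A)
    ...   | no w∉A  = inj₂ (inj₂ (w , w∉A , m))

abstract
  allMarks : ∀ r → List (Mark r)
  allMarks r = List.cartesianProduct (true ∷ false ∷ []) (colors r)

  ∈-allMarks : ∀ (x : Mark r) → x ∈′ allMarks r
  ∈-allMarks {r} (b , c) = ∈-cartesianProduct⁺ {xs = true ∷ false ∷ []} {ys = colors r} (∈-bool b) (∈-allFin c)
    where
    ∈-bool : ∀ b → b ∈′ (true ∷ false ∷ [])
    ∈-bool true  = here refl
    ∈-bool false = there (here refl)

  1≤allMarks : ∀ r → 1 ≤ length (allMarks r)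
  1≤allMarks r = s≤s z≤n

-- Extracts bounds for r ^ m and r ^ (2 m) from the one for r ^ (8 m), with the exponent rounded up.
root : ∀ k X N → 1 ≤ k → X ^ k ≤ 2 ^ N → ∃ λ e → k * e ≤ N + k × X ≤ 2 ^ e
root k X N 1≤k h = suc (N / k) , small , ≮⇒≥ λ lt → <-irrefl refl (begin-strict
  2 ^ N                  <⟨ ^-monoʳ-< 2 (s≤s (s≤s z≤n)) N< ⟩
  2 ^ (suc (N / k) * k)  ≡⟨ ^-*-assoc 2 (suc (N / k)) k ⟨
  (2 ^ suc (N / k)) ^ k  ≤⟨ ^-monoˡ-≤ k (<⇒≤ lt) ⟩
  X ^ k                  ≤⟨ h ⟩
  2 ^ N ∎)
  where
  open ≤-Reasoning
  instance
    k≢0 : NonZero k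
    k≢0 = >-nonZero 1≤k
  N< : N < suc (N / k) * k
  N< = ≤-trans (s≤s (≤-reflexive (m≡m%n+[m/n]*n N k))) (+-monoˡ-≤ _ (m%n<n N k))
  small : k * suc (N / k) ≤ N + k
  small = ≤-trans (≤-reflexive (trans (*-suc k _) (trans (+-comm k _) (cong (_+ k) (*-comm k _))))) (+-monoˡ-≤ k (m/n*n≤m N k))

r^≤2^ : ∀ r x → r ^ x ≤ 2 ^ (r * x)
r^≤2^ r x = ≤-trans (^-monoˡ-≤ x (<⇒≤ (n<2^n r))) (≤-reflexive (^-*-assoc 2 r x))

other : Parity → Parity
other 0ℙ = 1ℙ
other 1ℙ = 0ℙ

par-split : ∀ π (u : Fin n) → par u ≡ π ⊎ par u ≡ other π
par-split π u = go π (par u)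
  where
  go : ∀ π ρ → ρ ≡ π ⊎ ρ ≡ other π
  go 0ℙ 0ℙ = inj₁ refl
  go 0ℙ 1ℙ = inj₂ refl
  go 1ℙ 0ℙ = inj₂ refl
  go 1ℙ 1ℙ = inj₁ refl

module Budget (r H t : ℕ) (2≤r : 2 ≤ r) (H≥ : 128 * r ≤ H) (n : ℕ) (n≥ : 48 + 160 * r ≤ n) (A : Subset n)
              (dense : r ^ (8 * # (Missing? A)) ≤ 2 ^ (3 * n)) (p q : Partial r n) (f : Vec (Col r) n)
              (rich-few : # (RichUntyped? t A f p) * H ≤ n)
              (active-few : # (UnknownActive? t (H * H) A f q) * H ≤ n) where

  open LinkScheme A p q

  private
    m UT UU : ℕ
    m = # (Missing? A)
    UT = # UnknownTyped?
    UU = # UnknownUntyped?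

    1≤H : 1 ≤ H
    1≤H = ≤-trans (1≤* {128} (s≤s z≤n) (≤-trans (s≤s z≤n) 2≤r)) H≥

    1≤n : 1 ≤ n
    1≤n = ≤-trans (s≤s z≤n) n≥

    instance
      H≢0 : NonZero H
      H≢0 = >-nonZero 1≤H
      r≢0 : NonZero r
      r≢0 = >-nonZero (≤-trans (s≤s z≤n) 2≤r)

    s : ℕ
    s = suc (n / H)

    n≤Hs : n ≤ H * s
    n≤Hs = ≤-trans (≤-reflexive (m≡m%n+[m/n]*n n H)) (≤-trans (+-monoˡ-≤ _ (<⇒≤ (m%n<n n H))) (≤-reflexive (*-comm (suc (n / H)) H)))

    small : ∀ {x} → H * x ≤ n → x ≤ s
    small h = *-cancelˡ-≤ H (≤-trans h n≤Hs)

    -- Negligible sets are measured in units of s, slightly more than n / H. A few of them, at r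
    -- bits per element, must fit into the slack between 7 n / 8 and 15 n / 16.
    128rs≤ : 128 * (r * s) ≤ n + 128 * r
    128rs≤ = begin
      128 * (r * s)                 ≡⟨ lemma r (n / H) ⟩
      128 * r * (n / H) + 128 * r   ≤⟨ +-monoˡ-≤ (128 * r) (≤-trans (*-monoˡ-≤ (n / H) H≥) (≤-trans (≤-reflexive (*-comm H _)) (m/n*n≤m n H))) ⟩
      n + 128 * r ∎
      where
      open ≤-Reasoning
      lemma : ∀ r x → 128 * (r * (1 + x)) ≡ 128 * r * x + 128 * r
      lemma = solve-∀

    UnknownPar? : ∀ π u → Dec ((u ∈ A × known q u ≡ zero × ¬ Linked q u) × par u ≡ π)
    UnknownPar? π u = Unknown? A q u ×-dec par? π u

    -- The unknown elements with many poor links are few because the sample links almost all of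
    -- them; the others obey `parity-bound`.
    unknown-par : ∀ π → n ≤ H * # (PoorPar? t A f π) → # (UnknownPar? π) ≤ 2 * s + 1 + m
    unknown-par π many = *-cancelˡ-≤ H (begin
      H * # (UnknownPar? π)
        ≤⟨ *-monoʳ-≤ H (#-⊎ (UnknownPar? π) (UnknownActive? t (H * H) A f q) (λ u → Idle? u ×-dec par? π u) split) ⟩
      H * (# (UnknownActive? t (H * H) A f q) + # (λ u → Idle? u ×-dec par? π u))
        ≡⟨ *-distribˡ-+ H _ _ ⟩
      H * # (UnknownActive? t (H * H) A f q) + H * # (λ u → Idle? u ×-dec par? π u)
        ≤⟨ +-mono-≤ (≤-trans (≤-reflexive (*-comm H _)) active-few)
             (parity-bound t H H 1≤H 1≤H A f 1≤n Idle? (λ u (_ , ¬act) → ≰⇒> ¬act) π many) ⟩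
      n + (n + H + H * m)              ≤⟨ farkas 0 (2 ⊗ n≤Hs) (lemma H n m s) ⟩
      H * (2 * s + 1 + m) ∎)
      where
      open ≤-Reasoning
      lemma : ∀ H n m s → n + (n + H + H * m) + 2 * (H * s) + 0 ≡ H * (2 * s + 1 + m) + 2 * n
      lemma = solve-∀
      Idle? : ∀ u → Dec ((u ∈ A × known q u ≡ zero × ¬ Linked q u) × ¬ (n ≤ H * H * poor-links t A f u))
      Idle? u = Unknown? A q u ×-dec ¬? (n ≤? H * H * poor-links t A f u)
      split : ∀ u → (u ∈ A × known q u ≡ zero × ¬ Linked q u) × par u ≡ π →
              ((u ∈ A × known q u ≡ zero × ¬ Linked q u) × n ≤ H * H * poor-links t A f u) ⊎
              ((u ∈ A × known q u ≡ zero × ¬ Linked q u) × ¬ (n ≤ H * H * poor-links t A f u)) × par u ≡ π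
      split u (un , e) = by (n ≤? H * H * poor-links t A f u)
        where
        by : Dec (n ≤ H * H * poor-links t A f u) → _
        by (yes act) = inj₁ (un , act)
        by (no ¬act) = inj₂ ((un , ¬act) , e)

    finish : ∀ x → 16 * x ≤ 15 * n → 2 ^ x ≤ 2 ^ (15 * n / 16)
    finish x h = ^-monoʳ-≤ 2 (≤-trans (≤-reflexive (sym (m*n/n≡m x 16)))
      (/-monoˡ-≤ 16 (≤-trans (≤-reflexive (*-comm x 16)) h)))

    -- About m elements of each parity remain unknown. Even at r colors each they cost r ^ (2 m),
    -- whose fourth power is r ^ (8 m), so 3 n / 4 bits.
    both : (∀ π → n ≤ H * # (PoorPar? t A f π)) → 2 ^ UT * r ^ UU ≤ 2 ^ (15 * n / 16)
    both many =
      let (e , 4e≤ , r²ᵐ≤) = root 4 (r ^ (2 * m)) (3 * n) (s≤s z≤n)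
            (≤-trans (≤-reflexive (trans (^-*-assoc r (2 * m) 4) (cong (r ^_) (eq m)))) dense)
      in ≤-trans (begin
        2 ^ UT * r ^ UU                       ≤⟨ *-monoˡ-≤ (r ^ UU) (^-monoˡ-≤ UT 2≤r) ⟩
        r ^ UT * r ^ UU                       ≡⟨ ^-distribˡ-+-* r UT UU ⟨
        r ^ (UT + UU)                         ≤⟨ ^-monoʳ-≤ r total ⟩
        r ^ (2 * m + (4 * s + 2))             ≡⟨ ^-distribˡ-+-* r (2 * m) (4 * s + 2) ⟩
        r ^ (2 * m) * r ^ (4 * s + 2)         ≤⟨ *-mono-≤ r²ᵐ≤ (r^≤2^ r (4 * s + 2)) ⟩
        2 ^ e * 2 ^ (r * (4 * s + 2))         ≡⟨ ^-distribˡ-+-* 2 e _ ⟨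
        2 ^ (e + r * (4 * s + 2)) ∎)
        (finish (e + r * (4 * s + 2)) (*-cancelˡ-≤ 2 (farkas (3 * n + 64 + 128 * r) ((8 ⊗ 4e≤) ⊕ 128rs≤ ⊕ (2 ⊗ n≥)) (eq′ e r s n))))
      where
      open ≤-Reasoning
      eq : ∀ m → 2 * m * 4 ≡ 8 * m
      eq = solve-∀
      eq′ : ∀ e r s n → 2 * (16 * (e + r * (4 * s + 2))) + (8 * (3 * n + 4) + (n + 128 * r + 2 * n)) + (3 * n + 64 + 128 * r)
            ≡ 2 * (15 * n) + (8 * (4 * e) + (128 * (r * s) + 2 * (48 + 160 * r)))
      eq′ = solve-∀
      total : UT + UU ≤ 2 * m + (4 * s + 2)
      total = begin
        UT + UU                    ≤⟨ #-disjoint (Unknown? A q) UnknownTyped? UnknownUntyped? (λ _ → proj₁) (λ _ → proj₁) (λ _ (_ , t) (_ , ¬t) → ¬t t) ⟩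
        # (Unknown? A q)           ≤⟨ #-⊎ (Unknown? A q) (UnknownPar? 0ℙ) (UnknownPar? 1ℙ) (λ u un → Sum.map (un ,_) (un ,_) (par-split 0ℙ u)) ⟩
        # (UnknownPar? 0ℙ) + # (UnknownPar? 1ℙ) ≤⟨ +-mono-≤ (unknown-par 0ℙ (many 0ℙ)) (unknown-par 1ℙ (many 1ℙ)) ⟩
        2 * s + 1 + m + (2 * s + 1 + m) ≡⟨ eq″ s m ⟩
        2 * m + (4 * s + 2) ∎
        where
        eq″ : ∀ s m → 2 * s + 1 + m + (2 * s + 1 + m) ≡ 2 * m + (4 * s + 2)
        eq″ = solve-∀

    -- In parity π about m unknown elements cost r ^ m, so 3 n / 8 bits. The other parity has few
    -- poor elements, so almost all of its unknown elements are typed and cost one bit each, n / 2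
    -- in total.
    one : ∀ π → n ≤ H * # (PoorPar? t A f π) → ¬ (n ≤ H * # (PoorPar? t A f (other π))) →
          2 ^ UT * r ^ UU ≤ 2 ^ (15 * n / 16)
    one π many few =
      let (e , 8e≤ , rᵐ≤) = root 8 (r ^ m) (3 * n) (s≤s z≤n)
            (≤-trans (≤-reflexive (trans (^-*-assoc r m 8) (cong (r ^_) (*-comm m 8)))) dense)
      in ≤-trans (begin
        2 ^ UT * r ^ UU                           ≤⟨ *-mono-≤ (^-monoʳ-≤ 2 UT≤) (^-monoʳ-≤ r UU≤) ⟩
        2 ^ (UTπ + k) * r ^ (UUπ + 2 * s)         ≡⟨ cong (_* r ^ (UUπ + 2 * s)) (^-distribˡ-+-* 2 UTπ k) ⟩
        2 ^ UTπ * 2 ^ k * r ^ (UUπ + 2 * s)       ≤⟨ *-monoˡ-≤ _ (*-monoˡ-≤ (2 ^ k) (^-monoˡ-≤ UTπ 2≤r)) ⟩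
        r ^ UTπ * 2 ^ k * r ^ (UUπ + 2 * s)       ≡⟨ swap (r ^ UTπ) (2 ^ k) _ ⟩
        r ^ UTπ * r ^ (UUπ + 2 * s) * 2 ^ k       ≡⟨ cong (_* 2 ^ k) (^-distribˡ-+-* r UTπ (UUπ + 2 * s)) ⟨
        r ^ (UTπ + (UUπ + 2 * s)) * 2 ^ k         ≤⟨ *-monoˡ-≤ (2 ^ k) (^-monoʳ-≤ r total) ⟩
        r ^ (m + (4 * s + 1)) * 2 ^ k             ≡⟨ cong (_* 2 ^ k) (^-distribˡ-+-* r m (4 * s + 1)) ⟩
        r ^ m * r ^ (4 * s + 1) * 2 ^ k           ≤⟨ *-monoˡ-≤ (2 ^ k) (*-mono-≤ rᵐ≤ (r^≤2^ r (4 * s + 1))) ⟩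
        2 ^ e * 2 ^ (r * (4 * s + 1)) * 2 ^ k     ≡⟨ cong (_* 2 ^ k) (^-distribˡ-+-* 2 e _) ⟨
        2 ^ (e + r * (4 * s + 1)) * 2 ^ k         ≡⟨ ^-distribˡ-+-* 2 (e + r * (4 * s + 1)) k ⟨
        2 ^ (e + r * (4 * s + 1) + k) ∎)
        (finish (e + r * (4 * s + 1) + k)
          (*-cancelˡ-≤ 2 (farkas 0 ((4 ⊗ 8e≤) ⊕ 128rs≤ ⊕ (16 ⊗ #-parity-≤ n (other π)) ⊕ n≥) (eq e r s n k))))
      where
      open ≤-Reasoning
      k : ℕ
      k = # {n} (par? (other π))
      eq : ∀ e r s n k → 2 * (16 * (e + r * (4 * s + 1) + k)) + (4 * (3 * n + 8) + (n + 128 * r + (16 * suc n + n))) + 0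
           ≡ 2 * (15 * n) + (4 * (8 * e) + (128 * (r * s) + (16 * (2 * k) + (48 + 160 * r))))
      eq = solve-∀
      swap : ∀ a b c → a * b * c ≡ a * c * b
      swap = solve-∀
      UTπ? = λ u → UnknownTyped? u ×-dec par? π u
      UUπ? = λ u → UnknownUntyped? u ×-dec par? π u
      UTπ = # UTπ?
      UUπ = # UUπ?
      UT≤ : UT ≤ UTπ + k
      UT≤ = #-⊎ UnknownTyped? UTπ? (par? (other π)) λ u h → Sum.map (h ,_) id (par-split π u)
      poor≤ : # (PoorPar? t A f (other π)) ≤ s
      poor≤ = small (<⇒≤ (≰⇒> few))
      rich≤ : # (RichUntyped? t A f p) ≤ s
      rich≤ = small (≤-trans (≤-reflexive (*-comm H _)) rich-few)
      UU≤ : UU ≤ UUπ + 2 * s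
      UU≤ = ≤-trans (#-⊎ UnknownUntyped? UUπ? (λ u → PoorPar? t A f (other π) u ⊎-dec RichUntyped? t A f p u) split)
        (+-monoʳ-≤ UUπ (≤-trans (#-⊎ (λ u → PoorPar? t A f (other π) u ⊎-dec RichUntyped? t A f p u) (PoorPar? t A f (other π)) (RichUntyped? t A f p) λ _ → id)
          (≤-trans (+-mono-≤ poor≤ rich≤) (≤-reflexive (cong (s +_) (sym (+-identityʳ s)))))))
        where
        split : ∀ u → (u ∈ A × known q u ≡ zero × ¬ Linked q u) × ¬ Typed p u →
                (((u ∈ A × known q u ≡ zero × ¬ Linked q u) × ¬ Typed p u) × par u ≡ π) ⊎
                ((u ∈ A × ¬ (n ≤ t * splits A f u)) × par u ≡ other π) ⊎ ((u ∈ A × n ≤ t * splits A f u) × ¬ Typed p u)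
        split u h@((u∈A , _) , ¬t) = by (par-split π u) (n ≤? t * splits A f u)
          where
          by : par u ≡ π ⊎ par u ≡ other π → Dec (n ≤ t * splits A f u) → _
          by (inj₁ e) _         = inj₁ (h , e)
          by (inj₂ e) (yes ri)  = inj₂ (inj₂ ((u∈A , ri) , ¬t))
          by (inj₂ e) (no poor) = inj₂ (inj₁ ((u∈A , poor) , e))
      total : UTπ + (UUπ + 2 * s) ≤ m + (4 * s + 1)
      total = begin
        UTπ + (UUπ + 2 * s)      ≡⟨ +-assoc UTπ UUπ (2 * s) ⟨
        UTπ + UUπ + 2 * s        ≤⟨ +-monoˡ-≤ (2 * s) (#-disjoint (UnknownPar? π) UTπ? UUπ?
                                      (λ { _ ((un , _) , e) → un , e }) (λ { _ ((un , _) , e) → un , e }) (λ { _ ((_ , t) , _) ((_ , ¬t) , _) → ¬t t })) ⟩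
        # (UnknownPar? π) + 2 * s ≤⟨ +-monoˡ-≤ (2 * s) (unknown-par π many) ⟩
        2 * s + 1 + m + 2 * s    ≡⟨ eq‴ s m ⟩
        m + (4 * s + 1) ∎
        where
        eq‴ : ∀ s m → 2 * s + 1 + m + 2 * s ≡ m + (4 * s + 1)
        eq‴ = solve-∀

  budget : ∀ π → n ≤ H * # (PoorPar? t A f π) → 2 ^ UT * r ^ UU ≤ 2 ^ (15 * n / 16)
  budget π many = by (n ≤? H * # (PoorPar? t A f (other π)))
    where
    is-either : ∀ π ρ → π ≡ ρ ⊎ other π ≡ ρ
    is-either 0ℙ 0ℙ = inj₁ refl
    is-either 0ℙ 1ℙ = inj₂ refl
    is-either 1ℙ 0ℙ = inj₂ refl
    is-either 1ℙ 1ℙ = inj₁ refl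
    by : Dec (n ≤ H * # (PoorPar? t A f (other π))) → 2 ^ UT * r ^ UU ≤ 2 ^ (15 * n / 16)
    by (yes many′) = both λ ρ → pick ρ (is-either π ρ)
      where
      pick : ∀ ρ → π ≡ ρ ⊎ other π ≡ ρ → n ≤ H * # (PoorPar? t A f ρ)
      pick ρ (inj₁ e) = subst (λ ρ → n ≤ H * # (PoorPar? t A f ρ)) e many
      pick ρ (inj₂ e) = subst (λ ρ → n ≤ H * # (PoorPar? t A f ρ)) e many′
    by (no few) = one π many few

module PoorCase (r H : ℕ) (2≤r : 2 ≤ r) (H≥ : 128 * r ≤ H) where

  private
    1≤H : 1 ≤ H
    1≤H = ≤-trans (1≤* {128} (s≤s z≤n) (≤-trans (s≤s z≤n) 2≤r)) H≥

  open Sparse (allMarks r) H (1≤allMarks r) 1≤H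
  open PoorSampling (H * H) H gap (1≤* 1≤H 1≤H) 1≤H 1≤gap public using (t; 1≤t)
  open PoorSampling (H * H) H gap (1≤* 1≤H 1≤H) 1≤H 1≤gap using (n₀; poor-sample)

  poor-n₀ : ℕ
  poor-n₀ = n₀ + (48 + 160 * r) + H

  ManyPoor : Subset n → Partial r n → Vec (Col r) n → Set
  ManyPoor {n} A p f = Good A f × Agree p f × # (RichUntyped? t A f p) * H ≤ n × ∃ λ π → n ≤ H * # (PoorPar? t A f π)

  poor-case : poor-n₀ ≤ n → (A : Subset n) → r ^ (8 * # (Missing? A)) ≤ 2 ^ (3 * n) → (p : Partial r n) →
              ∃ λ e → e * H ≤ 3 * n × Bounded (colors r) (ManyPoor A p) (2 ^ e * 2 ^ (15 * n / 16))
  poor-case {n} n≥ A dense p =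
    let (e , small , count) = sparse-count n (≤-trans (m≤n+m H _) n≥)
    in e , small , Bounded-mono covered ≤-refl
         (Bounded-∃ (∈-marks ∈-allMarks) SparseMarks? {λ q f → Good A f × Agree p f × Follows A q f × Cheap q}
           (λ q _ → cheap-bound q (2 ^ # (LinkScheme.UnknownTyped? A p q) * r ^ # (LinkScheme.UnknownUntyped? A p q) ≤? _)) count)
    where
    -- The cost bound concerns p and q alone but is derived from a coloring that they describe. So
    -- it is made part of the class and decided for each q; the class of an expensive q is empty.
    Cheap : Partial r n → Set
    Cheap q = 2 ^ # (LinkScheme.UnknownTyped? A p q) * r ^ # (LinkScheme.UnknownUntyped? A p q) ≤ 2 ^ (15 * n / 16)
    cheap-bound : ∀ q → Dec (Cheap q) → Bounded (colors r) (λ f → Good A f × Agree p f × Follows A q f × Cheap q) (2 ^ (15 * n / 16))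
    cheap-bound q (yes c) = Bounded-mono (λ _ (good , ag , fo , _) → good , ag , fo) ≤-refl (LinkScheme.link-scheme A p q _ c)
    cheap-bound q (no ¬c) = Bounded-mono (λ _ h → h) z≤n (Bounded-∅ λ _ (_ , _ , _ , c) → ¬c c)
    covered : ∀ f → ManyPoor A p f → ∃ λ q → # (Marked? q) * gap ≤ n × (Good A f × Agree p f × Follows A q f × Cheap q)
    covered f (good , ag , rich , π , many) =
      let (q , sparse , fo , active) = poor-sample (≤-trans (m≤m+n n₀ _) (≤-trans (m≤m+n (n₀ + (48 + 160 * r)) H) n≥)) A good
      in q , sparse , good , ag , fo ,
         Budget.budget r H t 2≤r H≥ n (≤-trans (m≤n+m (48 + 160 * r) n₀) (≤-trans (m≤m+n _ H) n≥)) A dense p q f rich active π many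

-- Progressions of mixed type

HasColor : Partial r n → Fin n → Col r → Set
HasColor p v c = ∃ λ a → ∃ λ b → type p v ≡ just (a , b) × (c ≡ a ⊎ c ≡ b)

Distinct : Col r → Col r → Col r → Set
Distinct α β γ = α ≢ β × α ≢ γ × β ≢ γ

type-< : ∀ (p : Partial r n) v {a b} → type p v ≡ just (a , b) → a Fin.< b
type-< p v e = let (_ , _ , _ , _ , _ , _ , lt) = type-witness p v e in lt

avoid : ∀ (p : Partial r n) v {a b} → type p v ≡ just (a , b) → ∀ c → ∃ λ d → HasColor p v d × d ≢ c
avoid p v {a} {b} e c with a Fin.≟ c
... | no a≢c  = a , (a , b , e , inj₁ refl) , a≢c
... | yes a≡c = b , (a , b , e , inj₂ refl) , λ b≡c → <ᶠ⇒≢ (type-< p v e) (trans a≡c (sym b≡c))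

-- Two distinct two-element sets; the ordering of each pair rules out that they differ only in
-- order.
outside-type : ∀ {a b a′ b′ : Col r} → a Fin.< b → a′ Fin.< b′ → (a , b) ≢ (a′ , b′) →
               ∃ λ c → (c ≡ a ⊎ c ≡ b) × c ≢ a′ × c ≢ b′
outside-type {a = a} {b} {a′} {b′} a<b a′<b′ ne with a Fin.≟ a′ | a Fin.≟ b′ | b Fin.≟ a′ | b Fin.≟ b′
... | no x | no y | _ | _ = a , inj₁ refl , x , y
... | _ | _ | no x | no y = b , inj₂ refl , x , y
... | yes refl | _ | _ | yes refl = ⊥-elim (ne refl)
... | yes refl | _ | yes refl | no _ = ⊥-elim (<-irrefl refl a<b)
... | no _ | yes refl | _ | yes refl = ⊥-elim (<-irrefl refl a<b)
... | no _ | yes refl | yes refl | no _ = ⊥-elim (<-asym a<b a′<b′)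

-- α is chosen in the type of u outside that of v, then γ ≠ α at w, then β ≠ γ at v. The remaining
-- inequality α ≠ β holds because α is not in the type of v.
representatives : ∀ (p : Partial r n) u v w {a b a′ b′ a″ b″} → type p u ≡ just (a , b) → type p v ≡ just (a′ , b′) →
                  type p w ≡ just (a″ , b″) → (a , b) ≢ (a′ , b′) →
                  ∃ λ α → ∃ λ β → ∃ λ γ → HasColor p u α × HasColor p v β × HasColor p w γ × Distinct α β γ
representatives p u v w eu ev ew ne =
  let (α , α∈ , α≢a′ , α≢b′) = outside-type (type-< p u eu) (type-< p v ev) ne
      (γ , γ∈ , γ≢α)         = avoid p w ew α
      (β , β∈ , β≢γ)         = avoid p v ev γ
  in α , β , γ , (_ , _ , eu , α∈) , β∈ , γ∈ ,
     (λ e → not-in ev β∈ α≢a′ α≢b′ e) , γ≢α ∘ sym , β≢γ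
  where
  not-in : ∀ {α β a′ b′} → type p v ≡ just (a′ , b′) → HasColor p v β → α ≢ a′ → α ≢ b′ → α ≢ β
  not-in ev (x , y , e , β∈) α≢a′ α≢b′ refl with trans (sym ev) e
  ... | refl = Sum.[ α≢a′ , α≢b′ ] β∈

-- The terms are sorted because colors are chosen from the last position down: k first, i last.
record Mixed (A : Subset n) (p : Partial r n) : Set where
  field
    i j k       : Fin n
    i<j         : i Fin.< j
    j<k         : j Fin.< k
    ap          : AP3 i j k
    i∈A         : i ∈ A
    j∈A         : j ∈ A
    k∈A         : k ∈ A
    α β γ       : Col r
    α∈          : HasColor p i α
    β∈          : HasColor p j β
    γ∈          : HasColor p k γ
    distinct    : Distinct α β γ

_≟ᵗ_ : ∀ (x y : Maybe (Col r × Col r)) → Dec (x ≡ y)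
_≟ᵗ_ = Maybe.≡-dec (Product.≡-dec Fin._≟_ Fin._≟_)

MixedAt : Subset n → Partial r n → Fin n → Fin n → Fin n → Set
MixedAt A p i j k = i Fin.< j × Mid i j k × (i ∈ A × j ∈ A × k ∈ A) × (Typed p i × Typed p j × Typed p k) ×
                    ¬ (type p i ≡ type p j × type p j ≡ type p k)

MixedAt? : ∀ (A : Subset n) (p : Partial r n) i j k → Dec (MixedAt A p i j k)
MixedAt? A p i j k = (i Fin.<? j) ×-dec (_ ≟ _) ×-dec ((i ∈? A) ×-dec (j ∈? A) ×-dec (k ∈? A)) ×-dec
  (Typed? p i ×-dec Typed? p j ×-dec Typed? p k) ×-dec ¬? ((type p i ≟ᵗ type p j) ×-dec (type p j ≟ᵗ type p k))

Mid-< : ∀ {i j k : Fin n} → i Fin.< j → Mid i j k → j Fin.< k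
Mid-< {i = i} {j} {k} i<j m = +-cancelˡ-< (toℕ j) _ _ (begin-strict
  toℕ j + toℕ j ≡⟨ cong (toℕ j +_) (+-identityʳ _) ⟨
  2 * toℕ j     ≡⟨ m ⟨
  toℕ i + toℕ k <⟨ +-monoˡ-< (toℕ k) i<j ⟩
  toℕ j + toℕ k ∎)
  where open ≤-Reasoning

to-mixed : ∀ (A : Subset n) (p : Partial r n) {i j k} → MixedAt A p i j k →
           ∃ λ (t : Mixed A p) → Mixed.i t ≡ i × Mixed.j t ≡ j × Mixed.k t ≡ k
to-mixed A p {i} {j} {k} (i<j , m , (i∈ , j∈ , k∈) , (ti , tj , tk) , ne) = build (type-typed p i ti) (type-typed p j tj) (type-typed p k tk)
  where
  j<k = Mid-< {i = i} {j} {k} i<j m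
  make : (∃ λ α → ∃ λ β → ∃ λ γ → HasColor p i α × HasColor p j β × HasColor p k γ × Distinct α β γ) →
         ∃ λ (t : Mixed A p) → Mixed.i t ≡ i × Mixed.j t ≡ j × Mixed.k t ≡ k
  make (α , β , γ , α∈ , β∈ , γ∈ , d) = record
    { i = i ; j = j ; k = k ; i<j = i<j ; j<k = j<k
    ; ap = Mid⇒AP3 (λ e → <-irrefl (cong toℕ e) (<-trans i<j j<k)) m
    ; i∈A = i∈ ; j∈A = j∈ ; k∈A = k∈ ; α∈ = α∈ ; β∈ = β∈ ; γ∈ = γ∈ ; distinct = d } , refl , refl , refl
  build : (∃ λ a → ∃ λ b → type p i ≡ just (a , b)) → (∃ λ a → ∃ λ b → type p j ≡ just (a , b)) →
          (∃ λ a → ∃ λ b → type p k ≡ just (a , b)) → _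
  build (a , b , ei) (a′ , b′ , ej) (a″ , b″ , ek) = by (type p i ≟ᵗ type p j) (type p j ≟ᵗ type p k)
    where
    by : Dec (type p i ≡ type p j) → Dec (type p j ≡ type p k) → _
    by (yes e) (yes e′) = ⊥-elim (ne (e , e′))
    by (no ne′) _ = make (representatives p i j k ei ej ek λ e → ne′ (trans ei (trans (cong just e) (sym ej))))
    by (yes _) (no ne′) = let (β , γ , α , β∈ , γ∈ , α∈ , βγ , βα , γα) =
                                representatives p j k i ej ek ei λ e → ne′ (trans ej (trans (cong just e) (sym ek)))
                          in make (α , β , γ , α∈ , β∈ , γ∈ , βα ∘ sym , γα ∘ sym , βγ)

module _ {A : Subset n} {p : Partial r n} where

  open Mixed

  vertices : List (Mixed A p) → List (Fin n)
  vertices []      = []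
  vertices (t ∷ M) = i t ∷ j t ∷ k t ∷ vertices M

  length-vertices : ∀ M → length (vertices M) ≡ 3 * length M
  length-vertices []      = refl
  length-vertices (t ∷ M) = trans (cong (3 +_) (length-vertices M)) (sym (*-suc 3 (length M)))

  Matching : List (Mixed A p) → Set
  Matching []      = ⊤
  Matching (t ∷ M) = (¬ i t ∈L vertices M × ¬ j t ∈L vertices M × ¬ k t ∈L vertices M) × Matching M

  Extends : List (Mixed A p) → Fin n → Fin n → Fin n → Set
  Extends M x y z = MixedAt A p x y z × ¬ x ∈L vertices M × ¬ y ∈L vertices M × ¬ z ∈L vertices M

  Extends? : ∀ M x y z → Dec (Extends M x y z)
  Extends? M x y z = MixedAt? A p x y z ×-dec ¬? (x ∈L? vertices M) ×-dec ¬? (y ∈L? vertices M) ×-dec ¬? (z ∈L? vertices M)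

  -- Greedy: progressions are added one at a time, and being unable to add another is exactly
  -- maximality.
  matching : ∀ N → (∃ λ M → Matching M × length M ≡ N) ⊎
                   (∃ λ M → length M ≤ N × ∀ x y z → ¬ Extends M x y z)
  matching zero = inj₁ ([] , tt , refl)
  matching (suc N) with matching N
  ... | inj₂ (M , le , max) = inj₂ (M , ≤-trans le (n≤1+n N) , max)
  ... | inj₁ (M , mat , refl) = by (Fin.any? λ x → Fin.any? λ y → Fin.any? λ z → Extends? M x y z)
    where
    by : Dec (∃ λ x → ∃ λ y → ∃ λ z → Extends M x y z) → _
    by (no ¬e) = inj₂ (M , n≤1+n _ , λ x y z e → ¬e (x , y , z , e))
    by (yes (x , y , z , mx , ix , iy , iz)) with to-mixed A p mx
    ... | t , refl , refl , refl = inj₁ (t ∷ M , ((ix , iy , iz) , mat) , refl)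

-- Disjointness of the progressions makes the positions `pos t` distinct, so each t with `C t f`
-- yields its own forced position. `C t f` must be decided by the entries above `pos t`.
module Forcing {r n} (1≤r : 1 ≤ r) (A : Subset n) (p q : Partial r n) (M : List (Mixed A p)) (mat : Matching M)
  (pos : Mixed A p → Fin n) (χ : Mixed A p → Col r)
  (pos-vertex : ∀ t → pos t ≡ Mixed.i t ⊎ pos t ≡ Mixed.j t ⊎ pos t ≡ Mixed.k t)
  (pos∈A : ∀ t → pos t ∈ A) (χ∈ : ∀ t → HasColor p (pos t) (χ t))
  {C : Mixed A p → Vec (Col r) n → Set} (C? : ∀ t f → Dec (C t f))
  (C-local : ∀ t f g → AgreeAbove (pos t) f g → C t f → C t g) where

  open Mixed

  Cond : Fin n → Vec (Col r) n → Set
  Cond v f = Any (λ t → pos t ≡ v × C t f) M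

  Cond? : ∀ v f → Dec (Cond v f)
  Cond? v f = Any.any? (λ t → (pos t Fin.≟ v) ×-dec C? t f) M

  Excl : Fin n → Vec (Col r) n → Col r → Set
  Excl v f c = Any (λ t → (pos t ≡ v × C t f) × c ≡ χ t) M

  Excl? : ∀ v f c → Dec (Excl v f c)
  Excl? v f c = Any.any? (λ t → ((pos t Fin.≟ v) ×-dec C? t f) ×-dec (c Fin.≟ χ t)) M

  private
    pos∈ : ∀ {v} (M : List (Mixed A p)) → Any (λ t → pos t ≡ v) M → v ∈L vertices M
    pos∈ (t ∷ M) (there a) = there (there (there (pos∈ M a)))
    pos∈ (t ∷ M) (here refl) with pos-vertex t
    ... | inj₁ e        = here e
    ... | inj₂ (inj₁ e) = there (here e)
    ... | inj₂ (inj₂ e) = there (there (here e))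

    pos∉ : ∀ t (M : List (Mixed A p)) → ¬ i t ∈L vertices M × ¬ j t ∈L vertices M × ¬ k t ∈L vertices M → ¬ pos t ∈L vertices M
    pos∉ t M (¬i , ¬j , ¬k) h with pos-vertex t
    ... | inj₁ e        = ¬i (subst (_∈L vertices M) e h)
    ... | inj₂ (inj₁ e) = ¬j (subst (_∈L vertices M) e h)
    ... | inj₂ (inj₂ e) = ¬k (subst (_∈L vertices M) e h)

    count : ∀ f (M : List (Mixed A p)) → Matching M → length (List.filter (λ t → C? t f) M) ≤
            # (λ v → Any.any? (λ t → (pos t Fin.≟ v) ×-dec C? t f) M)
    count f []      _ = z≤n
    count f (t ∷ M) (fresh , mat) = by (C? t f)
      where
      Some? : ∀ M v → Dec (Any (λ t → pos t ≡ v × C t f) M)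
      Some? M v = Any.any? (λ t → (pos t Fin.≟ v) ×-dec C? t f) M
      by : Dec (C t f) → length (List.filter (λ t → C? t f) (t ∷ M)) ≤ # (Some? (t ∷ M))
      by (no ¬c) = ≤-trans (≤-reflexive (cong length (filter-reject (λ t → C? t f) {xs = M} ¬c)))
        (≤-trans (count f M mat) (#-mono (Some? M) (Some? (t ∷ M)) λ _ → there))
      by (yes c) = ≤-trans (≤-reflexive (cong length (filter-accept (λ t → C? t f) {xs = M} c)))
        (≤-trans (+-mono-≤ (#-positive (λ v → pos t Fin.≟ v) (pos t) refl) (count f M mat))
        (#-disjoint (Some? (t ∷ M)) (λ v → pos t Fin.≟ v) (Some? M)
          (λ { _ refl → here (refl , c) }) (λ _ → there)
          (λ { _ refl a → pos∉ t M fresh (pos∈ M (Any.map proj₁ a)) })))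

    forcing : ∀ v f → Cond v f → v ∈ A × ∃ λ a → ∃ λ b → type p v ≡ just (a , b) ×
                (known q v ≡ zero → Excl v f a ⊎ Excl v f b)
    forcing v f cond = at (Any⇒∃ cond)
      where
      Any⇒∃ : ∀ {P : Mixed A p → Set} {M} → Any P M → ∃ λ t → P t × (∀ {Q : Mixed A p → Set} → Q t → Any Q M)
      Any⇒∃ (here x)  = _ , x , here
      Any⇒∃ (there a) = let (t , x , inj) = Any⇒∃ a in t , x , λ y → there (inj y)
      at : (∃ λ t → (pos t ≡ v × C t f) × (∀ {Q : Mixed A p → Set} → Q t → Any Q M)) → _
      at (t , (refl , c) , inj) with χ∈ t
      ... | a , b , e , inj₁ x = pos∈A t , a , b , e , λ _ → inj₁ (inj ((refl , c) , sym x))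
      ... | a , b , e , inj₂ x = pos∈A t , a , b , e , λ _ → inj₂ (inj ((refl , c) , sym x))

    cond-local : ∀ v f g → AgreeAbove v f g → Cond v f → Cond v g
    cond-local v f g agree = Any.map λ { {t} (refl , c) → refl , C-local t f g agree c }

    excl-local : ∀ v f g → AgreeAbove v f g → ∀ c → Excl v f c → Excl v g c
    excl-local v f g agree c = Any.map λ { {t} ((refl , x) , e) → (refl , C-local t f g agree x) , e }

  Avoids : Vec (Col r) n → Set
  Avoids f = ∀ t → t ∈′ M → C t f → known q (pos t) ≡ zero → lookup f (pos t) ≢ χ t

  forced-bound : ∀ F N → 2 ^ ∣ A ∣ * r ^ # (Untyped? p A) ≤ N * 2 ^ F →
    Bounded (colors r) (λ f → Good {r} A f × Agree p f × Agree q f × Avoids f ×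
                              F ≤ length (List.filter (λ t → C? t f) M)) N
  forced-bound F N budget = Bounded-mono
    (λ f (good , ag , ag′ , av , le) → good , ag , ag′ , respects f av M id , ≤-trans le (count f M mat)) ≤-refl
    (TypedScheme.typed-scheme 1≤r A p q Cond? Excl? cond-local excl-local forcing F N budget)
    where
    respects : ∀ f → Avoids f → ∀ M′ → (∀ {t} → t ∈′ M′ → t ∈′ M) → ∀ v → known q v ≡ zero → Cond v f →
               ¬ Any (λ t → (pos t ≡ v × C t f) × lookup f v ≡ χ t) M′
    respects f av (t ∷ M′) sub v un cond (here ((refl , c) , e)) = av t (sub (here refl)) c un e
    respects f av (t ∷ M′) sub v un cond (there a) = respects f av M′ (sub ∘ there) v un cond a

-- Bounds the logarithm of the number of colorings compatible with p, since r ≤ 2 ^ r.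
capacity : Subset n → Partial r n → ℕ
capacity {r = r} A p = ∣ A ∣ + r * # (Untyped? p A)

spend : ∀ (A : Subset n) (p : Partial r n) F → 2 ^ ∣ A ∣ * r ^ # (Untyped? p A) ≤ 2 ^ (capacity A p ∸ F) * 2 ^ F
spend {r = r} A p F = begin
  2 ^ ∣ A ∣ * r ^ # (Untyped? p A)       ≤⟨ *-monoʳ-≤ (2 ^ ∣ A ∣) (r^≤2^ r (# (Untyped? p A))) ⟩
  2 ^ ∣ A ∣ * 2 ^ (r * # (Untyped? p A)) ≡⟨ ^-distribˡ-+-* 2 ∣ A ∣ _ ⟨
  2 ^ capacity A p                       ≤⟨ ^-monoʳ-≤ 2 (m≤n+m∸n (capacity A p) F) ⟩
  2 ^ (F + (capacity A p ∸ F))           ≡⟨ cong (2 ^_) (+-comm F _) ⟩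
  2 ^ (capacity A p ∸ F + F)             ≡⟨ ^-distribˡ-+-* 2 (capacity A p ∸ F) F ⟩
  2 ^ (capacity A p ∸ F) * 2 ^ F ∎
  where open ≤-Reasoning

-- The rainbow choice (α, β, γ) is tested in the order k, j, i. If at least n / c₁ progressions take
-- γ and β, then i avoids α in each of them. Otherwise these few are recorded, and if at least n /
-- c₂ take γ, then j avoids β in them unless recorded. Otherwise those that take γ are recorded and
-- k avoids γ elsewhere. Recorded positions have no choice left, so they count as saved too. Each h
-- is 6 times the divisor of the saving that it serves, so a description of 3 n / h bits costs half
-- of that saving.
module MixedCase (r ν : ℕ) (1≤r : 1 ≤ r) (1≤ν : 1 ≤ ν) where

  h₁ : ℕ
  h₁ = 6 * ν
  module S₁ = Sparse (allMarks r) h₁ (1≤allMarks r) (1≤* {6} (s≤s z≤n) 1≤ν)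
  c₂ : ℕ
  c₂ = S₁.gap
  h₂ : ℕ
  h₂ = 6 * c₂
  module S₂ = Sparse (allMarks r) h₂ (1≤allMarks r) (1≤* {6} (s≤s z≤n) S₁.1≤gap)
  c₁ : ℕ
  c₁ = S₂.gap

  instance
    c₁≢0 : NonZero c₁
    c₁≢0 = >-nonZero S₂.1≤gap
    c₂≢0 : NonZero c₂
    c₂≢0 = >-nonZero S₁.1≤gap

  module _ (A : Subset n) (p : Partial r n) (M : List (Mixed A p)) (mat : Matching M) where

    open Mixed

    private
      K₀ K₁ : Mixed A p → Vec (Col r) n → Set
      K₀ t f = lookup f (k t) ≡ γ t
      K₁ t f = lookup f (k t) ≡ γ t × lookup f (j t) ≡ β t

      K₀? : ∀ t f → Dec (K₀ t f)
      K₀? t f = lookup f (k t) Fin.≟ γ t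
      K₁? : ∀ t f → Dec (K₁ t f)
      K₁? t f = (lookup f (k t) Fin.≟ γ t) ×-dec (lookup f (j t) Fin.≟ β t)

      K₀-local : ∀ t f g → AgreeAbove (j t) f g → K₀ t f → K₀ t g
      K₀-local t f g ag e = trans (sym (ag (k t) (j<k t))) e
      K₁-local : ∀ t f g → AgreeAbove (i t) f g → K₁ t f → K₁ t g
      K₁-local t f g ag (e , e′) = trans (sym (ag (k t) (<-trans (i<j t) (j<k t)))) e , trans (sym (ag (j t) (i<j t))) e′

      module Last (q : Partial r n) = Forcing 1≤r A p q M mat k γ (λ _ → inj₂ (inj₂ refl)) k∈A γ∈
        {λ _ _ → ⊤} (λ _ _ → yes tt) (λ _ _ _ _ → id)
      module Middle (q : Partial r n) = Forcing 1≤r A p q M mat j β (λ _ → inj₂ (inj₁ refl)) j∈A β∈ K₀? K₀-local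
      module First = Forcing 1≤r A p p M mat i α (λ _ → inj₁ refl) i∈A α∈ K₁? K₁-local

      exceptions : ∀ (pos : Mixed A p → Fin n) {K : Mixed A p → Set} (K? : ∀ t → Dec (K t)) (f : Vec (Col r) n) → Good A f →
        ∃ λ (q : Partial r n) → # (Marked? q) ≤ length (List.filter K? M) × Agree q f ×
          (∀ t → t ∈′ M → pos t ∈ A → known q (pos t) ≡ zero → ¬ K t)
      exceptions pos K? f good = q , ≤-trans (restrict-size In? _) (≤-trans (#-list In? xs λ _ → id)
          (≤-reflexive (length-map pos (List.filter K? M)))) ,
        agree-restrict In? (λ _ → false) f ,
        λ t t∈M pos∈ un kt → unknown-restrict In? (λ _ → false) f (pos t) (Good.present good (pos t) pos∈) un
          (∈-map⁺ pos (∈-filter⁺ K? t∈M kt))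
        where
        xs = List.map pos (List.filter K? M)
        In? : ∀ v → Dec (v ∈L xs)
        In? v = v ∈L? xs
        q : Partial r n
        q = restrict In? λ v → false , lookup f v

      small : ∀ c .{{_ : NonZero c}} {x y} → x ≤ y → ¬ (n / c ≤ y) → x * c ≤ n
      small c x≤y ¬le = ≤-trans (*-monoˡ-≤ c (≤-trans x≤y (<⇒≤ (≰⇒> ¬le)))) (m/n*n≤m n c)

      ⊤? : (t : Mixed A p) → Dec ⊤
      ⊤? _ = yes tt

      Class₁ Class₂ : Partial r n → Vec (Col r) n → Set
      Class₁ q f = Good A f × Agree p f × Agree q f × Last.Avoids q f × length M ≤ length (List.filter ⊤? M)
      Class₂ q f = Good A f × Agree p f × Agree q f × Middle.Avoids q f × n / c₂ ≤ length (List.filter (λ t → K₀? t f) M)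
      Class₃ : Vec (Col r) n → Set
      Class₃ f = Good A f × Agree p f × Agree p f × First.Avoids f × n / c₁ ≤ length (List.filter (λ t → K₁? t f) M)

      classify : ∀ f → Good A f × Agree p f →
        ((∃ λ q → # (Marked? q) * c₂ ≤ n × Class₁ q f) ⊎ (∃ λ q → # (Marked? q) * c₁ ≤ n × Class₂ q f)) ⊎ Class₃ f
      classify f (good , ag) = by (n / c₁ ≤? length (List.filter (λ t → K₁? t f) M)) (n / c₂ ≤? length (List.filter (λ t → K₀? t f) M))
        where
        by : Dec (n / c₁ ≤ length (List.filter (λ t → K₁? t f) M)) → Dec (n / c₂ ≤ length (List.filter (λ t → K₀? t f) M)) → _
        -- This level needs no exceptions: f i = α would make the progression rainbow.
        by (yes le) _ = inj₂ (good , ag , ag ,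
          (λ t _ (ek , ej) _ ei → Good.free good (ap t) (i∈A t) (j∈A t) (k∈A t)
            (subst₂ (λ x y → Rainbow x y (lookup f (k t))) (sym ei) (sym ej)
              (subst (Rainbow (α t) (β t)) (sym ek) (distinct t)))) , le)
        by (no ¬le) (yes le) =
          let (q , size , ag′ , ex) = exceptions j (λ t → K₁? t f) f good
          in inj₁ (inj₂ (q , small c₁ size ¬le , good , ag , ag′ , (λ t t∈ e un e′ → ex t t∈ (j∈A t) un (e , e′)) , le))
        by (no _) (no ¬le) =
          let (q , size , ag′ , ex) = exceptions k (λ t → K₀? t f) f good
          in inj₁ (inj₁ (q , small c₂ size ¬le , good , ag , ag′ , (λ t t∈ _ un e → ex t t∈ (k∈A t) un e) ,
               ≤-reflexive (cong length (sym (filter-all ⊤? (universal M))))))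
          where
          universal : ∀ (M : List (Mixed A p)) → All (λ _ → ⊤) M
          universal []      = []
          universal (t ∷ M) = tt ∷ universal M

    mixed-case : h₁ ≤ n → h₂ ≤ n → ∃ λ e₁ → ∃ λ e₂ → e₁ * h₁ ≤ 3 * n × e₂ * h₂ ≤ 3 * n ×
      Bounded (colors r) (λ f → Good {r} A f × Agree p f)
        (2 ^ e₁ * 2 ^ (capacity A p ∸ length M) + 2 ^ e₂ * 2 ^ (capacity A p ∸ n / c₂) + 2 ^ (capacity A p ∸ n / c₁))
    mixed-case h₁≤n h₂≤n =
      let (e₁ , le₁ , count₁) = S₁.sparse-count n h₁≤n
          (e₂ , le₂ , count₂) = S₂.sparse-count n h₂≤n
      in e₁ , e₂ , le₁ , le₂ , Bounded-mono classify ≤-refl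
        (Bounded-⊎ (Bounded-⊎
          (Bounded-∃ (∈-marks ∈-allMarks) S₁.SparseMarks? {Class₁} (λ q _ → Last.forced-bound q (length M) _ (spend A p (length M))) count₁)
          (Bounded-∃ (∈-marks ∈-allMarks) S₂.SparseMarks? {Class₂} (λ q _ → Middle.forced-bound q (n / c₂) _ (spend A p (n / c₂))) count₂))
          (First.forced-bound (n / c₁) _ (spend A p (n / c₁))))

-- A single type

-- Supplies a progression of difference 1, which connects the two parities in `Connected`.
consecutive : {X : Fin n → Set} (X? : ∀ v → Dec (X v)) → # (¬? ∘ X?) * 16 ≤ n → 9 ≤ n →
              ∃ λ i → ∃ λ j → ∃ λ k → X i × X j × X k × Mid i j k × i ≢ k × toℕ j ≡ suc (toℕ i)
consecutive {suc zero} X? dense (s≤s ())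
consecutive {suc (suc n)} {X} X? dense n≥ =
  let (d , x₀ , x₁ , x₂) = #-inhabited Fine? enough
  in at₀ d , at₁ d , at₂ d , x₀ , x₁ , x₂ , mid d , (λ e → <⇒≢ (m<n+m (toℕ d) {2} (s≤s z≤n)) (trans (sym (toℕ₀ d)) (cong toℕ e))) ,
     trans (toℕ₁ d) (cong suc (sym (toℕ₀ d)))
  where
  c = # (¬? ∘ X?)
  at₀ at₁ at₂ : Fin n → Fin (2 + n)
  at₀ d = Fin.inject₁ (Fin.inject₁ d)
  at₁ d = Fin.inject₁ (suc d)
  at₂ d = suc (suc d)
  toℕ₀ : ∀ d → toℕ (at₀ d) ≡ toℕ d
  toℕ₀ d = trans (Fin.toℕ-inject₁ _) (Fin.toℕ-inject₁ d)
  toℕ₁ : ∀ d → toℕ (at₁ d) ≡ suc (toℕ d)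
  toℕ₁ d = Fin.toℕ-inject₁ (suc d)
  mid : ∀ d → Mid (at₀ d) (at₁ d) (at₂ d)
  mid d = trans (cong (_+ (2 + toℕ d)) (toℕ₀ d)) (trans (eq (toℕ d)) (cong (2 *_) (sym (toℕ₁ d))))
    where
    eq : ∀ x → x + (2 + x) ≡ 2 * (1 + x)
    eq = solve-∀
  Fine? : ∀ d → Dec (X (at₀ d) × X (at₁ d) × X (at₂ d))
  Fine? d = X? (at₀ d) ×-dec X? (at₁ d) ×-dec X? (at₂ d)
  out₀ : # (λ d → ¬? (X? (at₀ d))) ≤ c
  out₀ = #-inject-fun (λ d → ¬? (X? (at₀ d))) (¬? ∘ X?) at₀ (λ _ → id) λ d d′ e → Fin.inject₁-injective (Fin.inject₁-injective e)
  out₁ : # (λ d → ¬? (X? (at₁ d))) ≤ c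
  out₁ = #-inject-fun (λ d → ¬? (X? (at₁ d))) (¬? ∘ X?) at₁ (λ _ → id) λ d d′ e → Fin.suc-injective (Fin.inject₁-injective e)
  out₂ : # (λ d → ¬? (X? (at₂ d))) ≤ c
  out₂ = #-inject-fun (λ d → ¬? (X? (at₂ d))) (¬? ∘ X?) at₂ (λ _ → id) λ d d′ e → Fin.suc-injective (Fin.suc-injective e)
  Out? : ∀ d → Dec (¬ X (at₀ d) ⊎ ¬ X (at₁ d) ⊎ ¬ X (at₂ d))
  Out? d = ¬? (X? (at₀ d)) ⊎-dec ¬? (X? (at₁ d)) ⊎-dec ¬? (X? (at₂ d))
  out≤ : # Out? ≤ c + (c + c)
  out≤ = ≤-trans (#-⊎ Out? (λ d → ¬? (X? (at₀ d))) (λ d → ¬? (X? (at₁ d)) ⊎-dec ¬? (X? (at₂ d))) λ _ → id)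
    (+-mono-≤ out₀ (≤-trans (#-⊎ (λ d → ¬? (X? (at₁ d)) ⊎-dec ¬? (X? (at₂ d))) (λ d → ¬? (X? (at₁ d))) (λ d → ¬? (X? (at₂ d))) λ _ → id)
      (+-mono-≤ out₁ out₂)))
  split : ∀ d → ⊤ → (X (at₀ d) × X (at₁ d) × X (at₂ d)) ⊎ (¬ X (at₀ d) ⊎ ¬ X (at₁ d) ⊎ ¬ X (at₂ d))
  split d _ with X? (at₀ d) | X? (at₁ d) | X? (at₂ d)
  ... | no x  | _     | _     = inj₂ (inj₁ x)
  ... | yes _ | no x  | _     = inj₂ (inj₂ (inj₁ x))
  ... | yes _ | yes _ | no x  = inj₂ (inj₂ (inj₂ x))
  ... | yes x | yes y | yes z = inj₁ (x , y , z)
  enough : 0 < # Fine?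
  enough = ≰⇒> λ none → <-irrefl refl (begin-strict
    -- Without such a run n ≤ 3 c, and 16 c ≤ n + 2, so 13 (n + 2) ≤ 32. But n + 2, the size of the
    -- ground set, is at least 9.
    32               <⟨ +-monoʳ-≤ 33 (z≤n {84}) ⟩
    117              ≤⟨ *-monoʳ-≤ 13 n≥ ⟩
    13 * (2 + n)     ≤⟨ farkas 0 ((16 ⊗ (≤-trans (≤-reflexive (sym (#-all {n})))
                          (≤-trans (#-⊎ {n} (λ _ → yes tt) Fine? Out? split) (+-mono-≤ none out≤)))) ⊕ (3 ⊗ dense)) (eq n c) ⟩
    32 ∎)
    where
    open ≤-Reasoning
    eq : ∀ n c → 13 * (2 + n) + (16 * (0 + (c + (c + c))) + 3 * (2 + n)) + 0 ≡ 32 + (16 * n + 3 * (c * 16))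
    eq = solve-∀

module Connected {n : ℕ} {X : Fin n → Set} (X? : ∀ v → Dec (X v)) (dense : # (¬? ∘ X?) * 16 ≤ n) (n≥ : 9 ≤ n)
  {T : Set} (τ : Fin n → T)
  (same : ∀ x y z → X x → X y → X z → Mid x y z → x ≢ z → τ x ≡ τ y × τ y ≡ τ z) where

  private
    c = # (¬? ∘ X?)

    MidOut? : ∀ x z → Dec (∃ λ w → ¬ X w × Mid x w z)
    MidOut? x z = Fin.any? λ w → ¬? (X? w) ×-dec (_ ≟ _)

    midOut≤ : ∀ x → # (MidOut? x) ≤ c
    midOut≤ x = #-inject (MidOut? x) (¬? ∘ X?) (λ z w → (toℕ x + toℕ z) ≟ (2 * toℕ w)) (λ _ → id)
      λ w z z′ e e′ → toℕ-cancel (toℕ x) (trans (+-comm (toℕ z) (toℕ x)) (trans e (trans (sym e′) (+-comm (toℕ x) (toℕ z′)))))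

    mid-in : ∀ {x z} → ¬ (∃ λ w → ¬ X w × Mid x w z) → par x ≡ par z → ∃ λ w → X w × Mid x w z
    mid-in {x} {z} none e with midpoint x z e
    ... | w , m = w , decidable-stable (X? w) (λ ¬x → none (w , ¬x , m)) , m

    Bad? : ∀ x y z → Dec (((z ≡ x ⊎ z ≡ y) ⊎ ¬ X z) ⊎ ((∃ λ w → ¬ X w × Mid x w z) ⊎ (∃ λ w → ¬ X w × Mid y w z)))
    Bad? x y z = (((z Fin.≟ x) ⊎-dec (z Fin.≟ y)) ⊎-dec ¬? (X? z)) ⊎-dec (MidOut? x z ⊎-dec MidOut? y z)

    Bad : Fin n → Fin n → Fin n → Set
    Bad x y z = ((z ≡ x ⊎ z ≡ y) ⊎ ¬ X z) ⊎ ((∃ λ w → ¬ X w × Mid x w z) ⊎ (∃ λ w → ¬ X w × Mid y w z))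

    bad≤ : ∀ x y → # (Bad? x y) ≤ 2 + c + (c + c)
    bad≤ x y = ≤-trans
      (#-⊎ (Bad? x y) (λ z → ((z Fin.≟ x) ⊎-dec (z Fin.≟ y)) ⊎-dec ¬? (X? z)) (λ z → MidOut? x z ⊎-dec MidOut? y z) λ _ → id)
      (+-mono-≤
        (≤-trans (#-⊎ (λ z → ((z Fin.≟ x) ⊎-dec (z Fin.≟ y)) ⊎-dec ¬? (X? z)) (λ z → (z Fin.≟ x) ⊎-dec (z Fin.≟ y)) (¬? ∘ X?) λ _ → id)
          (+-monoˡ-≤ c (#-two (λ z → (z Fin.≟ x) ⊎-dec (z Fin.≟ y)) x y λ _ → id)))
        (≤-trans (#-⊎ (λ z → MidOut? x z ⊎-dec MidOut? y z) (MidOut? x) (MidOut? y) λ _ → id) (+-mono-≤ (midOut≤ x) (midOut≤ y))))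

    -- Two elements of the same parity have a common neighbor.
    joint : ∀ {x y} → X x → X y → par x ≡ par y → τ x ≡ τ y
    joint {x} {y} xx xy e = connect (#-inhabited Fine? enough)
      where
      Fine? : ∀ z → Dec (par z ≡ par x × ¬ Bad x y z)
      Fine? z = par? (par x) z ×-dec ¬? (Bad? x y z)
      enough : 0 < # Fine?
      enough = ≰⇒> λ none → <-irrefl refl (begin-strict
        -- At least (n - 1) / 2 elements have the parity of x, at most 2 + 3 c are bad, and 16 c ≤
        -- n. Without a common neighbor this gives 10 n ≤ 80, against n ≥ 9.
        80              <⟨ +-monoʳ-≤ 81 (z≤n {9}) ⟩
        90              ≤⟨ *-monoʳ-≤ 10 n≥ ⟩
        10 * n          ≤⟨ farkas 0 ((16 ⊗ #-parity-≥ n (par x)) ⊕ (32 ⊗ ≤-trans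
                             (#-⊎ (par? (par x)) Fine? (Bad? x y) split) (+-mono-≤ none (bad≤ x y))) ⊕ (6 ⊗ dense))
                             (eq n c (# {n} (par? (par x)))) ⟩
        80 ∎)
        where
        open ≤-Reasoning
        eq : ∀ n c k → 10 * n + (16 * (1 + 2 * k) + (32 * (0 + (2 + c + (c + c))) + 6 * n)) + 0 ≡ 80 + (16 * n + (32 * k + 6 * (c * 16)))
        eq = solve-∀
        split : ∀ z → par z ≡ par x → (par z ≡ par x × ¬ Bad x y z) ⊎ Bad x y z
        split z h with Bad? x y z
        ... | yes b = inj₂ b
        ... | no ¬b = inj₁ (h , ¬b)
      connect : (∃ λ z → par z ≡ par x × ¬ Bad x y z) → τ x ≡ τ y
      connect (z , pz , ¬b) =
        let xz = decidable-stable (X? z) (λ ¬x → ¬b (inj₁ (inj₂ ¬x)))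
            (w , xw , m) = mid-in {x} {z} (λ h → ¬b (inj₂ (inj₁ h))) (sym pz)
            (w′ , xw′ , m′) = mid-in {y} {z} (λ h → ¬b (inj₂ (inj₂ h))) (trans (sym e) (sym pz))
            (e₁ , e₂) = same x w z xx xw xz m (λ h → ¬b (inj₁ (inj₁ (inj₁ (sym h)))))
            (e₃ , e₄) = same y w′ z xy xw′ xz m′ (λ h → ¬b (inj₁ (inj₁ (inj₂ (sym h)))))
        in trans e₁ (trans e₂ (sym (trans e₃ e₄)))

  -- `joint` works within one parity; the consecutive terms i and j carry the value over to the
  -- other.
  constant : ∃ λ i → X i × ∀ x → X x → τ x ≡ τ i
  constant with consecutive X? dense n≥
  ... | i , j , k , xi , xj , xk , m , i≢k , j≡ = i , xi , λ x xx → by x xx (either (toℕ i) (toℕ x))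
    where
    either : ∀ a b → parity b ≡ parity a ⊎ parity b ≡ parity (suc a)
    either zero          zero          = inj₁ refl
    either zero          (suc zero)    = inj₂ refl
    either (suc zero)    zero          = inj₂ refl
    either (suc zero)    (suc zero)    = inj₁ refl
    either (suc (suc a)) b             = either a b
    either zero          (suc (suc b)) = either zero b
    either (suc zero)    (suc (suc b)) = either (suc zero) b
    by : ∀ x → X x → par x ≡ par i ⊎ par x ≡ parity (suc (toℕ i)) → τ x ≡ τ i
    by x xx (inj₁ e) = joint xx xi e
    by x xx (inj₂ e) = trans (joint xx xj (trans e (cong parity (sym j≡)))) (sym (proj₁ (same i j k xi xj xk m i≢k)))

module SameType {r n} (1≤r : 1 ≤ r) (A : Subset n) (p : Partial r n) (a b : Col r)
  {X : Fin n → Set} (X? : ∀ v → Dec (X v)) (of-type : ∀ v → X v → v ∈ A × type p v ≡ just (a , b))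
  (dense : # (¬? ∘ X?) * 16 ≤ n) where

  private
    c = # (¬? ∘ X?)

  module _ (x : Fin n) where

    -- Since v < w, the color of w is fixed before v is chosen; if x has a third color, v has to
    -- repeat it.
    Partner? : ∀ v → Dec (∃ λ w → v Fin.< w × AP3 x v w × X w)
    Partner? v = Fin.any? λ w → (v Fin.<? w) ×-dec AP3? x v w ×-dec X? w

    Determined? : ∀ v → Dec (X v × ∃ λ w → v Fin.< w × AP3 x v w × X w)
    Determined? v = X? v ×-dec Partner? v

    -- An element outside X spoils at most one pair as `v d` and one as `w d`.
    from-family : ∀ k (v w : Fin k → Fin n) → (∀ d d′ → v d ≡ v d′ → d ≡ d′) → (∀ d d′ → w d ≡ w d′ → d ≡ d′) →
                  (∀ d → v d Fin.< w d) → (∀ d → AP3 x (v d) (w d)) → k ≤ # Determined? + (c + c)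
    from-family k v w v-inj w-inj v<w ap = begin
      k                            ≡⟨ #-all {k} ⟨
      # {k} (λ _ → yes tt)         ≤⟨ #-⊎ {k} (λ _ → yes tt) Fine? Out? split ⟩
      # Fine? + # Out?             ≤⟨ +-mono-≤
          (#-inject-fun Fine? Determined? v (λ d (xv , xw) → xv , w d , v<w d , ap d , xw) v-inj)
          (≤-trans (#-⊎ Out? (λ d → ¬? (X? (v d))) (λ d → ¬? (X? (w d))) λ _ → id)
            (+-mono-≤ (#-inject-fun (λ d → ¬? (X? (v d))) (¬? ∘ X?) v (λ _ → id) v-inj)
                      (#-inject-fun (λ d → ¬? (X? (w d))) (¬? ∘ X?) w (λ _ → id) w-inj))) ⟩
      # Determined? + (c + c) ∎
      where
      open ≤-Reasoning
      Fine? : ∀ d → Dec (X (v d) × X (w d))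
      Fine? d = X? (v d) ×-dec X? (w d)
      Out? : ∀ d → Dec (¬ X (v d) ⊎ ¬ X (w d))
      Out? d = ¬? (X? (v d)) ⊎-dec ¬? (X? (w d))
      split : ∀ d → ⊤ → (X (v d) × X (w d)) ⊎ (¬ X (v d) ⊎ ¬ X (w d))
      split d _ with X? (v d) | X? (w d)
      ... | no ¬v | _     = inj₂ (inj₁ ¬v)
      ... | yes _ | no ¬w = inj₂ (inj₂ ¬w)
      ... | yes v | yes w = inj₁ (v , w)

    private
      k : ℕ
      k = n / 4
      4k≤n : 4 * k ≤ n
      4k≤n = ≤-trans (≤-reflexive (*-comm 4 k)) (m/n*n≤m n 4)
      step : Fin k → ℕ
      step d = suc (toℕ d)
      4step≤n : ∀ d → 4 * step d ≤ n
      4step≤n d = ≤-trans (*-monoʳ-≤ 4 (Fin.toℕ<n d)) 4k≤n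

      lower : 2 * toℕ x < n → k ≤ # Determined? + (c + c)
      lower 2x<n = from-family k v w
        (λ d d′ e → step-inj (+-cancelˡ-≡ (toℕ x) _ _ (trans (sym (v≡ d)) (trans (cong toℕ e) (v≡ d′)))))
        (λ d d′ e → step-inj (*-cancelˡ-≡ _ _ 2 (+-cancelˡ-≡ (toℕ x) _ _ (trans (sym (w≡ d)) (trans (cong toℕ e) (w≡ d′))))))
        v<w ap
        where
        step-inj : ∀ {d d′} → step d ≡ step d′ → d ≡ d′
        step-inj e = Fin.toℕ-injective (suc-injective e)
        w<n : ∀ d → toℕ x + 2 * step d < n
        w<n d = *-cancelˡ-< 2 _ _ (farkas 0 (2x<n ⊕ 4step≤n d) (eq (toℕ x) (step d) n))
          where
          eq : ∀ x s n → 1 + 2 * (x + 2 * s) + (n + n) + 0 ≡ 2 * n + (1 + 2 * x + 4 * s)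
          eq = solve-∀
        v<n : ∀ d → toℕ x + step d < n
        v<n d = ≤-<-trans (+-monoʳ-≤ (toℕ x) (m≤n*m (step d) 2)) (w<n d)
        v w : Fin k → Fin n
        v d = fromℕ< (v<n d)
        w d = fromℕ< (w<n d)
        v≡ : ∀ d → toℕ (v d) ≡ toℕ x + step d
        v≡ d = Fin.toℕ-fromℕ< (v<n d)
        w≡ : ∀ d → toℕ (w d) ≡ toℕ x + 2 * step d
        w≡ d = Fin.toℕ-fromℕ< (w<n d)
        v<w : ∀ d → v d Fin.< w d
        v<w d = subst₂ _<_ (sym (v≡ d)) (sym (w≡ d)) (+-monoʳ-< (toℕ x) (m<m+n (step d) (s≤s z≤n)))
        ap : ∀ d → AP3 x (v d) (w d)
        ap d = Mid⇒AP3 (λ e → <⇒≢ (m<m+n (toℕ x) {2 * step d} (s≤s z≤n)) (trans (cong toℕ e) (w≡ d)))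
          (trans (cong (toℕ x +_) (w≡ d)) (trans (eq (toℕ x) (step d)) (cong (2 *_) (sym (v≡ d)))))
          where
          eq : ∀ x s → x + (x + 2 * s) ≡ 2 * (x + s)
          eq = solve-∀

      -- Downwards the roles change: v = x - 2 d is the far term and w = x - d the near one, so that
      -- again v < w.
      upper : n ≤ 2 * toℕ x → k ≤ # Determined? + (c + c)
      upper n≤2x = from-family k v w
        (λ d d′ e → step-inj (*-cancelˡ-≡ _ _ 2 (+-cancelˡ-≡ (toℕ (v d)) _ _ (trans (v≡ d) (trans (sym (v≡ d′)) (cong (λ z → toℕ z + 2 * step d′) (sym e)))))))
        (λ d d′ e → step-inj (+-cancelˡ-≡ (toℕ (w d)) _ _ (trans (w≡ d) (trans (sym (w≡ d′)) (cong (λ z → toℕ z + step d′) (sym e))))))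
        v<w ap
        where
        step-inj : ∀ {d d′} → step d ≡ step d′ → d ≡ d′
        step-inj e = Fin.toℕ-injective (suc-injective e)
        2step≤x : ∀ d → 2 * step d ≤ toℕ x
        2step≤x d = *-cancelˡ-≤ 2 (≤-trans (≤-reflexive (sym (*-assoc 2 2 (step d)))) (≤-trans (4step≤n d) n≤2x))
        step≤x : ∀ d → step d ≤ toℕ x
        step≤x d = ≤-trans (m≤n*m (step d) 2) (2step≤x d)
        v w : Fin k → Fin n
        v d = fromℕ< (≤-<-trans (m∸n≤m (toℕ x) (2 * step d)) (Fin.toℕ<n x))
        w d = fromℕ< (≤-<-trans (m∸n≤m (toℕ x) (step d)) (Fin.toℕ<n x))
        v≡ : ∀ d → toℕ (v d) + 2 * step d ≡ toℕ x
        v≡ d = trans (cong (_+ 2 * step d) (Fin.toℕ-fromℕ< _)) (m∸n+n≡m (2step≤x d))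
        w≡ : ∀ d → toℕ (w d) + step d ≡ toℕ x
        w≡ d = trans (cong (_+ step d) (Fin.toℕ-fromℕ< _)) (m∸n+n≡m (step≤x d))
        vw : ∀ d → toℕ (v d) + step d ≡ toℕ (w d)
        vw d = +-cancelʳ-≡ (step d) _ _ (trans (eq (toℕ (v d)) (step d)) (trans (v≡ d) (sym (w≡ d))))
          where
          eq : ∀ v s → v + s + s ≡ v + 2 * s
          eq = solve-∀
        v<w : ∀ d → v d Fin.< w d
        v<w d = subst (toℕ (v d) <_) (vw d) (m<m+n (toℕ (v d)) (s≤s z≤n))
        ap : ∀ d → AP3 x (v d) (w d)
        ap d = AP3-swap₂₃ (Mid⇒AP3 (λ e → <⇒≢ (m<m+n (toℕ (v d)) {2 * step d} (s≤s z≤n)) (trans (cong toℕ (sym e)) (sym (v≡ d))))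
          (trans (cong (_+ toℕ (v d)) (sym (w≡ d))) (trans (eq (toℕ (w d)) (step d) (toℕ (v d)))
            (trans (cong (toℕ (w d) +_) (vw d)) (cong (toℕ (w d) +_) (sym (+-identityʳ _)))))))
          where
          eq : ∀ w s v → w + s + v ≡ w + (v + s)
          eq = solve-∀

    -- In the roomier direction from x, the differences up to n / 4 give n / 4 pairs, of which at
    -- most 2 c ≤ n / 8 are spoiled.
    many-determined : n / 8 ≤ # Determined?
    many-determined = +-cancelʳ-≤ (c + c) _ _ (≤-trans (≤-trans bound quarter) (by (n ≤? 2 * toℕ x)))
      where
      by : Dec (n ≤ 2 * toℕ x) → k ≤ # Determined? + (c + c)
      by (yes le) = upper le
      by (no ¬le) = lower (≰⇒> ¬le)
      bound : n / 8 + (c + c) ≤ n / 8 + n / 8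
      bound = +-monoʳ-≤ (n / 8) (≤-trans (≤-reflexive (sym (m*n/n≡m (c + c) 8))) (/-monoˡ-≤ 8 (≤-trans (≤-reflexive (eq c)) dense)))
        where
        eq : ∀ c → (c + c) * 8 ≡ c * 16
        eq = solve-∀
      quarter : n / 8 + n / 8 ≤ k
      quarter = ≤-trans (≤-reflexive (sym (m*n/n≡m (n / 8 + n / 8) 4))) (/-monoˡ-≤ 4 (≤-trans (≤-reflexive (eq (n / 8))) (m/n*n≤m n 8)))
        where
        eq : ∀ a → (a + a) * 4 ≡ a * 8
        eq = solve-∀

  ThirdColor : Vec (Col r) n → Fin n → Set
  ThirdColor f x = x ∈ A × lookup f x ≢ a × lookup f x ≢ b

  private
    color∈ : ∀ {f} → Good A f → Agree p f → ∀ {v} → X v → lookup f v ≡ a ⊎ lookup f v ≡ b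
    color∈ good ag {v} xv = let (v∈A , ty) = of-type v xv in typed-color {p = p} good ag v∈A ty

    a≢b : ∀ v → X v → a ≢ b
    a≢b v xv = <ᶠ⇒≢ (type-< p v (proj₂ (of-type v xv)))

  -- Once x has a third color, each progression x, v, w forces v and w to have the same color.
  third-color-bound : Bounded (colors r) (λ f → ∃ λ x → Good {r} A f × Agree p f × ThirdColor f x)
                              (n * 2 ^ (capacity A p ∸ n / 8))
  third-color-bound = Bounded-∃Fin λ x → Bounded-mono
    (λ f (good , ag , x∈A , x≢a , x≢b) → good , ag , ag , (λ v _ (xv , _) (w , v<w , ap , xw , ne) →
        ne (decidable-stable (lookup f v Fin.≟ lookup f w) λ vw →
          Good.free good ap x∈A (proj₁ (of-type v xv)) (proj₁ (of-type w xw))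
            (differs good ag x≢a x≢b xv , differs good ag x≢a x≢b xw , vw))) , many-determined x) ≤-refl
    (TypedScheme.typed-scheme 1≤r A p p {λ v _ → X v × ∃ λ w → v Fin.< w × AP3 x v w × X w} (λ v _ → Determined? x v)
      -- The color of x is not mentioned, so the exclusion is decided above v even when x lies below
      -- v; x itself is guessed, at the cost of a factor n.
      {λ v f c → ∃ λ w → v Fin.< w × AP3 x v w × X w × c ≢ lookup f w}
      (λ v f c → Fin.any? λ w → (v Fin.<? w) ×-dec AP3? x v w ×-dec X? w ×-dec ¬? (c Fin.≟ lookup f w))
      (λ _ _ _ _ → id)
      (λ { v f g agree c (w , v<w , ap , xw , ne) → w , v<w , ap , xw , λ e → ne (trans e (sym (agree w v<w))) })
      (λ v f (xv , w , v<w , ap , xw) → proj₁ (of-type v xv) , a , b , proj₂ (of-type v xv) ,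
         λ _ → excluded v f xv (w , v<w , ap , xw) (a Fin.≟ lookup f w))
      (n / 8) _ (spend A p (n / 8)))
    where
    differs : ∀ {f x v} → Good A f → Agree p f → lookup f x ≢ a → lookup f x ≢ b → X v → lookup f x ≢ lookup f v
    differs {f} good ag x≢a x≢b xv e with color∈ {f} good ag xv
    ... | inj₁ va = x≢a (trans e va)
    ... | inj₂ vb = x≢b (trans e vb)
    excluded : ∀ {x} v f → X v → (h : ∃ λ w → v Fin.< w × AP3 x v w × X w) → Dec (a ≡ lookup f (proj₁ h)) →
               (∃ λ w → v Fin.< w × AP3 x v w × X w × a ≢ lookup f w) ⊎ (∃ λ w → v Fin.< w × AP3 x v w × X w × b ≢ lookup f w)
    excluded v f xv (w , v<w , ap , xw) (no ne) = inj₁ (w , v<w , ap , xw , ne)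
    excluded v f xv (w , v<w , ap , xw) (yes e) = inj₂ (w , v<w , ap , xw , λ e′ → a≢b v xv (trans e (sym e′)))

-- Assembling the bounds

-- An exponent e + (a - n / c), with a ≤ n + U, saves 3 n / (4 K) when c divides K properly and e ≤ n / (2 c).
saving : ∀ c κ {K n e a U} .{{_ : NonZero c}} → 4 ≤ κ → c * κ ≡ K → K ≤ n → 2 * c * e ≤ n → 4 * (K * U) ≤ n → a ≤ n + U →
         4 * (K * (e + (a ∸ n / c))) + 3 * n ≤ 4 * (K * n)
saving c κ {K} {n} {e} {a} {U} 4≤κ refl K≤n e≤ U≤ a≤ =
  farkas 0 (((4 * κ) ⊗ core) ⊕ ((2 * κ) ⊗ e≤) ⊕ U≤ ⊕ (4 ⊗ K≤n) ⊕ ((2 * n) ⊗ 4≤κ)) (eq c κ n e y U)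
  where
  y = a ∸ n / c
  n≤ : n ≤ c * (n / c) + c
  n≤ = ≤-trans (≤-reflexive (m≡m%n+[m/n]*n n c)) (≤-trans (+-monoˡ-≤ _ (<⇒≤ (m%n<n n c)))
    (≤-reflexive (trans (+-comm c _) (cong (_+ c) (*-comm (n / c) c)))))
  core : c * y + n ≤ c * (n + U) + c
  core = by (n / c ≤? a)
    where
    eq′ : ∀ c y q → c * (y + q) ≡ c * y + c * q
    eq′ = solve-∀
    by : Dec (n / c ≤ a) → c * y + n ≤ c * (n + U) + c
    by (yes le) = begin
      c * y + n                 ≤⟨ +-monoʳ-≤ (c * y) n≤ ⟩
      c * y + (c * (n / c) + c) ≡⟨ +-assoc (c * y) (c * (n / c)) c ⟨
      c * y + c * (n / c) + c   ≡⟨ cong (_+ c) (trans (sym (eq′ c y (n / c))) (cong (c *_) (m∸n+n≡m le))) ⟩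
      c * a + c                 ≤⟨ +-monoˡ-≤ c (*-monoʳ-≤ c a≤) ⟩
      c * (n + U) + c ∎
      where open ≤-Reasoning
    by (no ¬le) = begin
      c * y + n        ≡⟨ cong (λ z → c * z + n) (m≤n⇒m∸n≡0 (<⇒≤ (≰⇒> ¬le))) ⟩
      c * 0 + n        ≡⟨ cong (_+ n) (*-zeroʳ c) ⟩
      n                ≤⟨ m≤n*m n c ⟩
      c * n            ≤⟨ *-monoʳ-≤ c (m≤m+n n U) ⟩
      c * (n + U)      ≤⟨ m≤m+n _ c ⟩
      c * (n + U) + c ∎
      where open ≤-Reasoning
  eq : ∀ c κ n e y U → 4 * (c * κ * (e + y)) + 3 * n +
         (4 * κ * (c * (n + U) + c) + (2 * κ * n + (n + (4 * n + 2 * n * κ)))) + 0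
       ≡ 4 * (c * κ * n) + (4 * κ * (c * y + n) + (2 * κ * (2 * c * e) + (4 * (c * κ * U) + (4 * (c * κ) + 2 * n * 4))))
  eq = solve-∀

-- Absorbs the factor n for the guess of x; n / 32 + 6 bits are at most half of the saving n / 8
-- once n ≥ 192.
n≤2^ : ∀ n → n ≤ 2 ^ (n / 32 + 6)
n≤2^ n = begin
  n                       ≤⟨ ≤-trans (≤-reflexive (m≡m%n+[m/n]*n n 32)) (+-monoˡ-≤ _ (<⇒≤ (m%n<n n 32))) ⟩
  suc (n / 32) * 32       ≤⟨ *-monoˡ-≤ 32 (<⇒≤ (n<2^n (suc (n / 32)))) ⟩
  2 ^ suc (n / 32) * 2 ^ 5 ≡⟨ ^-distribˡ-+-* 2 (suc (n / 32)) 5 ⟨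
  2 ^ (suc (n / 32) + 5)  ≡⟨ cong (2 ^_) (sym (+-suc (n / 32) 5)) ⟩
  2 ^ (n / 32 + 6) ∎
  where open ≤-Reasoning

module Assembly (r : ℕ) (3≤r : 3 ≤ r) where

  1≤r : 1 ≤ r
  1≤r = ≤-trans (s≤s z≤n) 3≤r

  -- The vertices of at most n / 192 progressions number at most n / 64, the same share as is
  -- granted to missing and to untyped elements.
  ν : ℕ
  ν = 192

  open MixedCase r ν 1≤r (s≤s z≤n) using (h₁; h₂; c₁; c₂; mixed-case; module S₁; module S₂)

  abstract
    -- K is a multiple of ν, c₂, c₁ and 8 with cofactor at least 4, so each saving n / c is at least
    -- 4 n / K. H makes both a description of 3 n / H bits and the charge r per untyped element at
    -- most n / (4 K).
    K H : ℕ
    K = 4 * c₁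
    H = 12 * (r * K)

    K≡ : c₁ * 4 ≡ K
    K≡ = *-comm c₁ 4

    H≡ : H ≡ 12 * (r * K)
    H≡ = refl

  private
    R : ℕ
    R = length (allMarks r)

    1≤c₁ : 1 ≤ c₁
    1≤c₁ = S₂.1≤gap

    1≤c₂ : 1 ≤ c₂
    1≤c₂ = S₁.1≤gap

    instance
      c₁≢0 : NonZero c₁
      c₁≢0 = >-nonZero 1≤c₁
      c₂≢0 : NonZero c₂
      c₂≢0 = >-nonZero 1≤c₂

    abstract
      κ₂ κ₁ κ₈ : ℕ
      κ₂ = 4 * (2 * 6 * R * (6 * c₂))
      κ₁ = 2 * 6 * R * (6 * ν) * κ₂
      κ₈ = 6 * c₂ * R * (6 * c₂)

      K≡₂ : c₂ * κ₂ ≡ K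
      K≡₂ = trans (eq c₂ R) (trans (cong (4 *_) (sym S₂.gap≡)) (trans (*-comm 4 c₁) K≡))
        where
        eq : ∀ c R → c * (4 * (2 * 6 * R * (6 * c))) ≡ 4 * (2 * (6 * c) * R * (6 * c))
        eq = solve-∀

      K≡₁ : ν * κ₁ ≡ K
      K≡₁ = trans (eq ν R κ₂) (trans (cong (_* κ₂) {x = 2 * (6 * ν) * R * (6 * ν)} {y = c₂} (sym S₁.gap≡)) K≡₂)
        where
        eq : ∀ ν R κ → ν * (2 * 6 * R * (6 * ν) * κ) ≡ 2 * (6 * ν) * R * (6 * ν) * κ
        eq = solve-∀

      K≡₈ : 8 * κ₈ ≡ K
      K≡₈ = trans (eq c₂ R) (trans (cong (4 *_) (sym S₂.gap≡)) (trans (*-comm 4 c₁) K≡))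
        where
        eq : ∀ c R → 8 * (6 * c * R * (6 * c)) ≡ 4 * (2 * (6 * c) * R * (6 * c))
        eq = solve-∀

      4≤κ₂ : 4 ≤ κ₂
      4≤κ₂ = m≤m*n 4 (2 * 6 * R * (6 * c₂)) {{>-nonZero (1≤* {2 * 6 * R} {6 * c₂} (1≤* {2 * 6} {R} (s≤s z≤n) (1≤allMarks r)) (1≤* {6} {c₂} (s≤s z≤n) 1≤c₂))}}

      4≤κ₁ : 4 ≤ κ₁
      4≤κ₁ = ≤-trans 4≤κ₂ (m≤n*m κ₂ (2 * 6 * R * (6 * ν)) {{>-nonZero (1≤* {2 * 6 * R} {6 * ν} (1≤* {2 * 6} {R} (s≤s z≤n) (1≤allMarks r)) (s≤s z≤n))}})

      8≤κ₈ : 8 ≤ κ₈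
      8≤κ₈ = ≤-trans (m≤m+n 8 28) (*-mono-≤ {6} {6 * c₂ * R} {6} {6 * c₂}
        (*-mono-≤ {6} {6 * c₂} {1} {R} (m≤m*n 6 c₂) (1≤allMarks r)) (m≤m*n 6 c₂))

    4≤κ₈ : 4 ≤ κ₈
    4≤κ₈ = ≤-trans (m≤m+n 4 4) 8≤κ₈

  64≤K : 64 ≤ K
  64≤K = ≤-trans (*-monoʳ-≤ 8 8≤κ₈) (≤-reflexive K≡₈)

  Multicolored : Subset n → Vec (Col r) n → Set
  Multicolored A f = ¬ (∃ λ a → ∃ λ b → a Fin.< b × TwoColored A a b f)

  module Exponents (n e₀ : ℕ) (12K≤n : 12 * K ≤ n) (e₀≤ : 4 * (K * e₀) ≤ n) where

    instance
      4K≢0 : NonZero (4 * K)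
      4K≢0 = >-nonZero (1≤* {4} (s≤s z≤n) (≤-trans (s≤s z≤n) 64≤K))

    E : ℕ
    -- Each class saves 3 n / (4 K). One third remains as the final saving, one pays the e₀ bits
    -- describing p, and one, being at least 3, covers the number of classes.
    E = n ∸ (n / (4 * K) + e₀ + 3)

    K≤n : K ≤ n
    K≤n = ≤-trans (m≤n*m K 12) 12K≤n

    fits : ∀ x → 4 * (K * x) + 3 * n ≤ 4 * (K * n) → 2 ^ x ≤ 2 ^ E
    fits x h = ^-monoʳ-≤ 2 (m+n≤o⇒m≤o∸n x (*-cancelˡ-≤ (4 * K) (farkas 0 (h ⊕ m/n*n≤m n (4 * K) ⊕ e₀≤ ⊕ 12K≤n) (eq K x n (n / (4 * K)) e₀))))
      where
      eq : ∀ K x n q e → 4 * K * (x + (q + e + 3)) + (4 * (K * n) + (n + (n + n))) + 0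
           ≡ 4 * K * n + (4 * (K * x) + 3 * n + (q * (4 * K) + (4 * (K * e) + 12 * K)))
      eq = solve-∀

    module Lists (A : Subset n) (p : Partial r n) (unt : # (Untyped? p A) * H ≤ 3 * n) where

      private
        U m : ℕ
        U = r * # (Untyped? p A)
        m = # (Missing? A)

        U≤ : 4 * (K * U) ≤ n
        U≤ = *-cancelˡ-≤ 3 (≤-trans (≤-reflexive (trans (eq K r (# (Untyped? p A))) (cong (# (Untyped? p A) *_) (sym H≡)))) unt)
          where
          eq : ∀ K r u → 3 * (4 * (K * (r * u))) ≡ u * (12 * (r * K))
          eq = solve-∀

        ∣A∣≤n : ∣ A ∣ ≤ n
        ∣A∣≤n = ≤-trans (m≤m+n ∣ A ∣ m) (≤-reflexive (∣A∣+∁ A))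

        a≤ : capacity A p ≤ n + U
        a≤ = +-monoˡ-≤ U ∣A∣≤n

      -- Here |A| alone is small enough: n - |A| > n / 64 ≥ n / K exceeds the charge n / (4 K) for
      -- untyped elements by 3 n / (4 K).
      thin : ¬ (m * 64 ≤ n) → Bounded (colors r) (λ f → Good {r} A f × Agree p f) (2 ^ E)
      thin ¬dense = Bounded-mono (λ _ h → h)
        (≤-trans (*-monoʳ-≤ (2 ^ ∣ A ∣) (r^≤2^ r (# (Untyped? p A))))
          (≤-trans (≤-reflexive (sym (^-distribˡ-+-* 2 ∣ A ∣ U))) (fits (∣ A ∣ + U) (subst (λ z → 4 * (K * (∣ A ∣ + U)) + 3 * z ≤ 4 * (K * z)) (∣A∣+∁ A) h))))
        (typed-bound 1≤r A p)
        where
        open ≤-Reasoning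
        n≤64m : ∣ A ∣ + m ≤ m * 64
        n≤64m = ≤-trans (≤-reflexive (∣A∣+∁ A)) (<⇒≤ (≰⇒> ¬dense))
        U≤′ : 4 * (K * U) ≤ ∣ A ∣ + m
        U≤′ = ≤-trans U≤ (≤-reflexive (sym (∣A∣+∁ A)))
        h : 4 * (K * (∣ A ∣ + U)) + 3 * (∣ A ∣ + m) ≤ 4 * (K * (∣ A ∣ + m))
        h = farkas 0 (U≤′ ⊕ (4 ⊗ n≤64m) ⊕ ((4 * m) ⊗ 64≤K)) (eq K U (∣ A ∣) m)
          where
          eq : ∀ K U a m → 4 * (K * (a + U)) + 3 * (a + m) + (a + m + (4 * (m * 64) + 4 * m * K)) + 0
               ≡ 4 * (K * (a + m)) + (4 * (K * U) + (4 * (a + m) + 4 * m * 64))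
          eq = solve-∀

      mixed : h₁ ≤ n → h₂ ≤ n → (M : List (Mixed A p)) → Matching M → length M ≡ n / ν →
              Bounded (colors r) (λ f → Good {r} A f × Agree p f) (3 * 2 ^ E)
      mixed h₁≤n h₂≤n M mat len =
        let (e₁ , e₂ , le₁ , le₂ , bound) = mixed-case A p M mat h₁≤n h₂≤n
        in Bounded-mono (λ _ h → h) (≤-trans (+-mono-≤ (+-mono-≤
             (≤-trans (≤-reflexive (trans (cong (λ z → 2 ^ e₁ * 2 ^ (capacity A p ∸ z)) len) (sym (^-distribˡ-+-* 2 e₁ _))))
               (fits _ (saving ν κ₁ 4≤κ₁ K≡₁ K≤n (third ν e₁ le₁) U≤ a≤)))
             (≤-trans (≤-reflexive (sym (^-distribˡ-+-* 2 e₂ _)))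
               (fits _ (saving c₂ κ₂ 4≤κ₂ K≡₂ K≤n (third c₂ e₂ le₂) U≤ a≤))))
             (fits _ (saving c₁ 4 {e = 0} ≤-refl K≡ K≤n (≤-trans (≤-reflexive (*-zeroʳ (2 * c₁))) z≤n) U≤ a≤)))
             (≤-reflexive (eq (2 ^ E)))) bound
        where
        eq : ∀ x → x + x + x ≡ 3 * x
        eq = solve-∀
        third : ∀ c e → e * (6 * c) ≤ 3 * n → 2 * c * e ≤ n
        third c e h = *-cancelˡ-≤ 3 (≤-trans (≤-reflexive (eq′ c e)) h)
          where
          eq′ : ∀ c e → 3 * (2 * c * e) ≡ e * (6 * c)
          eq′ = solve-∀

      -- By maximality every progression in X has a constant type. Missing elements, untyped
      -- elements and vertices of M are at most n / 64 each, so X is dense enough for all its types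
      -- to be equal to one pair, and a multicolored f has an element of a third color.
      unmixed : 192 ≤ n → m * 64 ≤ n → (M : List (Mixed A p)) → length M ≤ n / ν → (∀ x y z → ¬ Extends M x y z) →
                Bounded (colors r) (λ f → Good {r} A f × Agree p f × Multicolored A f) (2 ^ E)
      unmixed n≥ dense M len maximal = by constant
        where
        X : Fin n → Set
        X v = (v ∈ A × Typed p v) × ¬ v ∈L vertices M
        X? : ∀ v → Dec (X v)
        X? v = ((v ∈? A) ×-dec Typed? p v) ×-dec ¬? (v ∈L? vertices M)
        c≤ : # (¬? ∘ X?) ≤ m + (# (Untyped? p A) + 3 * length M)
        c≤ = ≤-trans (#-⊎ (¬? ∘ X?) (Missing? A) (λ v → Untyped? p A v ⊎-dec (v ∈L? vertices M)) split)
          (+-monoʳ-≤ m (≤-trans (#-⊎ (λ v → Untyped? p A v ⊎-dec (v ∈L? vertices M)) (Untyped? p A) (λ v → v ∈L? vertices M) λ _ → id)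
            (+-monoʳ-≤ (# (Untyped? p A)) (≤-trans (#-list (λ v → v ∈L? vertices M) (vertices M) λ _ → id) (≤-reflexive (length-vertices M))))))
          where
          split : ∀ v → ¬ X v → v ∉ A ⊎ (v ∈ A × ¬ Typed p v) ⊎ v ∈L vertices M
          split v ¬x with v ∈? A
          ... | no v∉A = inj₁ v∉A
          ... | yes v∈A with Typed? p v
          ...   | no ¬t = inj₂ (inj₁ (v∈A , ¬t))
          ...   | yes t = inj₂ (inj₂ (decidable-stable (v ∈L? vertices M) λ ¬v → ¬x ((v∈A , t) , ¬v)))
        unt≤ : 64 * # (Untyped? p A) ≤ n
        unt≤ = ≤-trans (≤-trans (*-monoˡ-≤ (# (Untyped? p A)) 64≤K) (≤-trans (m≤n*m _ r {{>-nonZero 1≤r}})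
          (≤-trans (≤-reflexive (eq r K (# (Untyped? p A)))) (m≤n*m _ 4)))) U≤
          where
          eq : ∀ r K u → r * (K * u) ≡ K * (r * u)
          eq = solve-∀
        X-dense : # (¬? ∘ X?) * 16 ≤ n
        X-dense = *-cancelˡ-≤ 4 (farkas n ((64 ⊗ c≤) ⊕ dense ⊕ unt≤ ⊕ (192 ⊗ len) ⊕ m/n*n≤m n ν) (eq (# (¬? ∘ X?)) m (# (Untyped? p A)) (length M) (n / ν) n))
          where
          eq : ∀ c m u l q n → 4 * (c * 16) + (64 * (m + (u + 3 * l)) + (n + (n + (192 * q + n)))) + n ≡ 4 * n + (64 * c + (m * 64 + (64 * u + (192 * l + q * 192))))
          eq = solve-∀
        same : ∀ x y z → X x → X y → X z → Mid x y z → x ≢ z → type p x ≡ type p y × type p y ≡ type p z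
        same x y z ((x∈ , tx) , ¬x) ((y∈ , ty) , ¬y) ((z∈ , tz) , ¬z) mid x≢z with Fin.<-cmp x y
        ... | tri< x<y _ _ = decidable-stable ((type p x ≟ᵗ type p y) ×-dec (type p y ≟ᵗ type p z))
              λ ne → maximal x y z ((x<y , mid , (x∈ , y∈ , z∈) , (tx , ty , tz) , ne) , ¬x , ¬y , ¬z)
        ... | tri≈ _ refl _ = ⊥-elim (proj₁ (proj₁ (Mid⇒AP3 x≢z mid)) refl)
        ... | tri> _ _ y<x = decidable-stable ((type p x ≟ᵗ type p y) ×-dec (type p y ≟ᵗ type p z))
              λ ne → maximal z y x ((z<y , Mid-sym {x = x} {y} {z} mid , (z∈ , y∈ , x∈) , (tz , ty , tx) , λ (e , e′) → ne (sym e′ , sym e)) , ¬z , ¬y , ¬x)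
          where
          z<y : z Fin.< y
          z<y = +-cancelˡ-< (toℕ y) _ _ (<-≤-trans (+-monoˡ-< (toℕ z) y<x)
                  (≤-reflexive (trans mid (cong (toℕ y +_) (+-identityʳ _)))))
        open Connected X? X-dense (≤-trans (m≤m+n 9 183) n≥) (type p) same using (constant)
        by : (∃ λ i → X i × ∀ x → X x → type p x ≡ type p i) →
             Bounded (colors r) (λ f → Good {r} A f × Agree p f × Multicolored A f) (2 ^ E)
        by (i , ((i∈A , ti) , _) , const) with type-typed p i ti
        ... | a , b , e = Bounded-mono third (≤-trans (*-monoˡ-≤ (2 ^ (capacity A p ∸ n / 8)) (n≤2^ n))
              (≤-trans (≤-reflexive (sym (^-distribˡ-+-* 2 (n / 32 + 6) (capacity A p ∸ n / 8))))
                (fits (n / 32 + 6 + (capacity A p ∸ n / 8)) (saving 8 κ₈ {e = n / 32 + 6} 4≤κ₈ K≡₈ K≤n small U≤ a≤))))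
              (SameType.third-color-bound 1≤r A p a b X? (λ v xv → proj₁ (proj₁ xv) , trans (const v xv) e) X-dense)
          where
          small : 16 * (n / 32 + 6) ≤ n
          small = *-cancelˡ-≤ 2 (farkas 0 (m/n*n≤m n 32 ⊕ n≥) (eq n (n / 32)))
            where
            eq : ∀ n q → 2 * (16 * (q + 6)) + (n + n) + 0 ≡ 2 * n + (q * 32 + 192)
            eq = solve-∀
          third : ∀ f → Good A f × Agree p f × Multicolored A f → ∃ λ x → Good A f × Agree p f × (x ∈ A × lookup f x ≢ a × lookup f x ≢ b)
          third f (good , ag , multi) = found (Fin.any? λ x → (x ∈? A) ×-dec ¬? (lookup f x Fin.≟ a) ×-dec ¬? (lookup f x Fin.≟ b))
            where
            two : ∀ a b → a ≢ zero → a Fin.< b → (∀ x → x ∈ A → lookup f x ≡ a ⊎ lookup f x ≡ b) → ⊥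
            two zero    _       ne _   _ = ne refl
            two (suc a) (suc b) _  a<b h = multi (a , b , s≤s⁻¹ a<b , h)
            found : Dec (∃ λ x → x ∈ A × lookup f x ≢ a × lookup f x ≢ b) → _
            found (yes (x , h)) = x , good , ag , h
            found (no none) = ⊥-elim (let (_ , _ , _ , _ , _ , ne , lt) = type-witness p i e in two a b ne lt all-two)
              where
              all-two : ∀ x → x ∈ A → lookup f x ≡ a ⊎ lookup f x ≡ b
              all-two x x∈A with lookup f x Fin.≟ a | lookup f x Fin.≟ b
              ... | yes ea | _      = inj₁ ea
              ... | no _   | yes eb = inj₂ eb
              ... | no ¬a  | no ¬b  = ⊥-elim (none (x , x∈A , ¬a , ¬b))

module Conclusion (r : ℕ) (3≤r : 3 ≤ r) where

  open Assembly r 3≤r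
  open MixedCase r ν 1≤r (s≤s z≤n) using (h₁; h₂)

  private
    H≥ : 128 * r ≤ H
    H≥ = ≤-trans (≤-trans (*-monoˡ-≤ r (*-mono-≤ {2} {12} (m≤m+n 2 10) 64≤K)) (≤-reflexive (*-assoc 12 K r)))
      (≤-reflexive (trans (cong (12 *_) (*-comm K r)) (sym H≡)))

    1≤H : 1 ≤ H
    1≤H = ≤-trans (1≤* {128} (s≤s z≤n) 1≤r) H≥

  open PoorCase r H (≤-trans (n≤1+n 2) 3≤r) H≥ using (t; 1≤t; poor-n₀; ManyPoor; poor-case)
  module S₀ = Sparse (allMarks r) H (1≤allMarks r) 1≤H
  module Sam = Sampling t H S₀.gap 1≤t 1≤H S₀.1≤gap

  module _ {n} (sample≤n : Sam.n₀ ≤ n) (poor≤n : poor-n₀ ≤ n) (12K≤n : 12 * K ≤ n) (h₁≤n : h₁ ≤ n) (h₂≤n : h₂ ≤ n)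
           (192≤n : 192 ≤ n) (H≤n : H ≤ n) (A : Subset n) (sparse-complement : r ^ (8 * # (Missing? A)) ≤ 2 ^ (3 * n)) where

    private
      4Ke≤ : ∀ {e} → e * H ≤ 3 * n → 4 * (K * e) ≤ n
      4Ke≤ {e} h = *-cancelˡ-≤ 3 (≤-trans (≤-trans (m≤n*m _ r {{>-nonZero 1≤r}}) (≤-reflexive (trans (eq r K e) (cong (e *_) (sym H≡))))) h)
        where
        eq : ∀ r K e → r * (3 * (4 * (K * e))) ≡ e * (12 * (r * K))
        eq = solve-∀

    module _ (e₀ : ℕ) (e₀≤ : e₀ * H ≤ 3 * n) where

      open Exponents n e₀ 12K≤n (4Ke≤ {e₀} e₀≤)

      private
        Class : Partial r n → Vec (Col r) n → Set
        Class p f = Good A f × Agree p f × # (RichUntyped? t A f p) * H ≤ n × Multicolored A f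

        poor : ∀ p → Bounded (colors r) (ManyPoor A p) (2 ^ E)
        poor p = let (e , e≤ , bound) = poor-case poor≤n A sparse-complement p
                 in Bounded-mono (λ _ h → h) (≤-trans (≤-reflexive (sym (^-distribˡ-+-* 2 e (15 * n / 16))))
                      (fits (e + 15 * n / 16) (arith e (15 * n / 16) (4Ke≤ {e} e≤) (m/n*n≤m (15 * n) 16)))) bound
          where
          -- The poor case saves n / 16 ≥ 4 n / K, because K ≥ 64, and spends at most n / (4 K) on
          -- describing q.
          arith : ∀ e y → 4 * (K * e) ≤ n → y * 16 ≤ 15 * n → 4 * (K * (e + y)) + 3 * n ≤ 4 * (K * n)
          arith e y h h′ = *-cancelˡ-≤ 4 (farkas 0 ((4 ⊗ h) ⊕ (K ⊗ h′) ⊕ ((n) ⊗ 64≤K) ⊕ z≤n {48 * n}) (eq K n e y))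
            where
            eq : ∀ K n e y → 4 * (4 * (K * (e + y)) + 3 * n) + (4 * n + (K * (15 * n) + (n * K + 48 * n))) + 0
                 ≡ 4 * (4 * (K * n)) + (4 * (4 * (K * e)) + (K * (y * 16) + (n * 64 + 0)))
            eq = solve-∀

        few-untyped : ∀ p → # (Untyped? p A) * H ≤ 3 * n →
                      Bounded (colors r) (λ f → Good {r} A f × Agree p f × Multicolored A f) (3 * 2 ^ E)
        few-untyped p unt = by (# (Missing? A) * 64 ≤? n)
          where
          open Lists A p unt
          by : Dec (# (Missing? A) * 64 ≤ n) → Bounded (colors r) (λ f → Good {r} A f × Agree p f × Multicolored A f) (3 * 2 ^ E)
          by (no ¬d) = Bounded-mono (λ _ (good , ag , _) → good , ag) (m≤n*m (2 ^ E) 3) (thin ¬d)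
          by (yes d) = by′ (matching (n / ν))
            where
            by′ : _ ⊎ _ → Bounded (colors r) (λ f → Good {r} A f × Agree p f × Multicolored A f) (3 * 2 ^ E)
            by′ (inj₁ (M , mat , len)) = Bounded-mono (λ _ (good , ag , _) → good , ag) ≤-refl
              (mixed h₁≤n h₂≤n M mat len)
            by′ (inj₂ (M , len , max)) = Bounded-mono (λ _ h → h) (m≤n*m (2 ^ E) 3)
              (unmixed 192≤n d M len max)

        -- That few elements are untyped is a property of p, but it is known only through some f; so
        -- it belongs to the class and is decided for each p.
        Rest : Partial r n → Vec (Col r) n → Set
        Rest p f = # (Untyped? p A) * H ≤ 3 * n × Good A f × Agree p f × Multicolored A f

        rest : ∀ p → Bounded (colors r) (Rest p) (3 * 2 ^ E)
        rest p = by (# (Untyped? p A) * H ≤? 3 * n)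
          where
          by : Dec (# (Untyped? p A) * H ≤ 3 * n) → Bounded (colors r) (Rest p) (3 * 2 ^ E)
          by (yes unt) = Bounded-mono (λ _ → proj₂) ≤-refl (few-untyped p unt)
          by (no ¬unt) = Bounded-mono (λ _ h → h) z≤n (Bounded-∅ λ _ → ¬unt ∘ proj₁)

        -- An untyped element is poor of one of the two parities or one of the n / H rich elements
        -- that the sample missed. If neither parity reaches n / H poor elements, at most 3 n / H
        -- are untyped.
        classify : ∀ p f → Class p f → ManyPoor A p f ⊎ Rest p f
        classify p f (good , ag , rich , multi) = by (n ≤? H * # (PoorPar? t A f 0ℙ)) (n ≤? H * # (PoorPar? t A f 1ℙ))
          where
          by : Dec (n ≤ H * # (PoorPar? t A f 0ℙ)) → Dec (n ≤ H * # (PoorPar? t A f 1ℙ)) → ManyPoor A p f ⊎ Rest p f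
          by (yes h) _       = inj₁ (good , ag , rich , 0ℙ , h)
          by (no _)  (yes h) = inj₁ (good , ag , rich , 1ℙ , h)
          by (no ¬h) (no ¬h′) = inj₂ (untyped , good , ag , multi)
            where
            u₀ u₁ u₂ : ℕ
            u₀ = # (PoorPar? t A f 0ℙ)
            u₁ = # (PoorPar? t A f 1ℙ)
            u₂ = # (RichUntyped? t A f p)
            split : ∀ z → z ∈ A × ¬ Typed p z → ((z ∈ A × ¬ (n ≤ t * splits A f z)) × par z ≡ 0ℙ) ⊎
                    (((z ∈ A × ¬ (n ≤ t * splits A f z)) × par z ≡ 1ℙ) ⊎ ((z ∈ A × n ≤ t * splits A f z) × ¬ Typed p z))
            split z (z∈A , ¬t) = at (n ≤? t * splits A f z) (par-split 0ℙ z)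
              where
              at : Dec (n ≤ t * splits A f z) → par z ≡ 0ℙ ⊎ par z ≡ 1ℙ → _
              at (yes ri) _        = inj₂ (inj₂ ((z∈A , ri) , ¬t))
              at (no po)  (inj₁ e) = inj₁ ((z∈A , po) , e)
              at (no po)  (inj₂ e) = inj₂ (inj₁ ((z∈A , po) , e))
            untyped≤ : # (Untyped? p A) ≤ u₀ + (u₁ + u₂)
            untyped≤ = ≤-trans (#-⊎ (Untyped? p A) (PoorPar? t A f 0ℙ) (λ z → PoorPar? t A f 1ℙ z ⊎-dec RichUntyped? t A f p z) split)
              (+-monoʳ-≤ u₀ (#-⊎ (λ z → PoorPar? t A f 1ℙ z ⊎-dec RichUntyped? t A f p z) (PoorPar? t A f 1ℙ) (RichUntyped? t A f p) λ _ → id))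
            arith : ∀ {u a b c h} → u ≤ a + (b + c) → h * a ≤ n → h * b ≤ n → c * h ≤ n → u * h ≤ 3 * n
            arith {u} {a} {b} {c} {h} le ha hb hc = farkas 0 ((h ⊗ le) ⊕ ha ⊕ hb ⊕ hc) (eq n u a b c h)
              where
              eq : ∀ n u a b c h → u * h + (h * (a + (b + c)) + (n + (n + n))) + 0 ≡ 3 * n + (h * u + (h * a + (h * b + c * h)))
              eq = solve-∀
            untyped : # (Untyped? p A) * H ≤ 3 * n
            untyped = arith {a = u₀} {u₁} {u₂} {H} untyped≤ (<⇒≤ (≰⇒> ¬h)) (<⇒≤ (≰⇒> ¬h′)) rich

      class-bound : ∀ p → Bounded (colors r) (Class p) (2 ^ E + 3 * 2 ^ E)
      class-bound p = Bounded-mono (classify p) ≤-refl (Bounded-⊎ (poor p) (rest p))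

      total-exponent : 2 ^ e₀ * (2 ^ E + 3 * 2 ^ E) ≤ 2 ^ (n ∸ n / (4 * K))
      total-exponent = begin
        2 ^ e₀ * (4 * 2 ^ E)  ≡⟨ cong (2 ^ e₀ *_) (^-distribˡ-+-* 2 2 E) ⟨
        2 ^ e₀ * 2 ^ (2 + E)  ≡⟨ ^-distribˡ-+-* 2 e₀ (2 + E) ⟨
        2 ^ (e₀ + (2 + E))    ≤⟨ ^-monoʳ-≤ 2 (m+n≤o⇒m≤o∸n (e₀ + (2 + E)) (farkas 1 (≤-reflexive (m∸n+n≡m room)) (eq (n / (4 * K)) e₀ E n))) ⟩
        2 ^ (n ∸ n / (4 * K)) ∎
        where
        open ≤-Reasoning
        eq : ∀ q e E n → e + (2 + E) + q + n + 1 ≡ n + (E + (q + e + 3))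
        eq = solve-∀
        room : n / (4 * K) + e₀ + 3 ≤ n
        room = *-cancelˡ-≤ (4 * K) (farkas 0 (m/n*n≤m n (4 * K) ⊕ 4Ke≤ {e₀} e₀≤ ⊕ 12K≤n ⊕ ((4 * n) ⊗ ≤-trans (s≤s z≤n) 64≤K) ⊕ z≤n {n}) (eq′ K n (n / (4 * K)) e₀))
          where
          eq′ : ∀ K n q e → 4 * K * (q + e + 3) + (n + (n + (n + (4 * n * K + n)))) + 0
                ≡ 4 * K * n + (q * (4 * K) + (4 * (K * e) + (12 * K + (4 * n * 1 + 0))))
          eq′ = solve-∀

    private
      Goal : Set
      Goal = g r A ≤ (r C 2) * 2 ^ ∣ A ∣ + 2 ^ (n ∸ (n / (4 * K)) {{>-nonZero (1≤* {4} (s≤s z≤n) (≤-trans (s≤s z≤n) 64≤K))}})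

    finite-bound : Goal
    finite-bound = let (e₀ , e₀≤ , count) = S₀.sparse-count n H≤n in assemble e₀ e₀≤ count
      where
      Split-cases : Vec (Col r) n → Set
      Split-cases f = (Good {r} A f × ∃ λ a → ∃ λ b → a Fin.< b × TwoColored A a b f) ⊎
        (∃ λ (p : Partial r n) → # (Marked? p) * S₀.gap ≤ n × Good A f × Agree p f × # (RichUntyped? t A f p) * H ≤ n × Multicolored A f)
      two-colored? : ∀ f → Dec (∃ λ a → ∃ λ b → a Fin.< b × TwoColored {n} {r} A a b f)
      two-colored? f = Fin.any? λ a → Fin.any? λ b → (a Fin.<? b) ×-dec Fin.all? λ i → (i ∈? A) →-dec
                         ((lookup f i Fin.≟ suc a) ⊎-dec (lookup f i Fin.≟ suc b))
      sampled : ∀ f → Good A f → Multicolored A f →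
        (∃ λ (p : Partial r n) → # (Marked? p) * S₀.gap ≤ n × Agree p f × # (RichUntyped? t A f p) * H ≤ n) → Split-cases f
      sampled f good many (p , sp , ag , rich) = inj₂ (p , sp , good , ag , rich , many)
      cases : ∀ f → Good A f → Split-cases f
      cases f good = by (two-colored? f)
        where
        by : Dec (∃ λ a → ∃ λ b → a Fin.< b × TwoColored A a b f) → Split-cases f
        by (yes two) = inj₁ (good , two)
        by (no many) = sampled f good many (Sam.sample sample≤n A good)
      assemble : ∀ e₀ → e₀ * H ≤ 3 * n → sumV (marks (allMarks r)) n (λ p → ⟦ S₀.SparseMarks? p ⟧) ≤ 2 ^ e₀ → Goal
      assemble e₀ e₀≤ count = g-bound A (Bounded-mono cases (+-monoʳ-≤ ((r C 2) * 2 ^ ∣ A ∣) (total-exponent e₀ e₀≤))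
        (Bounded-⊎ (two-colored-bound r A)
          (Bounded-∃ (∈-marks ∈-allMarks) S₀.SparseMarks?
            {λ p f → Good A f × Agree p f × # (RichUntyped? t A f p) * H ≤ n × Multicolored A f}
            (λ p _ → class-bound e₀ e₀≤ p) count)))

  private
    summands : ∀ {a b c d e f g h n} → a + (b + (c + (d + (e + (f + (g + h)))))) ≤ n →
               a ≤ n × b ≤ n × c ≤ n × d ≤ n × e ≤ n × f ≤ n × g ≤ n × h ≤ n
    summands {a} {b} {c} {d} {e} {f} {g} {h} le₀ =
      let le₁ = m+n≤o⇒n≤o a le₀; le₂ = m+n≤o⇒n≤o b le₁; le₃ = m+n≤o⇒n≤o c le₂
          le₄ = m+n≤o⇒n≤o d le₃; le₅ = m+n≤o⇒n≤o e le₄; le₆ = m+n≤o⇒n≤o f le₅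
      in m+n≤o⇒m≤o a le₀ , m+n≤o⇒m≤o b le₁ , m+n≤o⇒m≤o c le₂ , m+n≤o⇒m≤o d le₃ , m+n≤o⇒m≤o e le₄ ,
         m+n≤o⇒m≤o f le₅ , m+n≤o⇒m≤o g le₆ , m+n≤o⇒n≤o g le₆

    -- With t = n / k rounded down, l = 2 k still satisfies n < t l, which is how the saving t is
    -- compared with n / log₂ n.
    double-quotient : ∀ k n .{{_ : NonZero k}} → 2 * k ≤ n → n < n / k * (2 * k)
    double-quotient k n 2k≤n = +-cancelʳ-< n _ _ (begin-strict
      n + n                        <⟨ +-mono-< n< n< ⟩
      n / k * k + k + (n / k * k + k) ≡⟨ eq (n / k) k ⟩
      n / k * (2 * k) + 2 * k      ≤⟨ +-monoʳ-≤ _ 2k≤n ⟩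
      n / k * (2 * k) + n ∎)
      where
      open ≤-Reasoning
      n< : n < n / k * k + k
      n< = ≤-trans (s≤s (≤-reflexive (m≡m%n+[m/n]*n n k))) (≤-trans (+-monoˡ-≤ _ (m%n<n n k)) (≤-reflexive (+-comm k _)))
      eq : ∀ q k → q * k + k + (q * k + k) ≡ q * (2 * k) + 2 * k
      eq = solve-∀

  -- The error term is small enough as soon as log₂ n exceeds the constant l.
  uniform-bound : ∃ λ n₀ → ∀ n → n₀ ≤ n → ∀ (A : Subset n) → r ^ (8 * # (Missing? A)) ≤ 2 ^ (3 * n) →
    ∃ λ t → ∃ λ l → 1 ≤ l × 2 ^ l < n × n < t * l × t ≤ n × g r A ≤ (r C 2) * 2 ^ ∣ A ∣ + 2 ^ (n ∸ t)
  uniform-bound = Sam.n₀ + (poor-n₀ + (12 * K + (h₁ + (h₂ + (192 + (H + suc (2 ^ (2 * (4 * K))))))))) , λ n n≥ A sc → at n A sc (summands n≥)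
    where
    at : ∀ n (A : Subset n) → r ^ (8 * # (Missing? A)) ≤ 2 ^ (3 * n) →
         Sam.n₀ ≤ n × poor-n₀ ≤ n × 12 * K ≤ n × h₁ ≤ n × h₂ ≤ n × 192 ≤ n × H ≤ n × suc (2 ^ (2 * (4 * K))) ≤ n →
         ∃ λ t → ∃ λ l → 1 ≤ l × 2 ^ l < n × n < t * l × t ≤ n × g r A ≤ (r C 2) * 2 ^ ∣ A ∣ + 2 ^ (n ∸ t)
    at n A sc (sa , po , 12K≤n , a , b , c , d , 2^l<n) =
      n / (4 * K) , 2 * (4 * K) , 1≤* {2} (s≤s z≤n) 1≤4K , 2^l<n ,
      double-quotient (4 * K) n (≤-trans (≤-trans (≤-reflexive (sym (*-assoc 2 4 K))) (*-monoˡ-≤ K (m≤m+n 8 4))) 12K≤n) ,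
      m/n≤m n (4 * K) , finite-bound sa po 12K≤n a b c d A sc
      where
      1≤4K : 1 ≤ 4 * K
      1≤4K = 1≤* {4} (s≤s z≤n) (≤-trans (s≤s z≤n) 64≤K)
      instance
        4K≢0 : NonZero (4 * K)
        4K≢0 = >-nonZero 1≤4K

open import Defs

theorem1p2 : (r : ℕ) (3≤r : 3 ≤ r) →
    let instance
          nonTrivial-r : NonTrivial r
          nonTrivial-r = n>1⇒nonTrivial (<⇒≤ 3≤r)
    in
    (ξ : ℝ) → fromℕ 0 <ᴿ ξ → ξ ≤ᴿ 3 · (fromℕ 13 +ᴿ 8 · log₂ r) ⁻¹ →
    ∃ λ n₀ → (n : ℕ) .{{_ : NonTrivial n}} → n₀ ≤ n →
    (A : Subset n) → n · (fromℕ 1 -ᴿ ξ) ≤ᴿ fromℕ ∣ A ∣ →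
    fromℕ (g r A) ≤ᴿ
      fromℕ ((r C 2) * 2 ^ ∣ A ∣) +ᴿ (2 ^ n) · 2^ᴿ (-ᴿ (n · (36 · log₂ n) ⁻¹))
theorem1p2 r 3≤r ξ 0<ξ ξ≤ =
  -- The threshold depends on r only; ξ enters later, through the density of A.
  let (n₀ , bound) = Conclusion.uniform-bound r 3≤r
  in n₀ , λ n n₀≤n A dense → transfer n A dense (bound n n₀≤n A)
  where
  instance
    nonTrivial-r : NonTrivial r
    nonTrivial-r = n>1⇒nonTrivial (<⇒≤ 3≤r)
  transfer : ∀ n .{{_ : NonTrivial n}} (A : Subset n) → n · (fromℕ 1 -ᴿ ξ) ≤ᴿ fromℕ ∣ A ∣ →
    (r ^ (8 * # (Missing? A)) ≤ 2 ^ (3 * n) →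
     ∃ λ t → ∃ λ l → 1 ≤ l × 2 ^ l < n × n < t * l × t ≤ n × g r A ≤ (r C 2) * 2 ^ ∣ A ∣ + 2 ^ (n ∸ t)) →
    fromℕ (g r A) ≤ᴿ
      fromℕ ((r C 2) * 2 ^ ∣ A ∣) +ᴿ (2 ^ n) · 2^ᴿ (-ᴿ (n · (36 · log₂ n) ⁻¹))
  transfer n A dense bound =
    let (t , l , 1≤l , 2^l<n , n<tl , t≤n , g≤) =
          bound (Reals.density r (# (Missing? A)) n ∣ A ∣ (≤-trans (s≤s z≤n) (nonTrivial⇒n>1 n)) (∣A∣+∁ A) ξ ξ≤ dense)
    in Reals.conclude n (g r A) ((r C 2) * 2 ^ ∣ A ∣) t l 1≤l 2^l<n n<tl t≤n g≤
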